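{- Consider the random graph process $(G_t(n))_{t=0}^{\binom n2}$. Let $\tau_{\mathcal S}$ be the smallest $t$ such that $G_t(n)$ has no stable cut, and let $\tau_{\mathcal T}$ be the smallest $t$ such that every vertex of $G_t(n)$ lies in a triangle. Then asymptotically almost surely $\tau_{\mathcal S}=\tau_{\mathcal T}$.
   Context: The random graph process starts with $G_0(n)$ the empty graph on $n$ vertices, and for each $t\ge1$, $G_t(n)$ is obtained from $G_{t-1}(n)$ by adding an edge chosen uniformly at random among the non-edges of $G_{t-1}(n)$, independently of previous choices. A stable cut in a graph $G$ is a set $S$ of vertices such that $S$ is a stable (independent) set and $G-S$ is disconnected. "Asymptotically almost surely" means with probability tending to $1$ as $n\to\infty$. -}

module Defs where

open import Data.Nat using (ℕ; _*_; _<_; _≤_; _!)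
open import Data.Nat.Combinatorics using (_C_)
open import Data.Fin using (Fin; _<?_)
open import Data.Fin.Subset using (Subset; _∈_; _∉_)
open import Data.List using (List; filter; cartesianProduct; allFin; take; length)
open import Data.List.Membership.Propositional using () renaming (_∈_ to _∈ₗ_)
open import Data.List.Relation.Binary.Permutation.Propositional using (_↭_)
open import Data.Product using (_×_; _,_; proj₁; proj₂; ∃; ∃-syntax; Σ)
open import Data.Sum using (_⊎_)
open import Relation.Nullary using (¬_)

-- An edge of the complete graph on vertex set Fin n, written (i , j) with i < j.
Edge : ℕ → Set
Edge n = Fin n × Fin n

allEdges : (n : ℕ) → List (Edge n)
allEdges n = filter (λ p → proj₁ p <? proj₂ p) (cartesianProduct (allFin n) (allFin n))

-- An outcome of the random graph process on n vertices is an ordering σ of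
-- all edges of K_n (a permutation of allEdges n); G_t is formed by the
-- first t edges of σ. The process is uniform over all (n C 2)! orderings.
Ordering : ℕ → Set
Ordering n = List (Edge n)

IsOrdering : (n : ℕ) → Ordering n → Set
IsOrdering n σ = σ ↭ allEdges n

Adj : {n : ℕ} → Ordering n → ℕ → Fin n → Fin n → Set
Adj σ t u v = ((u , v) ∈ₗ take t σ) ⊎ ((v , u) ∈ₗ take t σ)

data PathAvoiding {n : ℕ} (A : Fin n → Fin n → Set) (S : Subset n) : Fin n → Fin n → Set where
  here : ∀ {u} → u ∉ S → PathAvoiding A S u u
  step : ∀ {u v w} → u ∉ S → A u v → PathAvoiding A S v w → PathAvoiding A S u w

Stable : {n : ℕ} → (Fin n → Fin n → Set) → Subset n → Set
Stable A S = ∀ u v → u ∈ S → v ∈ S → ¬ A u v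

DisconnectedMinus : {n : ℕ} → (Fin n → Fin n → Set) → Subset n → Set
DisconnectedMinus A S = ∃[ u ] ∃[ v ] (u ∉ S × v ∉ S × ¬ PathAvoiding A S u v)

StableCut : {n : ℕ} → (Fin n → Fin n → Set) → Subset n → Set
StableCut A S = Stable A S × DisconnectedMinus A S

HasNoStableCut : {n : ℕ} → Ordering n → ℕ → Set
HasNoStableCut {n} σ t = ¬ (Σ (Subset n) λ S → StableCut (Adj σ t) S)

EveryVertexInTriangle : {n : ℕ} → Ordering n → ℕ → Set
EveryVertexInTriangle {n} σ t =
  ∀ (u : Fin n) → ∃[ v ] ∃[ w ] (Adj σ t u v × Adj σ t v w × Adj σ t u w)

IsFirst : (ℕ → Set) → ℕ → Set
IsFirst P t = P t × (∀ s → s < t → ¬ P s)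

HittingTimesEqual : {n : ℕ} → Ordering n → Set
HittingTimesEqual σ = ∃[ t ] (IsFirst (HasNoStableCut σ) t × IsFirst (EveryVertexInTriangle σ) t)

-- "a.a.s. P": for every k ≥ 1 there is N such that for all n ≥ N the number
-- of orderings violating P is < (1/k) · (n C 2)!. The violating orderings are
-- counted by exhibiting a list B covering all of them with k · |B| < (n C 2)!.
AAS : (P : {n : ℕ} → Ordering n → Set) → Set
AAS P = ∀ (k : ℕ) → 1 ≤ k → ∃[ N ] ∀ (n : ℕ) → N ≤ n →
  Σ (List (Ordering n)) λ B →
    (∀ σ → IsOrdering n σ → ¬ P σ → σ ∈ₗ B) × (k * length B < ((n C 2) !))

-- An uncovered vertex yields a stable cut, its neighbourhood, so only the cuts at
-- the first time τ at which every vertex lies in a triangle must be excluded. Such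
-- a cut consists of a stable set S separating A from B.
--
-- Let N be the number of pairs of vertices and ignore powers of log n. A fixed
-- vertex is typically uncovered at a time T + T slightly below n^(4/3), and at a time
-- t slightly above n^(4/3) all vertices are covered, so τ lies between the two. At
-- time T every set of a ≤ a⋆ vertices has at least aD neighbours, where D is about
-- n^(1/3) and a⋆D > 2n/3. Hence one side of the cut, say A, has at most a⋆ elements,
-- and since the edges between T and T + T typically destroy the stability of N(A)
-- if a₀ ≤ |A|, the set A is of polylogarithmic size.
--
-- Now delete the set F of all edges inside A. This uncovers A and otherwise only
-- common neighbours of pairs in A, in total at most M vertices, since codegrees are
-- bounded. So F lies inside a set of M vertices determined by the ordering without F.
-- Moving F behind the other edges of the first t shows that this has probability at
-- most (t M² / N)^|F|, and |F| ≥ 1 because the vertices of A are covered.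

module Submission where

open import Defs
open import Data.Bool.Base using (Bool; true; false; not; _∧_; _∨_; if_then_else_)
import Data.Bool.Properties as BP
open import Data.Bool.Properties using (∧-comm; ∧-identityʳ; ∧-zeroʳ; ∨-comm)
open import Data.Empty using (⊥; ⊥-elim)
open import Data.Fin.Base as F using (Fin; zero; suc; fromℕ<)
import Data.Fin.Properties as FP
open import Data.Fin.Subset using (Subset) renaming (_∈_ to _∈ˢ_; _∉_ to _∉ˢ_)
open import Data.Fin.Subset.Properties using () renaming (_∈?_ to _∈ˢ?_)
open import Data.List.Base hiding (any; all; lookup; sum; find; tabulate)
import Data.List.Membership.DecPropositional as DecMembership
open import Data.List.Membership.Propositional using (find; lose) renaming (_∈_ to _∈ₗ_)
open import Data.List.Membership.Propositional.Properties using (∈-map⁺; ∈-map⁻; ∈-++⁺ˡ; ∈-++⁺ʳ; ∈-++⁻; ∈-∃++; ∈-concatMap⁺; ∈-concatMap⁻; ∈-filter⁻; ∈-allFin; ∈-cartesianProduct⁺; ∈-upTo⁺; ∈-upTo⁻)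
import Data.List.Properties as LP
open import Data.List.Properties using (length-map; length-++; length-take; length-replicate; length-tabulate; length-upTo; take++drop≡id; filter-++; ++-assoc; ++-identityʳ)
open import Data.List.Relation.Binary.Permutation.Propositional as Perm using (_↭_; prep; ↭-refl; ↭-sym; ↭-trans; ↭-reflexive)
open import Data.List.Relation.Binary.Permutation.Propositional.Properties as PermP using (∈-resp-↭; drop-mid; ↭-length; shift; ↭-empty-inv)
import Data.List.Relation.Unary.All as All
open import Data.List.Relation.Unary.AllPairs using ([]; _∷_)
open import Data.List.Relation.Unary.Any using (here; there)
open import Data.List.Relation.Unary.Unique.Propositional using (Unique)
import Data.List.Relation.Unary.Unique.Propositional.Properties as Uniq
open import Data.Nat.Base hiding (Ordering)
open import Data.Nat.Combinatorics using (_C_; nC1≡n; nCk+nC[k+1]≡[n+1]C[k+1])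
open import Data.Nat.DivMod using (_/_; _%_; m≡m%n+[m/n]*n; m%n<n; m/n*n≤m)
open import Data.Nat.Properties
open import Data.Nat.Tactic.RingSolver using (solve-∀)
open import Data.Product.Base using (Σ; ∃; ∃₂; _×_; _,_; proj₁; proj₂; uncurry)
open import Data.Product.Properties using (≡-dec)
open import Data.Sum.Base using (_⊎_; inj₁; inj₂)
open import Data.Unit.Base using (⊤; tt)
open import Data.Vec.Base using (tabulate)
open import Data.Vec.Properties using (lookup⇒[]=; []=⇒lookup; lookup∘tabulate)
open import Function.Base using (_∘_; id; const; flip; _|>_)
open import Relation.Binary.Definitions using (DecidableEquality; tri<; tri≈; tri>)
open import Relation.Binary.PropositionalEquality
open import Relation.Nullary using (¬_; Dec; yes; no; does)
open import Relation.Nullary.Decidable using (True; T?; toWitness; dec-true; dec-false; decidable-stable; ¬¬-excluded-middle)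
open import Relation.Nullary.Negation using (¬¬-map)

-- A probability is a proportion of orderings: an event is covered by a list whose length is bounded
-- with denominators multiplied out. All estimates come from revealing the ordering one edge at a
-- time, without replacement; conditioning means fixing a prefix.
--
-- Stability of N(A) is tested in two rounds: the first `T` edges fix the neighbourhood, and the
-- later ones are fresh. For |A| = a, N(A) contains about (aD)² pairs, so a union over n^a sets is
-- affordable once `a` exceeds a power of log n. Below that it cannot be: until τ some vertex is
-- uncovered, and its neighbourhood is stable.
--
-- For small A, one prescribed edge among the first `t` gains only about n^(2/3), less than the
-- factor n for choosing a single vertex of A. So A must be read off from the other edges. Neither A
-- nor τ is available once F is removed; therefore the confining set `critical` is selected by its
-- size alone, and the monotonicity of uncovered sets ensures that it contains A. The union then
-- runs over |F| only.

private
  variable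
    A B : Set
    n : ℕ

-- Counting in lists, and powers

⟦_⟧ : Bool → ℕ
⟦ true ⟧ = 1
⟦ false ⟧ = 0

cnt : (A → Bool) → List A → ℕ
cnt f [] = 0
cnt f (x ∷ xs) = ⟦ f x ⟧ + cnt f xs

⟦⟧≤1 : ∀ b → ⟦ b ⟧ ≤ 1
⟦⟧≤1 true = ≤-refl
⟦⟧≤1 false = z≤n

⟦⟧-mono : ∀ {b c} → (b ≡ true → c ≡ true) → ⟦ b ⟧ ≤ ⟦ c ⟧
⟦⟧-mono {false} _ = z≤n
⟦⟧-mono {true} h rewrite h refl = ≤-refl

exchange : ∀ a b c → a + (b + c) ≡ b + (a + c)
exchange = solve-∀

interchange : ∀ a b c d → (a + b) + (c + d) ≡ (a + c) + (b + d)
interchange = solve-∀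

cnt-++ : ∀ (f : A → Bool) xs ys → cnt f (xs ++ ys) ≡ cnt f xs + cnt f ys
cnt-++ f [] ys = refl
cnt-++ f (x ∷ xs) ys = trans (cong (⟦ f x ⟧ +_) (cnt-++ f xs ys)) (sym (+-assoc ⟦ f x ⟧ _ _))

cnt-↭ : ∀ (f : A → Bool) {xs ys} → xs ↭ ys → cnt f xs ≡ cnt f ys
cnt-↭ f Perm.refl = refl
cnt-↭ f (prep x p) = cong (⟦ f x ⟧ +_) (cnt-↭ f p)
cnt-↭ f (Perm.swap {xs = xs} x y p) =
  trans (exchange ⟦ f x ⟧ ⟦ f y ⟧ (cnt f xs)) (cong (λ z → ⟦ f y ⟧ + (⟦ f x ⟧ + z)) (cnt-↭ f p))
cnt-↭ f (Perm.trans p q) = trans (cnt-↭ f p) (cnt-↭ f q)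

cnt-mono : ∀ (f g : A → Bool) xs → (∀ x → x ∈ₗ xs → f x ≡ true → g x ≡ true) → cnt f xs ≤ cnt g xs
cnt-mono f g [] h = z≤n
cnt-mono f g (x ∷ xs) h =
  +-mono-≤ (⟦⟧-mono (h x (here refl))) (cnt-mono f g xs (λ y y∈ → h y (there y∈)))

cnt-cong : ∀ {f g : A → Bool} → (∀ x → f x ≡ g x) → ∀ xs → cnt f xs ≡ cnt g xs
cnt-cong h [] = refl
cnt-cong h (x ∷ xs) = cong₂ _+_ (cong ⟦_⟧ (h x)) (cnt-cong h xs)

cnt-const-true : ∀ (xs : List A) → cnt (const true) xs ≡ length xs
cnt-const-true [] = refl
cnt-const-true (x ∷ xs) = cong suc (cnt-const-true xs)

cnt≤length : ∀ (f : A → Bool) xs → cnt f xs ≤ length xs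
cnt≤length f [] = z≤n
cnt≤length f (x ∷ xs) = +-mono-≤ (⟦⟧≤1 (f x)) (cnt≤length f xs)

⟦⟧-not : ∀ b → ⟦ b ⟧ + ⟦ not b ⟧ ≡ 1
⟦⟧-not true = refl
⟦⟧-not false = refl

cnt-not : ∀ (f : A → Bool) xs → cnt f xs + cnt (not ∘ f) xs ≡ length xs
cnt-not f [] = refl
cnt-not f (x ∷ xs) =
  trans (interchange ⟦ f x ⟧ _ _ _) (cong₂ _+_ (⟦⟧-not (f x)) (cnt-not f xs))

cnt≡length-filter : ∀ (f : A → Bool) xs → length (filterᵇ f xs) ≡ cnt f xs
cnt≡length-filter f [] = refl
cnt≡length-filter f (x ∷ xs) with f x
... | true = cong suc (cnt≡length-filter f xs)
... | false = cnt≡length-filter f xs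

cnt-zero : ∀ (f : A → Bool) xs → (∀ x → x ∈ₗ xs → f x ≡ false) → cnt f xs ≡ 0
cnt-zero f [] h = refl
cnt-zero f (x ∷ xs) h rewrite h x (here refl) = cnt-zero f xs (λ y y∈ → h y (there y∈))

cnt-pos : ∀ (f : A → Bool) {xs x} → x ∈ₗ xs → f x ≡ true → 1 ≤ cnt f xs
cnt-pos f {xs = x ∷ xs} (here refl) fx rewrite fx = s≤s z≤n
cnt-pos f {y ∷ ys} (there x∈) fx = ≤-trans (cnt-pos f x∈ fx) (m≤n+m _ ⟦ f y ⟧)

m≤o*m : ∀ {o} m → 1 ≤ o → m ≤ o * m
m≤o*m {suc o} m _ = m≤m+n m (o * m)

1≤^ : ∀ {x} m → 1 ≤ x → 1 ≤ x ^ m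
1≤^ zero _ = ≤-refl
1≤^ (suc m) 1≤x = *-mono-≤ 1≤x (1≤^ m 1≤x)

^-distribʳ-* : ∀ f a b → (a * b) ^ f ≡ a ^ f * b ^ f
^-distribʳ-* zero a b = refl
^-distribʳ-* (suc f) a b = trans (cong ((a * b) *_) (^-distribʳ-* f a b)) (middle a b (a ^ f) (b ^ f))
  where
  middle : ∀ a b c d → (a * b) * (c * d) ≡ (a * c) * (b * d)
  middle = solve-∀

n<2^n : ∀ n → n < 2 ^ n
n<2^n zero = s≤s z≤n
n<2^n (suc n) = +-mono-≤ (1≤^ {2} n (s≤s z≤n)) (≤-trans (n<2^n n) (m≤m+n _ 0))

-- For `t = 0` powers drop from 1 to 0, but there `f ≤ t` forces both exponents to be 0.
^-monoʳ-≤′ : ∀ {a f t} → a ≤ f → f ≤ t → t ^ a ≤ t ^ f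
^-monoʳ-≤′ {t = zero} z≤n z≤n = ≤-refl
^-monoʳ-≤′ {t = suc t} a≤f _ = ^-monoʳ-≤ (suc t) a≤f

-- Proportions of orderings

-- The possible first draws, each with what is left. Draws are positions rather than values, so that
-- counts over `picks L` are counts over `L`.
picks : List A → List (A × List A)
picks [] = []
picks (x ∷ xs) = (x , xs) ∷ map (λ (y , ys) → y , x ∷ ys) (picks xs)

picks-↭ : ∀ {L : List A} {x rest} → (x , rest) ∈ₗ picks L → x ∷ rest ↭ L
picks-↭ {L = x ∷ xs} (here refl) = ↭-refl
picks-↭ {L = x ∷ xs} (there h) with (y , ys) , h′ , refl ← ∈-map⁻ _ h =
  ↭-trans (Perm.swap y x ↭-refl) (prep x (picks-↭ h′))

length-picks-rest : ∀ {L : List A} {x rest} → (x , rest) ∈ₗ picks L → suc (length rest) ≡ length L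
length-picks-rest h = ↭-length (picks-↭ h)

cnt-picks : ∀ (f : A → Bool) L → cnt (f ∘ proj₁) (picks L) ≡ cnt f L
cnt-picks f [] = refl
cnt-picks f (x ∷ xs) = cong (⟦ f x ⟧ +_) (trans (go (picks xs)) (cnt-picks f xs))
  where
  go : ∀ ps → cnt (f ∘ proj₁) (map (λ (y , ys) → y , x ∷ ys) ps) ≡ cnt (f ∘ proj₁) ps
  go [] = refl
  go (p ∷ ps) = cong (⟦ f (proj₁ p) ⟧ +_) (go ps)

picks-split : ∀ (xs : List A) x ys → (x , xs ++ ys) ∈ₗ picks (xs ++ x ∷ ys)
picks-split [] x ys = here refl
picks-split (w ∷ xs) x ys = there (∈-map⁺ _ (picks-split xs x ys))

picks-complete : ∀ {L : List A} {x σ} → x ∷ σ ↭ L → ∃ λ rest → (x , rest) ∈ₗ picks L × σ ↭ rest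
picks-complete {x = x} p with xs , ys , refl ← ∈-∃++ (∈-resp-↭ p (here refl)) =
  xs ++ ys , picks-split xs x ys , drop-mid [] xs p

-- Among the |L|! orderings of L, those satisfying P make up a proportion at most num / den.
record Bound (L : List A) (P : List A → Set) (num den : ℕ) : Set where
  constructor bound
  field
    list   : List (List A)
    covers : ∀ σ → σ ↭ L → P σ → σ ∈ₗ list
    proportion   : den * length list ≤ num * (length L) !

open Bound

Bound-⊆ : ∀ {L : List A} {P Q num den} → (∀ σ → σ ↭ L → Q σ → P σ) → Bound L P num den → Bound L Q num den
Bound-⊆ h (bound l c s) = bound l (λ σ p q → c σ p (h σ p q)) s

Bound-∅ : ∀ {L : List A} {P num den} → (∀ σ → σ ↭ L → ¬ P σ) → Bound L P num den
Bound-∅ {den = den} h = bound [] (λ σ p q → ⊥-elim (h σ p q)) (≤-trans (≤-reflexive (*-zeroʳ den)) z≤n)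

-- A condition that does not depend on the ordering but is forced by the event may be assumed: if it
-- fails, the event is empty.
Bound-dec : ∀ {L : List A} {P num den} {D : Set} → Dec D → (∀ σ → σ ↭ L → P σ → D) → (D → Bound L P num den) →
  Bound L P num den
Bound-dec (yes d) _ k = k d
Bound-dec (no ¬d) h _ = Bound-∅ (λ σ p q → ¬d (h σ p q))

-- Conditioning on the first draw: a proportion at most `num′ / den′` of the draws is admissible,
-- and after each of them the tail is a uniform ordering of the rest.
Bound-∷ : ∀ {L : List A} {P : List A → Set} {num den num′ den′} (g : A → Bool) →
  1 ≤ length L →
  den′ * cnt g L ≤ num′ * length L →
  (∀ x σ → P (x ∷ σ) → g x ≡ true) →
  (∀ x rest → (x , rest) ∈ₗ picks L → g x ≡ true → Bound rest (P ∘ (x ∷_)) num den) →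
  Bound L P (num′ * num) (den′ * den)
Bound-∷ {L = []} g () few Pg rec
Bound-∷ {A = A} {L = L@(x₀ ∷ xs₀)} {P} {num} {den} {num′} {den′} g 1≤L few Pg rec =
  bound (proj₁ all) cov (final (proj₂ (proj₂ all)))
  where
  ℓ = length xs₀
  go : ∀ ps → (∀ {p} → p ∈ₗ ps → p ∈ₗ picks L) →
       Σ (List (List A)) λ l →
         (∀ x rest σ → (x , rest) ∈ₗ ps → σ ↭ rest → P (x ∷ σ) → (x ∷ σ) ∈ₗ l) ×
         (den * length l ≤ cnt (g ∘ proj₁) ps * (num * ℓ !))
  go [] _ = [] , (λ _ _ _ ()) , ≤-reflexive (*-zeroʳ den)
  go ((x , rest) ∷ ps) ⊆picks with g x in eq | go ps (⊆picks ∘ there)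
  ... | false | l , c , s = l , c′ , s
    where
    c′ : ∀ y rest′ σ → (y , rest′) ∈ₗ (x , rest) ∷ ps → σ ↭ rest′ → P (y ∷ σ) → (y ∷ σ) ∈ₗ l
    c′ y rest′ σ (here refl) _ Pσ with () ← trans (sym eq) (Pg _ _ Pσ)
    c′ y rest′ σ (there h) = c y rest′ σ h
  ... | true | l , c , s = map (x ∷_) (list b) ++ l , c′ , s′
    where
    b = rec x rest (⊆picks (here refl)) eq
    c′ : ∀ y rest′ σ → (y , rest′) ∈ₗ (x , rest) ∷ ps → σ ↭ rest′ → P (y ∷ σ) →
         (y ∷ σ) ∈ₗ map (x ∷_) (list b) ++ l
    c′ y rest′ σ (here refl) p Pσ = ∈-++⁺ˡ (∈-map⁺ (x ∷_) (covers b σ p Pσ))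
    c′ y rest′ σ (there h) p Pσ = ∈-++⁺ʳ _ (c y rest′ σ h p Pσ)
    s′ : den * length (map (x ∷_) (list b) ++ l) ≤ num * ℓ ! + cnt (g ∘ proj₁) ps * (num * ℓ !)
    s′ = begin
      den * length (map (x ∷_) (list b) ++ l)
        ≡⟨ cong (den *_) (trans (length-++ (map (x ∷_) (list b)))
            (cong (_+ length l) (length-map (x ∷_) (list b)))) ⟩
      den * (length (list b) + length l) ≡⟨ *-distribˡ-+ den _ _ ⟩
      den * length (list b) + den * length l
        ≤⟨ +-mono-≤ (proportion b) s ⟩
      num * length rest ! + _
        ≡⟨ cong (λ z → num * z ! + cnt (g ∘ proj₁) ps * (num * ℓ !))
            (suc-injective (length-picks-rest (⊆picks (here refl)))) ⟩
      num * ℓ ! + cnt (g ∘ proj₁) ps * (num * ℓ !) ∎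
      where open ≤-Reasoning
  all = go (picks L) id
  cov : ∀ σ → σ ↭ L → P σ → σ ∈ₗ proj₁ all
  cov [] p _ with () ← ↭-length p
  cov (x ∷ σ) p Pσ with rest , h , q ← picks-complete p = proj₁ (proj₂ all) x rest σ h q Pσ
  rearrange₁ : ∀ a b c d → a * (b * (c * d)) ≡ (a * b) * (c * d)
  rearrange₁ = solve-∀
  rearrange₂ : ∀ a b c d → (a * b) * (c * d) ≡ (a * c) * (b * d)
  rearrange₂ = solve-∀
  final : ∀ {m} → den * m ≤ cnt (g ∘ proj₁) (picks L) * (num * ℓ !) →
    (den′ * den) * m ≤ (num′ * num) * (length L) !
  final {m} s = begin
    (den′ * den) * m ≡⟨ *-assoc den′ den m ⟩
    den′ * (den * m) ≤⟨ *-monoʳ-≤ den′ s ⟩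
    den′ * (cnt (g ∘ proj₁) (picks L) * (num * ℓ !)) ≡⟨ rearrange₁ den′ _ num (ℓ !) ⟩
    (den′ * cnt (g ∘ proj₁) (picks L)) * (num * ℓ !) ≡⟨ cong (λ z → (den′ * z) * (num * ℓ !)) (cnt-picks g L) ⟩
    (den′ * cnt g L) * (num * ℓ !) ≤⟨ *-monoˡ-≤ (num * ℓ !) few ⟩
    (num′ * suc ℓ) * (num * ℓ !) ≡⟨ rearrange₂ num′ (suc ℓ) num (ℓ !) ⟩
    (num′ * num) * (suc ℓ * ℓ !) ∎
    where open ≤-Reasoning

Bound-all : ∀ (L : List A) → Bound L (const ⊤) 1 1
Bound-all L = go (length L) L refl
  where
  go : ∀ k (L : List _) → length L ≡ k → Bound L (const ⊤) 1 1
  go zero [] _ = bound ([] ∷ []) (λ σ p _ → subst (_∈ₗ [] ∷ []) (sym (↭-empty-inv p)) (here refl)) ≤-refl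
  go (suc k) L eq = Bound-∷ {num′ = 1} {den′ = 1} (const true) (≤-trans (s≤s z≤n) (≤-reflexive (sym eq)))
    (≤-reflexive (cong (1 *_) (cnt-const-true L))) (λ _ _ _ → refl)
    (λ x rest h _ → go k rest (suc-injective (trans (length-picks-rest h) eq)))

-- Given its first `k` elements, the remainder of an ordering is again uniform, so a bound valid
-- after every prefix holds on average.
Bound-prefix : ∀ k {L : List A} {R : List A → List A → Set} {num den} → k ≤ length L →
  (∀ π L′ → length π ≡ k → π ++ L′ ↭ L → Bound L′ (R π) num den) →
  Bound L (λ σ → R (take k σ) (drop k σ)) num den
Bound-prefix zero k≤ h = h [] _ refl ↭-refl
Bound-prefix (suc k) {L} {R} {num} {den} k≤ h =
  subst₂ (Bound L _) (*-identityˡ num) (*-identityˡ den)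
    (Bound-∷ {num′ = 1} {den′ = 1} (const true) (≤-trans (s≤s z≤n) k≤)
      (≤-reflexive (cong (1 *_) (cnt-const-true L)))
      (λ _ _ _ → refl)
      λ x rest p _ → Bound-prefix k {R = λ π → R (x ∷ π)}
        (≤-pred (≤-trans k≤ (≤-reflexive (sym (length-picks-rest p)))))
        λ π L′ e q → h (x ∷ π) L′ (cong suc e) (↭-trans (prep x q) (picks-↭ p)))

cnt-rest : ∀ (g : A → Bool) {L x rest} → (x , rest) ∈ₗ picks L → ⟦ g x ⟧ + cnt g rest ≡ cnt g L
cnt-rest g h = cnt-↭ g (picks-↭ h)

-- As draws shrink the pool to `ℓ`, the chance `(ℓ - q) / ℓ` of missing `q` elements only decreases;
-- keeping the ratio for `N` yields a pure power.
∸-ratio : ∀ {q ℓ N} → ℓ ≤ N → N * (ℓ ∸ q) ≤ (N ∸ q) * ℓ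
∸-ratio {q} {ℓ} {N} ℓ≤N = begin
  N * (ℓ ∸ q) ≡⟨ *-distribˡ-∸ N ℓ q ⟩
  N * ℓ ∸ N * q ≤⟨ ∸-monoʳ-≤ (N * ℓ) (*-monoˡ-≤ q ℓ≤N) ⟩
  N * ℓ ∸ ℓ * q ≡⟨ cong (N * ℓ ∸_) (*-comm ℓ q) ⟩
  N * ℓ ∸ q * ℓ ≡⟨ *-distribʳ-∸ ℓ N q ⟨
  (N ∸ q) * ℓ ∎
  where open ≤-Reasoning

-- As long as the set is missed, all its `q` or more elements stay in the pool, so every draw misses
-- it with probability at most `(N - q) / N`.
Bound-avoid : ∀ m {L : List A} {q N} (g : A → Bool) → length L ≤ N → 1 ≤ q → q ≤ cnt g L →
  Bound L (λ σ → cnt g (take m σ) ≡ 0) ((N ∸ q) ^ m) (N ^ m)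
Bound-avoid zero g _ _ _ = Bound-⊆ (λ _ _ _ → tt) (Bound-all _)
Bound-avoid (suc m) {L} {q} {N} g ℓ≤N 1≤q q≤ =
  Bound-∷ {num′ = N ∸ q} {den′ = N} (not ∘ g) (≤-trans 1≤q (≤-trans q≤ (cnt≤length g L)))
    (≤-trans (*-monoʳ-≤ N few) (∸-ratio {q} ℓ≤N))
    (λ x σ e → cong not (first x σ e))
    (λ x rest p e → Bound-⊆ (λ σ _ e′ → m+n≡0⇒n≡0 ⟦ g x ⟧ e′)
      (Bound-avoid m g
        (≤-trans (n≤1+n _) (≤-trans (≤-reflexive (length-picks-rest p)) ℓ≤N)) 1≤q
        (≤-trans q≤ (≤-reflexive (trans (sym (cnt-rest g p))
            (cong (λ z → ⟦ z ⟧ + cnt g rest) (notfalse (g x) e)))))))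
  where
  notfalse : ∀ b → not b ≡ true → b ≡ false
  notfalse false _ = refl
  first : ∀ x σ → ⟦ g x ⟧ + cnt g (take m σ) ≡ 0 → g x ≡ false
  first x σ e with g x
  ... | false = refl
  few : cnt (not ∘ g) L ≤ length L ∸ q
  few = ≤-trans (≤-reflexive (trans (sym (m+n∸m≡n (cnt g L) _)) (cong (_∸ cnt g L) (cnt-not g L))))
      (∸-monoʳ-≤ (length L) q≤)

-- At each of the `f` draws at least `ℓ` elements are left, at most `M` of them allowed.
Bound-confine : ∀ f {L : List A} {M ℓ} (g : A → Bool) → 1 ≤ ℓ → ℓ + f ≤ length L → cnt g L ≤ M →
  Bound L (λ σ → cnt (not ∘ g) (take f σ) ≡ 0) (M ^ f) (ℓ ^ f)
Bound-confine zero g _ _ _ = Bound-⊆ (λ _ _ _ → tt) (Bound-all _)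
Bound-confine (suc f) {L} {M} {ℓ} g 1≤ℓ ℓ≤ ≤M =
  Bound-∷ {num′ = M} {den′ = ℓ} g (≤-trans 1≤ℓ ℓ≤L)
    (≤-trans (≤-reflexive (*-comm ℓ (cnt g L))) (*-mono-≤ ≤M ℓ≤L))
    first
    (λ x rest p e → Bound-⊆ (λ σ _ e′ → m+n≡0⇒n≡0 ⟦ not (g x) ⟧ e′)
      (Bound-confine f g 1≤ℓ
        (≤-pred (≤-trans (≤-reflexive (sym (+-suc ℓ f)))
            (≤-trans ℓ≤ (≤-reflexive (sym (length-picks-rest p))))))
        (≤-trans (≤-trans (m≤n+m _ ⟦ g x ⟧) (≤-reflexive (cnt-rest g p))) ≤M)))
  where
  ℓ≤L = ≤-trans (m≤m+n ℓ (suc f)) ℓ≤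
  first : ∀ x σ → ⟦ not (g x) ⟧ + cnt (not ∘ g) (take f σ) ≡ 0 → g x ≡ true
  first x σ e with g x
  ... | true = refl

-- Moving a few elements within an ordering

take-length-++ : ∀ (xs : List A) {ys} → take (length xs) (xs ++ ys) ≡ xs
take-length-++ [] = refl
take-length-++ (x ∷ xs) = cong (x ∷_) (take-length-++ xs)

drop-length-++ : ∀ (xs : List A) {ys} → drop (length xs) (xs ++ ys) ≡ ys
drop-length-++ [] = refl
drop-length-++ (x ∷ xs) = drop-length-++ xs

take-+ : ∀ k m (xs : List A) → take (k + m) xs ≡ take k xs ++ take m (drop k xs)
take-+ zero m xs = refl
take-+ (suc k) zero [] = refl
take-+ (suc k) (suc m) [] = refl
take-+ (suc k) m (x ∷ xs) = cong (x ∷_) (take-+ k m xs)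

∈-take⁻ : ∀ k {x : A} (xs : List A) → x ∈ₗ take k xs → x ∈ₗ xs
∈-take⁻ k {x} xs h = subst (x ∈ₗ_) (take++drop≡id k xs) (∈-++⁺ˡ h)

length-concatMap≤ : ∀ (g : A → List B) xs {c} → (∀ x → x ∈ₗ xs → length (g x) ≤ c) →
  length (concatMap g xs) ≤ length xs * c
length-concatMap≤ g [] h = z≤n
length-concatMap≤ g (x ∷ xs) h =
  ≤-trans (≤-reflexive (length-++ (g x)))
    (+-mono-≤ (h x (here refl)) (length-concatMap≤ g xs (λ y y∈ → h y (there y∈))))

∈-concatMap : ∀ (g : A → List B) {x xs y} → x ∈ₗ xs → y ∈ₗ g x → y ∈ₗ concatMap g xs
∈-concatMap g x∈ y∈ = ∈-concatMap⁺ g (lose x∈ y∈)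

inserts : A → List A → List (List A)
inserts x [] = (x ∷ []) ∷ []
inserts x (y ∷ ys) = (x ∷ y ∷ ys) ∷ map (y ∷_) (inserts x ys)

length-inserts : ∀ (x : A) ys → length (inserts x ys) ≡ suc (length ys)
length-inserts x [] = refl
length-inserts x (y ∷ ys) = cong suc (trans (length-map (y ∷_) (inserts x ys)) (length-inserts x ys))

∈-inserts-length : ∀ (x : A) ys {zs} → zs ∈ₗ inserts x ys → length zs ≡ suc (length ys)
∈-inserts-length x [] (here refl) = refl
∈-inserts-length x (y ∷ ys) (here refl) = refl
∈-inserts-length x (y ∷ ys) (there h) with ws , h′ , refl ← ∈-map⁻ _ h = cong suc (∈-inserts-length x ys h′)

inserts-head : ∀ (x : A) ys → (x ∷ ys) ∈ₗ inserts x ys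
inserts-head x [] = here refl
inserts-head x (y ∷ ys) = here refl

-- The elements of `F` are inserted one by one at arbitrary positions. This gives more than the
-- interleavings, but still at most one factor `t` per element.
merges : List A → List A → List (List A)
merges [] π = π ∷ []
merges (x ∷ F) π = concatMap (inserts x) (merges F π)

∈-merges-length : ∀ (F π : List A) {zs} → zs ∈ₗ merges F π → length zs ≡ length F + length π
∈-merges-length [] π (here refl) = refl
∈-merges-length (x ∷ F) π h with ws , ws∈ , zs∈ ← find (∈-concatMap⁻ (inserts x) {xs = merges F π} h) =
  trans (∈-inserts-length x ws zs∈) (cong suc (∈-merges-length F π ws∈))

length-merges : ∀ (F π : List A) {t} → length F + length π ≤ t → length (merges F π) ≤ t ^ length F
length-merges [] π h = ≤-refl
length-merges (x ∷ F) π {t} h = begin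
  length (concatMap (inserts x) (merges F π))
    ≤⟨ length-concatMap≤ (inserts x) (merges F π)
         (λ zs zs∈ → ≤-trans (≤-reflexive (trans (length-inserts x zs) (cong suc (∈-merges-length F π zs∈))))
             h) ⟩
  length (merges F π) * t ≤⟨ *-monoˡ-≤ t (length-merges F π (≤-trans (n≤1+n _) h)) ⟩
  t ^ length F * t ≡⟨ *-comm _ t ⟩
  t * t ^ length F ∎
  where open ≤-Reasoning

merges-∷ : ∀ (x : A) F {π zs} → zs ∈ₗ merges F π → (x ∷ zs) ∈ₗ merges F (x ∷ π)
merges-∷ x [] (here refl) = here refl
merges-∷ x (y ∷ F) {π} h with ws , ws∈ , zs∈ ← find (∈-concatMap⁻ (inserts y) {xs = merges F π} h) =
  ∈-concatMap (inserts y) (merges-∷ x F ws∈) (there (∈-map⁺ (x ∷_) zs∈))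

merges-filter : ∀ (D : A → Bool) p → p ∈ₗ merges (filterᵇ D p) (filterᵇ (not ∘ D) p)
merges-filter D [] = here refl
merges-filter D (x ∷ p) with D x
... | true = ∈-concatMap (inserts x) (merges-filter D p) (inserts-head x p)
... | false = merges-∷ x (filterᵇ D p) (merges-filter D p)

filter-↭-++ : ∀ (D : A → Bool) p → p ↭ filterᵇ (not ∘ D) p ++ filterᵇ D p
filter-↭-++ D [] = ↭-refl
filter-↭-++ D (x ∷ p) with D x
... | true = ↭-trans (prep x (filter-↭-++ D p)) (↭-sym (shift x (filterᵇ (not ∘ D) p) (filterᵇ D p)))
... | false = prep x (filter-↭-++ D p)

-- A set D of f elements among the first t, each in the set allowed by the
-- remaining first elements, is moved right behind those; there Bound-confine
-- applies, and undoing the move costs a factor t for each of the f elements.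
Shuffled : ℕ → ℕ → (List A → A → Bool) → List A → Set
Shuffled t f allow σ = ∃ λ D → length (filterᵇ D (take t σ)) ≡ f ×
  cnt (not ∘ allow (filterᵇ (not ∘ D) (take t σ))) (filterᵇ D (take t σ)) ≡ 0

Bound-shuffle : ∀ t f {L : List A} {M ℓ} (allow : List A → A → Bool) →
  1 ≤ ℓ → f ≤ t → ℓ + t ≤ length L → (∀ π → cnt (allow π) L ≤ M) →
  Bound L (Shuffled t f allow) ((t * M) ^ f) (ℓ ^ f)
Bound-shuffle {A} t f {L} {M} {ℓ} allow 1≤ℓ f≤t ℓ+t≤ fewM =
  bound (concatMap dec (list Y)) cov sz
  where
  -- The event after the move. What `allow` permits depends on the first `t ∸ f` elements only, so
  -- it is a fixed set once these are given.
  Y : Bound L (λ σ → cnt (not ∘ allow (take (t ∸ f) σ)) (take f (drop (t ∸ f) σ)) ≡ 0) (M ^ f) (ℓ ^ f)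
  Y = Bound-prefix (t ∸ f) {R = λ π ρ → cnt (not ∘ allow π) (take f ρ) ≡ 0}
      (≤-trans (m∸n≤m t f) (m+n≤o⇒n≤o ℓ ℓ+t≤)) λ π L′ e q →
    let len : length π + length L′ ≡ length L
        len = trans (sym (length-++ π)) (↭-length q)
    in Bound-confine f (allow π) 1≤ℓ
      (+-cancelˡ-≤ (t ∸ f) _ _ (≤-trans
        (≤-reflexive (trans (exchange (t ∸ f) ℓ f) (cong (ℓ +_) (m∸n+n≡m f≤t))))
        (≤-trans ℓ+t≤ (≤-reflexive (trans (sym len) (cong (_+ length L′) e))))))
      (≤-trans (≤-trans (m≤n+m _ (cnt (allow π) π))
          (≤-reflexive (trans (sym (cnt-++ (allow π) π L′)) (cnt-↭ (allow π) q)))) (fewM π))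
  -- Undoes the move: the `f` elements behind the first `t ∸ f` are reinserted among these in all
  -- ways, so every ordering that could have been moved to `σ` is listed.
  dec : List A → List (List A)
  dec σ = map (_++ drop f (drop (t ∸ f) σ)) (merges (take f (drop (t ∸ f) σ)) (take (t ∸ f) σ))
  dec-length : ∀ σ → length (dec σ) ≤ t ^ f
  dec-length σ = begin
    length (dec σ) ≡⟨ length-map _ (merges F π) ⟩
    length (merges F π) ≤⟨ length-merges F π (≤-trans (+-mono-≤ F≤ π≤) (≤-reflexive (m+[n∸m]≡n f≤t))) ⟩
    t ^ length F ≤⟨ ^-monoʳ-≤′ F≤ f≤t ⟩
    t ^ f ∎
    where
    open ≤-Reasoning
    F = take f (drop (t ∸ f) σ)
    π = take (t ∸ f) σ
    F≤ : length F ≤ f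
    F≤ = ≤-trans (≤-reflexive (length-take f (drop (t ∸ f) σ))) (m⊓n≤m f _)
    π≤ : length π ≤ t ∸ f
    π≤ = ≤-trans (≤-reflexive (length-take (t ∸ f) σ)) (m⊓n≤m (t ∸ f) _)
  cov : ∀ σ → σ ↭ L → Shuffled t f allow σ → σ ∈ₗ concatMap dec (list Y)
  cov σ q (D , lenF , ok) = ∈-concatMap dec (covers Y σ′ (↭-trans σ′↭σ q) ok′) σ∈
    where
    p = take t σ
    F = filterᵇ D p
    π = filterᵇ (not ∘ D) p
    rest = drop t σ
    σ′ = π ++ (F ++ rest)
    σ′↭σ : σ′ ↭ σ
    σ′↭σ = ↭-trans (↭-reflexive (sym (++-assoc π F rest)))
      (↭-trans (PermP.++⁺ʳ rest (↭-sym (filter-↭-++ D p))) (↭-reflexive (take++drop≡id t σ)))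
    lenp : length p ≡ t
    lenp = trans (length-take t σ) (m≤n⇒m⊓n≡m (≤-trans (m+n≤o⇒n≤o ℓ ℓ+t≤) (≤-reflexive (sym (↭-length q)))))
    lenπ : length π ≡ t ∸ f
    lenπ = trans (sym (m+n∸n≡m (length π) f)) (cong (_∸ f)
      (trans (cong (length π +_) (sym lenF))
          (trans (sym (length-++ π)) (trans (sym (↭-length (filter-↭-++ D p))) lenp))))
    takeπ : take (t ∸ f) σ′ ≡ π
    takeπ = trans (cong (λ k → take k σ′) (sym lenπ)) (take-length-++ π)
    dropπ : drop (t ∸ f) σ′ ≡ F ++ rest
    dropπ = trans (cong (λ k → drop k σ′) (sym lenπ)) (drop-length-++ π)
    takeF : take f (drop (t ∸ f) σ′) ≡ F
    takeF = trans (cong₂ take (sym lenF) dropπ) (take-length-++ F)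
    dropF : drop f (drop (t ∸ f) σ′) ≡ rest
    dropF = trans (cong₂ drop (sym lenF) dropπ) (drop-length-++ F)
    ok′ : cnt (not ∘ allow (take (t ∸ f) σ′)) (take f (drop (t ∸ f) σ′)) ≡ 0
    ok′ = trans (cong₂ (λ a b → cnt (not ∘ allow a) b) takeπ takeF) ok
    σ∈ : σ ∈ₗ dec σ′
    σ∈ = subst (σ ∈ₗ_) (sym (trans (cong
        (λ r → map (_++ r) (merges (take f (drop (t ∸ f) σ′)) (take (t ∸ f) σ′))) dropF)
                                    (cong₂ (λ a b → map (_++ rest) (merges a b)) takeF takeπ)))
           (subst (_∈ₗ map (_++ rest) (merges F π)) (take++drop≡id t σ) (∈-map⁺ (_++ rest) (merges-filter D p)))
  rearrange : ∀ a b c → a * b * c ≡ (c * a) * b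
  rearrange = solve-∀
  sz : ℓ ^ f * length (concatMap dec (list Y)) ≤ (t * M) ^ f * length L !
  sz = begin
    ℓ ^ f * length (concatMap dec (list Y))
        ≤⟨ *-monoʳ-≤ (ℓ ^ f) (length-concatMap≤ dec (list Y) (λ σ _ → dec-length σ)) ⟩
    ℓ ^ f * (length (list Y) * t ^ f) ≡⟨ *-assoc (ℓ ^ f) _ _ ⟨
    ℓ ^ f * length (list Y) * t ^ f ≤⟨ *-monoˡ-≤ (t ^ f) (proportion Y) ⟩
    M ^ f * length L ! * t ^ f ≡⟨ rearrange (M ^ f) _ (t ^ f) ⟩
    (t ^ f * M ^ f) * length L ! ≡⟨ cong (_* length L !) (^-distribʳ-* f t M) ⟨
    (t * M) ^ f * length L ! ∎
    where
    open ≤-Reasoning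

Avoids : ℕ → ℕ → ℕ → (List A → A → Bool) → List A → List A → Set
Avoids k m q g L σ = q ≤ cnt (g (take k σ)) L × cnt (g (take k σ)) (take (k + m) σ) ≡ 0

-- The set is determined by the first `k` elements and missed by them as well, so all of it is still
-- in the pool for the next `m` draws.
Bound-avoid-after : ∀ k m {L : List A} {q N} (g : List A → A → Bool) → k ≤ length L → length L ≤ N → 1 ≤ q →
  Bound L (Avoids k m q g L) ((N ∸ q) ^ m) (N ^ m)
Bound-avoid-after {A} k m {L} {q} {N} g k≤ ℓ≤N 1≤q = Bound-⊆ split
  (Bound-prefix k {R = R} k≤ λ π L′ e p →
    Bound-dec (q ≤? cnt (g π) L) (λ _ _ → proj₁) λ q≤ →
    Bound-dec (cnt (g π) π ≟ 0) (λ _ _ → proj₁ ∘ proj₂) λ none →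
    Bound-⊆ (λ _ _ → proj₂ ∘ proj₂) (Bound-avoid m (g π)
      (≤-trans (m≤n+m _ (length π)) (≤-trans (≤-reflexive (trans (sym (length-++ π)) (↭-length p))) ℓ≤N))
      1≤q (≤-trans q≤ (≤-reflexive (trans (sym (cnt-↭ (g π) p))
          (trans (cnt-++ (g π) π L′) (cong (_+ cnt (g π) L′) none)))))))
  where
  R : List A → List A → Set
  R π ρ = q ≤ cnt (g π) L × cnt (g π) π ≡ 0 × cnt (g π) (take m ρ) ≡ 0
  split : ∀ σ → σ ↭ L → Avoids k m q g L σ → R (take k σ) (drop k σ)
  split σ _ (q≤ , e) = q≤ , m+n≡0⇒m≡0 _ e′ , m+n≡0⇒n≡0 (cnt (g (take k σ)) (take k σ)) e′
    where
    e′ = trans (sym (trans (cong (cnt (g (take k σ))) (take-+ k m σ)) (cnt-++ (g (take k σ)) (take k σ) _))) e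

-- Rare events and the union bound

Rare : List A → ℕ → (List A → Set) → Set
Rare L d P = Bound L P 1 d

Bound⇒Rare : ∀ {L : List A} {P num den} d → 1 ≤ den → d * num ≤ den → Bound L P num den → Rare L d P
Bound⇒Rare {L = L} {num = num} {den = suc den} d _ h (bound l c s) = bound l c (*-cancelˡ-≤ (suc den) (begin
  suc den * (d * length l) ≡⟨ rearrange (suc den) d _ ⟩
  d * (suc den * length l) ≤⟨ *-monoʳ-≤ d s ⟩
  d * (num * length L !) ≡⟨ *-assoc d num _ ⟨
  d * num * length L ! ≤⟨ *-monoˡ-≤ _ h ⟩
  suc den * length L ! ≡⟨ cong (suc den *_) (*-identityˡ _) ⟨
  suc den * (1 * length L !) ∎))
  where
  open ≤-Reasoning
  rearrange : ∀ a b c → a * (b * c) ≡ b * (a * c)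
  rearrange = solve-∀

Rare-weaken : ∀ {L : List A} {P d d′} → d′ ≤ d → Rare L d P → Rare L d′ P
Rare-weaken d′≤ (bound l c s) = bound l c (≤-trans (*-monoˡ-≤ _ d′≤) s)

-- Union bound: the factor `c` in the rarity of each case pays for the number of cases.
Rare-∃ : ∀ {L : List A} {P : B → List A → Set} {c d} (xs : List B) → 1 ≤ c → length xs ≤ c →
  (∀ x → x ∈ₗ xs → Rare L (c * d) (P x)) → Rare L d (λ σ → ∃ λ x → x ∈ₗ xs × P x σ)
Rare-∃ {L = L} {P} {c = c@(suc _)} {d} xs _ xs≤ h =
    bound (proj₁ (go xs h)) (λ σ p (x , x∈ , Pσ) → proj₁ (proj₂ (go xs h)) σ x p x∈ Pσ)
  (*-cancelˡ-≤ c (begin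
    c * (d * length l) ≡⟨ *-assoc c d _ ⟨
    c * d * length l ≤⟨ proj₂ (proj₂ (go xs h)) ⟩
    length xs * length L ! ≤⟨ *-monoˡ-≤ _ xs≤ ⟩
    c * length L ! ≡⟨ cong (c *_) (*-identityˡ _) ⟨
    c * (1 * length L !) ∎))
  where
  open ≤-Reasoning
  go : ∀ xs → (∀ x → x ∈ₗ xs → Rare L (c * d) (P x)) → Σ (List (List _)) λ l →
    (∀ σ x → σ ↭ L → x ∈ₗ xs → P x σ → σ ∈ₗ l) × (c * d * length l ≤ length xs * length L !)
  go [] h = [] , (λ _ _ _ ()) , ≤-reflexive (*-zeroʳ (c * d))
  go (x ∷ xs) h with l , cv , s ← go xs (λ y y∈ → h y (there y∈)) =
    list b ++ l , cv′ , ≤-trans (≤-reflexive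
        (trans (cong (c * d *_) (length-++ (list b))) (*-distribˡ-+ (c * d) _ _)))
      (+-mono-≤ (≤-trans (proportion b) (≤-reflexive (*-identityˡ _))) s)
    where
    b = h x (here refl)
    cv′ : ∀ σ y → σ ↭ L → y ∈ₗ x ∷ xs → P y σ → σ ∈ₗ list b ++ l
    cv′ σ y p (here refl) Pσ = ∈-++⁺ˡ (covers b σ p Pσ)
    cv′ σ y p (there y∈) Pσ = ∈-++⁺ʳ (list b) (cv σ y p y∈ Pσ)
  l = proj₁ (go xs h)

-- Booleans and the propositions they reflect

does⁻ : ∀ {P : Set} (d : Dec P) → does d ≡ true → P
does⁻ (yes p) _ = p

does⁺ : ∀ {P : Set} (d : Dec P) → P → does d ≡ true
does⁺ = dec-true

∧⁻ : ∀ {a b} → a ∧ b ≡ true → a ≡ true × b ≡ true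
∧⁻ {true} {true} _ = refl , refl

∧⁺ : ∀ {a b} → a ≡ true → b ≡ true → a ∧ b ≡ true
∧⁺ refl refl = refl

∨⁻ : ∀ {a b} → a ∨ b ≡ true → a ≡ true ⊎ b ≡ true
∨⁻ {true} _ = inj₁ refl
∨⁻ {false} h = inj₂ h

∨⁺ˡ : ∀ {a b} → a ≡ true → a ∨ b ≡ true
∨⁺ˡ refl = refl

∨⁺ʳ : ∀ {a b} → b ≡ true → a ∨ b ≡ true
∨⁺ʳ {true} _ = refl
∨⁺ʳ {false} h = h

not⁻ : ∀ {a} → not a ≡ true → a ≡ false
not⁻ {false} _ = refl

not⁺ : ∀ {a} → a ≡ false → not a ≡ true
not⁺ refl = refl

true≢false : ∀ {a} → a ≡ true → a ≡ false → ⊥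
true≢false refl ()

≢true⇒false : ∀ {a} → ¬ (a ≡ true) → a ≡ false
≢true⇒false {true} h = ⊥-elim (h refl)
≢true⇒false {false} h = refl

∈-filterᵇ⁻ : ∀ (f : A → Bool) xs {x} → x ∈ₗ filterᵇ f xs → x ∈ₗ xs × f x ≡ true
∈-filterᵇ⁻ f (y ∷ xs) h with f y in eq
∈-filterᵇ⁻ f (y ∷ xs) (here refl) | true = here refl , eq
∈-filterᵇ⁻ f (y ∷ xs) (there h) | true with x∈ , fx ← ∈-filterᵇ⁻ f xs h = there x∈ , fx
∈-filterᵇ⁻ f (y ∷ xs) h | false with x∈ , fx ← ∈-filterᵇ⁻ f xs h = there x∈ , fx

∈-filterᵇ⁺ : ∀ (f : A → Bool) {xs x} → x ∈ₗ xs → f x ≡ true → x ∈ₗ filterᵇ f xs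
∈-filterᵇ⁺ f {y ∷ xs} (here refl) fx rewrite fx = here refl
∈-filterᵇ⁺ f {y ∷ xs} (there h) fx with f y
... | true = there (∈-filterᵇ⁺ f h fx)
... | false = ∈-filterᵇ⁺ f h fx

-- Double counting

∑ : List A → (A → ℕ) → ℕ
∑ [] f = 0
∑ (x ∷ xs) f = f x + ∑ xs f

∑-mono : ∀ (xs : List A) {f g : A → ℕ} → (∀ x → x ∈ₗ xs → f x ≤ g x) → ∑ xs f ≤ ∑ xs g
∑-mono [] h = z≤n
∑-mono (x ∷ xs) h = +-mono-≤ (h x (here refl)) (∑-mono xs (λ y y∈ → h y (there y∈)))

∑-cong : ∀ (xs : List A) {f g : A → ℕ} → (∀ x → f x ≡ g x) → ∑ xs f ≡ ∑ xs g
∑-cong [] h = refl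
∑-cong (x ∷ xs) h = cong₂ _+_ (h x) (∑-cong xs h)

∑-+ : ∀ (xs : List A) (f g : A → ℕ) → ∑ xs (λ x → f x + g x) ≡ ∑ xs f + ∑ xs g
∑-+ [] f g = refl
∑-+ (x ∷ xs) f g = trans (cong (f x + g x +_) (∑-+ xs f g)) (interchange (f x) (g x) _ _)

∑-const : ∀ (xs : List A) c → ∑ xs (const c) ≡ length xs * c
∑-const [] c = refl
∑-const (x ∷ xs) c = cong (c +_) (∑-const xs c)

∑-swap : ∀ (xs : List A) (ys : List B) (f : A → B → ℕ) → ∑ xs (λ x → ∑ ys (f x)) ≡ ∑ ys (λ y → ∑ xs (flip f y))
∑-swap [] ys f = sym (trans (∑-const ys 0) (*-zeroʳ (length ys)))
∑-swap (x ∷ xs) ys f = trans (cong (∑ ys (f x) +_) (∑-swap xs ys f)) (sym (∑-+ ys (f x) _))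

∑-⟦⟧* : ∀ (f : A → Bool) c xs → ∑ xs (λ x → ⟦ f x ⟧ * c) ≡ cnt f xs * c
∑-⟦⟧* f c [] = refl
∑-⟦⟧* f c (x ∷ xs) = trans (cong (⟦ f x ⟧ * c +_) (∑-⟦⟧* f c xs)) (sym (*-distribʳ-+ c ⟦ f x ⟧ _))

cnt≡∑ : ∀ (f : A → Bool) xs → cnt f xs ≡ ∑ xs (λ x → ⟦ f x ⟧)
cnt≡∑ f [] = refl
cnt≡∑ f (x ∷ xs) = cong (⟦ f x ⟧ +_) (cnt≡∑ f xs)

cnt-map : ∀ (f : B → Bool) (g : A → B) xs → cnt f (map g xs) ≡ cnt (f ∘ g) xs
cnt-map f g [] = refl
cnt-map f g (x ∷ xs) = cong (⟦ f (g x) ⟧ +_) (cnt-map f g xs)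

cnt-cartesianProduct : ∀ (h : A → B → Bool) xs ys →
  cnt (uncurry h) (cartesianProduct xs ys) ≡ ∑ xs (λ x → cnt (h x) ys)
cnt-cartesianProduct h [] ys = refl
cnt-cartesianProduct h (x ∷ xs) ys =
  trans (cnt-++ (uncurry h) (map (x ,_) ys) _)
      (cong₂ _+_ (cnt-map (uncurry h) (x ,_) ys) (cnt-cartesianProduct h xs ys))

cnt-filter : ∀ {P : A → Set} (P? : ∀ x → Dec (P x)) (f : A → Bool) xs →
  cnt f (filter P? xs) ≡ cnt (λ x → f x ∧ does (P? x)) xs
cnt-filter P? f [] = refl
cnt-filter P? f (x ∷ xs) with does (P? x)
... | true rewrite ∧-identityʳ (f x) = cong (⟦ f x ⟧ +_) (cnt-filter P? f xs)
... | false rewrite ∧-zeroʳ (f x) = cnt-filter P? f xs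

cnt-unique-≡ : ∀ (_≟A_ : DecidableEquality A) (f : A → Bool) {u xs} → Unique xs → u ∈ₗ xs →
  cnt (λ v → f v ∧ does (u ≟A v)) xs ≡ ⟦ f u ⟧
cnt-unique-≡ _≟A_ f {u} {x ∷ xs} (x∉ ∷ uq) (here refl) rewrite dec-true (x ≟A x) refl =
  trans (cong (⟦ f x ∧ true ⟧ +_) (cnt-zero _ xs
      (λ v v∈ → trans (cong (f v ∧_) (dec-false (x ≟A v) (All.lookup x∉ v∈))) (∧-zeroʳ (f v)))))
    (trans (+-identityʳ _) (cong ⟦_⟧ (∧-comm (f x) true)))
cnt-unique-≡ _≟A_ f {u} {x ∷ xs} (x∉ ∷ uq) (there u∈) rewrite dec-false (u ≟A x)
    (λ { refl → All.lookup x∉ u∈ refl }) | ∧-comm (f x) false =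
  cnt-unique-≡ _≟A_ f uq u∈

unique⇒length≤cnt : ∀ (f : A → Bool) {xs ys} → Unique xs → (∀ {x} → x ∈ₗ xs → x ∈ₗ ys × f x ≡ true) →
  length xs ≤ cnt f ys
unique⇒length≤cnt f {[]} [] h = z≤n
unique⇒length≤cnt f {x ∷ xs} {ys} (x∉ ∷ uq) h with as , bs , refl ← ∈-∃++ (proj₁ (h (here refl))) =
  ≤-trans (s≤s (unique⇒length≤cnt f uq rest))
    (≤-reflexive (trans (cong (_+ cnt f (as ++ bs)) (sym (cong ⟦_⟧ (proj₂ (h (here refl))))))
        (sym (cnt-↭ f (shift x as bs)))))
  where
  rest : ∀ {y} → y ∈ₗ xs → y ∈ₗ as ++ bs × f y ≡ true
  rest {y} y∈ with ∈-resp-↭ (shift x as bs) (proj₁ (h (there y∈)))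
  ... | here y≡x = ⊥-elim (All.lookup x∉ y∈ (sym y≡x))
  ... | there y∈′ = y∈′ , proj₂ (h (there y∈))

-- Sets of vertices

size : (Fin n → Bool) → ℕ
size {n} f = cnt f (allFin n)

size-mono : ∀ {f g : Fin n → Bool} → (∀ v → f v ≡ true → g v ≡ true) → size f ≤ size g
size-mono {n} {f} {g} h = cnt-mono f g (allFin n) (λ v _ → h v)

length-allFin : ∀ n → length (allFin n) ≡ n
length-allFin n = length-tabulate {n = n} id

size-not : ∀ (f : Fin n → Bool) → size f + size (not ∘ f) ≡ n
size-not {n} f = trans (cnt-not f (allFin n)) (length-allFin n)

size-pos : ∀ {f : Fin n → Bool} {v} → f v ≡ true → 1 ≤ size f
size-pos {f = f} {v} = cnt-pos f (∈-allFin v)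

size-disjoint : ∀ {f g : Fin n → Bool} → (∀ v → f v ≡ true → g v ≡ true → ⊥) → size f + size g ≤ n
size-disjoint {f = f} {g} h = ≤-trans
    (+-monoʳ-≤ (size f) (size-mono (λ v gv → not⁺ (≢true⇒false (λ fv → h v fv gv))))) (≤-reflexive (size-not f))

size-cover : ∀ {f g h : Fin n → Bool} → (∀ v → f v ≡ true → g v ≡ true ⊎ h v ≡ true) → size f ≤ size g + size h
size-cover {n} {f} {g} {h} cov = go (allFin n)
  where
  one : ∀ v → ⟦ f v ⟧ ≤ ⟦ g v ⟧ + ⟦ h v ⟧
  one v with f v in eq
  ... | false = z≤n
  ... | true with cov v eq
  ...   | inj₁ gv rewrite gv = s≤s z≤n
  ...   | inj₂ hv rewrite hv = m≤n+m 1 ⟦ g v ⟧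
  go : ∀ xs → cnt f xs ≤ cnt g xs + cnt h xs
  go [] = z≤n
  go (x ∷ xs) = ≤-trans (+-mono-≤ (one x) (go xs)) (≤-reflexive (interchange ⟦ g x ⟧ ⟦ h x ⟧ _ _))

size-⋃ : ∀ (xs : List A) (g : A → Fin n → Bool) {c} (f : Fin n → Bool) →
  (∀ v → f v ≡ true → ∃ λ x → x ∈ₗ xs × g x v ≡ true) → (∀ x → x ∈ₗ xs → size (g x) ≤ c) →
      size f ≤ length xs * c
size-⋃ {n = n} [] g f cov h = ≤-reflexive (cnt-zero f (allFin n) (λ v _ → ≢true⇒false (λ fv → nope (cov v fv))))
  where
  nope : ∀ {v} → (∃ λ x → x ∈ₗ [] × g x v ≡ true) → ⊥
  nope (_ , () , _)
size-⋃ (x ∷ xs) g {c} f cov h = ≤-trans (size-cover {f = f} {g x} {λ v → f v ∧ not (g x v)} split)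
  (+-mono-≤ (h x (here refl)) (size-⋃ xs g (λ v → f v ∧ not (g x v)) cov′ (λ y y∈ → h y (there y∈))))
  where
  split : ∀ v → f v ≡ true → g x v ≡ true ⊎ f v ∧ not (g x v) ≡ true
  split v fv with g x v
  ... | true = inj₁ refl
  ... | false = inj₂ (∧⁺ fv refl)
  cov′ : ∀ v → f v ∧ not (g x v) ≡ true → ∃ λ y → y ∈ₗ xs × g y v ≡ true
  cov′ v fv′ with fv , ¬gv ← ∧⁻ {f v} fv′ | cov v (proj₁ (∧⁻ {f v} fv′))
  ... | y , here refl , gv = ⊥-elim (true≢false gv (not⁻ ¬gv))
  ... | y , there y∈ , gv = y , y∈ , gv

_∈ᵛ?_ : ∀ (v : Fin n) xs → Dec (v ∈ₗ xs)
_∈ᵛ?_ = DecMembership._∈?_ FP._≟_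

mem : List (Fin n) → Fin n → Bool
mem xs v = does (v ∈ᵛ? xs)

mem⁺ : ∀ {xs : List (Fin n)} {v} → v ∈ₗ xs → mem xs v ≡ true
mem⁺ = does⁺ (_ ∈ᵛ? _)

mem⁻ : ∀ {xs : List (Fin n)} {v} → mem xs v ≡ true → v ∈ₗ xs
mem⁻ = does⁻ (_ ∈ᵛ? _)

elements : (Fin n → Bool) → List (Fin n)
elements {n} f = filterᵇ f (allFin n)

length-elements : ∀ (f : Fin n → Bool) → length (elements f) ≡ size f
length-elements {n} f = cnt≡length-filter f (allFin n)

elements-unique : ∀ (f : Fin n → Bool) → Unique (elements f)
elements-unique {n} f = Uniq.filter⁺ _ (Uniq.allFin⁺ n)

∈-elements⁺ : ∀ (f : Fin n → Bool) {v} → f v ≡ true → v ∈ₗ elements f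
∈-elements⁺ f = ∈-filterᵇ⁺ f (∈-allFin _)

∈-elements⁻ : ∀ (f : Fin n → Bool) {v} → v ∈ₗ elements f → f v ≡ true
∈-elements⁻ {n} f h = proj₂ (∈-filterᵇ⁻ f (allFin n) h)

size-mem≤ : ∀ (xs : List (Fin n)) → size (mem xs) ≤ length xs
size-mem≤ {n} xs = ≤-trans (≤-reflexive (sym (length-elements (mem xs))))
  (≤-trans (unique⇒length≤cnt (const true) {ys = xs} (elements-unique (mem xs))
      (λ h → mem⁻ (∈-elements⁻ (mem xs) h) , refl))
    (≤-reflexive (cnt-const-true xs)))

unique⇒length≤size : ∀ (f : Fin n → Bool) {xs} → Unique xs → (∀ {v} → v ∈ₗ xs → f v ≡ true) → length xs ≤ size f
unique⇒length≤size f uq h = unique⇒length≤cnt f uq (λ v∈ → ∈-allFin _ , h v∈)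

subset-of-size : ∀ (f : Fin n → Bool) k → k ≤ size f →
  ∃ λ xs → length xs ≡ k × Unique xs × (∀ {v} → v ∈ₗ xs → f v ≡ true)
subset-of-size f k k≤ = take k (elements f) ,
  trans (length-take k (elements f)) (m≤n⇒m⊓n≡m (≤-trans k≤ (≤-reflexive (sym (length-elements f))))) ,
  Uniq.take⁺ k (elements-unique f) , λ v∈ → ∈-elements⁻ f (∈-take⁻ k (elements f) v∈)

-- Stands in for the `k`-subsets in union bounds; the overcounting is harmless since `n ^ k` is the
-- cost anyway.
tuples : ∀ n → ℕ → List (List (Fin n))
tuples n zero = [] ∷ []
tuples n (suc k) = concatMap (λ v → map (v ∷_) (tuples n k)) (allFin n)

length-tuples : ∀ n k → length (tuples n k) ≤ n ^ k
length-tuples n zero = ≤-refl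
length-tuples n (suc k) = ≤-trans (length-concatMap≤ (λ v → map (v ∷_) (tuples n k)) (allFin n)
    (λ v _ → ≤-trans (≤-reflexive (length-map (v ∷_) (tuples n k))) (length-tuples n k)))
  (≤-reflexive (cong (_* n ^ k) (length-allFin n)))

∈-tuples : ∀ (vs : List (Fin n)) → vs ∈ₗ tuples n (length vs)
∈-tuples [] = here refl
∈-tuples (v ∷ vs) = ∈-concatMap (λ v → map (v ∷_) (tuples _ (length vs))) (∈-allFin v)
    (∈-map⁺ (v ∷_) (∈-tuples vs))

-- Counting edges

lt : Fin n → Fin n → Bool
lt u v = does (u FP.<? v)

cnt-allEdges : ∀ n (h : Fin n → Fin n → Bool) →
  cnt (uncurry h) (allEdges n) ≡ ∑ (allFin n) (λ u → size (λ v → h u v ∧ lt u v))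
cnt-allEdges n h = trans (cnt-filter (λ p → proj₁ p FP.<? proj₂ p) (uncurry h)
    (cartesianProduct (allFin n) (allFin n)))
  (cnt-cartesianProduct (λ u v → h u v ∧ lt u v) (allFin n) (allFin n))

-- Trichotomy splits the ordered pairs: by symmetry `u < v` and `v < u` contribute equally, and the
-- diagonal remains.
cnt-symmetric : ∀ n (h : Fin n → Fin n → Bool) → (∀ u v → h u v ≡ h v u) →
  ∑ (allFin n) (λ u → size (h u)) ≡ 2 * cnt (uncurry h) (allEdges n) + size (λ u → h u u)
cnt-symmetric n h h-sym = begin
  ∑ V (λ u → size (h u))
    ≡⟨ ∑-cong V (λ u → trans (cnt≡∑ (h u) V) (trans (∑-cong V (λ v → one u v)) (∑-+ V _ _))) ⟩
  ∑ V (λ u → ∑ V (λ v → ⟦ h u v ∧ lt u v ⟧) + ∑ V (λ v → ⟦ h u v ∧ lt v u ⟧ + ⟦ h u v ∧ does (u FP.≟ v) ⟧))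
    ≡⟨ ∑-cong V (λ u → cong₂ _+_ (sym (cnt≡∑ _ V)) (trans (∑-+ V _ _) (cong₂ _+_ refl
         (trans (sym (cnt≡∑ _ V)) (cnt-unique-≡ FP._≟_ (h u) (Uniq.allFin⁺ n) (∈-allFin u)))))) ⟩
  ∑ V (λ u → size (λ v → h u v ∧ lt u v) + (∑ V (λ v → ⟦ h u v ∧ lt v u ⟧) + ⟦ h u u ⟧))
    ≡⟨ trans (∑-+ V _ _) (cong₂ _+_ (sym (cnt-allEdges n h)) (∑-+ V _ _)) ⟩
  m + (∑ V (λ u → ∑ V (λ v → ⟦ h u v ∧ lt v u ⟧)) + ∑ V (λ u → ⟦ h u u ⟧))
    ≡⟨ cong₂ (λ a b → m + (a + b)) (trans (∑-swap V V _)
        (trans (∑-cong V (λ v → trans (∑-cong V (λ u → cong (λ b → ⟦ b ∧ lt v u ⟧) (h-sym u v)))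
        (sym (cnt≡∑ _ V)))) (sym (cnt-allEdges n h)))) (sym (cnt≡∑ _ V)) ⟩
  m + (m + size (λ u → h u u)) ≡⟨ rearrange m _ ⟩
  2 * m + size (λ u → h u u) ∎
  where
  open ≡-Reasoning
  V = allFin n
  m = cnt (uncurry h) (allEdges n)
  rearrange : ∀ a b → a + (a + b) ≡ 2 * a + b
  rearrange = solve-∀
  one : ∀ u v → ⟦ h u v ⟧ ≡ ⟦ h u v ∧ lt u v ⟧ + (⟦ h u v ∧ lt v u ⟧ + ⟦ h u v ∧ does (u FP.≟ v) ⟧)
  one u v with h u v
  ... | false = refl
  ... | true with FP.<-cmp u v
  ...   | tri< a ¬b ¬c rewrite dec-true (u FP.<? v) a | dec-false (u FP.≟ v) ¬b | dec-false (v FP.<? u) ¬c =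
      refl
  ...   | tri≈ ¬a b ¬c rewrite dec-false (u FP.<? v) ¬a | dec-true (u FP.≟ v) b | dec-false (v FP.<? u) ¬c =
      refl
  ...   | tri> ¬a ¬b c rewrite dec-false (u FP.<? v) ¬a | dec-false (u FP.≟ v) ¬b | dec-true (v FP.<? u) c =
      refl

cnt-allEdges≤ : ∀ n (h : Fin n → Fin n → Bool) → cnt (uncurry h) (allEdges n) ≤ ∑ (allFin n) (λ u → size (h u))
cnt-allEdges≤ n h = ≤-trans (≤-reflexive (cnt-allEdges n h))
  (∑-mono (allFin n) (λ u _ → size-mono (λ v hv → proj₁ (∧⁻ {h u v} hv))))

∑-product : ∀ (f g : Fin n → Bool) → ∑ (allFin n) (λ u → size (λ v → f u ∧ g v)) ≡ size f * size g
∑-product {n} f g = trans (∑-cong (allFin n) one) (∑-⟦⟧* f (size g) (allFin n))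
  where
  one : ∀ u → size (λ v → f u ∧ g v) ≡ ⟦ f u ⟧ * size g
  one u with f u
  ... | true = sym (+-identityʳ _)
  ... | false = cnt-zero _ (allFin n) (λ _ _ → refl)

length-allEdges : ∀ n → n * n ≡ 2 * length (allEdges n) + n
length-allEdges n = trans (trans (cong₂ _*_ (sym sizetrue) (sym sizetrue))
    (sym (∑-product {n} (const true) (const true))))
  (trans (cnt-symmetric n (λ _ _ → true) (λ _ _ → refl))
      (cong₂ (λ a b → 2 * a + b) (cnt-const-true (allEdges n)) sizetrue))
  where
  sizetrue : size {n} (const true) ≡ n
  sizetrue = trans (cnt-const-true (allFin n)) (length-allFin n)

2*nC2 : ∀ n → n * n ≡ 2 * (n C 2) + n
2*nC2 zero = refl
2*nC2 (suc n) = begin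
  suc n * suc n ≡⟨ expand n ⟩
  n * n + (n + suc n) ≡⟨ cong (_+ (n + suc n)) (2*nC2 n) ⟩
  2 * (n C 2) + n + (n + suc n) ≡⟨ collect n (n C 2) ⟩
  2 * (n + n C 2) + suc n ≡⟨ cong (λ z → 2 * (z + n C 2) + suc n) (nC1≡n n) ⟨
  2 * (n C 1 + n C 2) + suc n ≡⟨ cong (λ z → 2 * z + suc n) (nCk+nC[k+1]≡[n+1]C[k+1] n 1) ⟩
  2 * (suc n C 2) + suc n ∎
  where
  open ≡-Reasoning
  expand : ∀ n → suc n * suc n ≡ n * n + (n + suc n)
  expand = solve-∀
  collect : ∀ n c → 2 * c + n + (n + suc n) ≡ 2 * (n + c) + suc n
  collect = solve-∀

length-allEdges≡nC2 : ∀ n → length (allEdges n) ≡ n C 2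
length-allEdges≡nC2 n = *-cancelˡ-≡ _ _ 2 (+-cancelʳ-≡ n _ _ (trans (sym (length-allEdges n)) (2*nC2 n)))

-- Adjacency, triangles and neighbourhoods

some : (A → Bool) → List A → Bool
some f [] = false
some f (x ∷ xs) = f x ∨ some f xs

some⁺ : ∀ (f : A → Bool) {xs x} → x ∈ₗ xs → f x ≡ true → some f xs ≡ true
some⁺ f (here refl) fx = ∨⁺ˡ fx
some⁺ f {y ∷ _} (there x∈) fx = ∨⁺ʳ {f y} (some⁺ f x∈ fx)

some⁻ : ∀ (f : A → Bool) xs → some f xs ≡ true → ∃ λ x → x ∈ₗ xs × f x ≡ true
some⁻ f (x ∷ xs) h with ∨⁻ {f x} h
... | inj₁ fx = x , here refl , fx
... | inj₂ h′ with y , y∈ , fy ← some⁻ f xs h′ = y , there y∈ , fy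

_∈ᵉ?_ : ∀ (e : Edge n) p → Dec (e ∈ₗ p)
_∈ᵉ?_ = DecMembership._∈?_ (≡-dec FP._≟_ FP._≟_)

memᵉ : List (Edge n) → Edge n → Bool
memᵉ p e = does (e ∈ᵉ? p)

memᵉ⁺ : ∀ {p : List (Edge n)} {e} → e ∈ₗ p → memᵉ p e ≡ true
memᵉ⁺ = does⁺ (_ ∈ᵉ? _)

memᵉ⁻ : ∀ {p : List (Edge n)} {e} → memᵉ p e ≡ true → e ∈ₗ p
memᵉ⁻ = does⁻ (_ ∈ᵉ? _)

adj : List (Edge n) → Fin n → Fin n → Bool
adj p u v = memᵉ p (u , v) ∨ memᵉ p (v , u)

adj⁺ : ∀ {p : List (Edge n)} {u v} → (u , v) ∈ₗ p ⊎ (v , u) ∈ₗ p → adj p u v ≡ true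
adj⁺ (inj₁ h) = ∨⁺ˡ (memᵉ⁺ h)
adj⁺ {p = p} {u} {v} (inj₂ h) = ∨⁺ʳ {memᵉ p (u , v)} (memᵉ⁺ h)

adj⁻ : ∀ {p : List (Edge n)} {u v} → adj p u v ≡ true → (u , v) ∈ₗ p ⊎ (v , u) ∈ₗ p
adj⁻ {p = p} {u} {v} h with ∨⁻ {memᵉ p (u , v)} h
... | inj₁ e = inj₁ (memᵉ⁻ e)
... | inj₂ e = inj₂ (memᵉ⁻ e)

adj-sym : ∀ (p : List (Edge n)) {u v} → adj p u v ≡ true → adj p v u ≡ true
adj-sym p {u} {v} h = trans (∨-comm (memᵉ p (v , u)) (memᵉ p (u , v))) h

adj-mono : ∀ {p q : List (Edge n)} → (∀ {e} → e ∈ₗ p → e ∈ₗ q) → ∀ {u v} → adj p u v ≡ true → adj q u v ≡ true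
adj-mono {p = p} p⊆q h with adj⁻ {p = p} h
... | inj₁ e = adj⁺ (inj₁ (p⊆q e))
... | inj₂ e = adj⁺ (inj₂ (p⊆q e))

take-⊆ : ∀ {s t} → s ≤ t → ∀ (xs : List A) {x} → x ∈ₗ take s xs → x ∈ₗ take t xs
take-⊆ {s = s} {t} s≤t xs {x} x∈ = subst (λ k → x ∈ₗ take k xs) (m+[n∸m]≡n s≤t)
  (subst (x ∈ₗ_) (sym (take-+ s (t ∸ s) xs)) (∈-++⁺ˡ x∈))

∈-allEdges⁻ : ∀ {u v : Fin n} → (u , v) ∈ₗ allEdges n → u F.< v
∈-allEdges⁻ {n} h = proj₂ (∈-filter⁻
    (λ p → proj₁ p FP.<? proj₂ p) {xs = cartesianProduct (allFin n) (allFin n)} h)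

triangle : List (Edge n) → Fin n → Fin n → Fin n → Bool
triangle p u v w = adj p u v ∧ (adj p v w ∧ adj p u w)

covered : List (Edge n) → Fin n → Bool
covered {n} p u = some (λ v → some (triangle p u v) (allFin n)) (allFin n)

covered⁺ : ∀ {p : List (Edge n)} {u v w} → adj p u v ≡ true → adj p v w ≡ true → adj p u w ≡ true →
  covered p u ≡ true
covered⁺ {p = p} {u} {v} {w} a b c =
  some⁺ (λ v → some (triangle p u v) (allFin _)) (∈-allFin v)
      (some⁺ (triangle p u v) (∈-allFin w) (∧⁺ a (∧⁺ b c)))

covered⁻ : ∀ {p : List (Edge n)} {u} → covered p u ≡ true →
  ∃₂ λ v w → adj p u v ≡ true × adj p v w ≡ true × adj p u w ≡ true
covered⁻ {n} {p} {u} h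
  with v , _ , h′ ← some⁻ (λ v → some (triangle p u v) (allFin n)) (allFin n) h
  with w , _ , h″ ← some⁻ (triangle p u v) (allFin n) h′
  with a , bc ← ∧⁻ {adj p u v} h″
  with b , c ← ∧⁻ {adj p v w} bc = v , w , a , b , c

covered-mono : ∀ {p q : List (Edge n)} → (∀ {e} → e ∈ₗ p → e ∈ₗ q) → ∀ {u} → covered p u ≡ true →
  covered q u ≡ true
covered-mono {p = p} {q} p⊆q {u} h with v , w , a , b , c ← covered⁻ {p = p} h =
  covered⁺ {p = q} {u} {v} {w} (adj-mono p⊆q {u} a) (adj-mono p⊆q {v} b) (adj-mono p⊆q {u} c)

nbr : List (Edge n) → List (Fin n) → Fin n → Bool
nbr p as v = not (mem as v) ∧ some (λ u → adj p u v) as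

nbr⁻ : ∀ {p : List (Edge n)} {as v} → nbr p as v ≡ true → (v ∈ₗ as → ⊥) × ∃ λ u → u ∈ₗ as × adj p u v ≡ true
nbr⁻ {p = p} {as} {v} h with ¬m , s ← ∧⁻ {not (mem as v)} h =
  (λ v∈ → true≢false (mem⁺ v∈) (not⁻ ¬m)) , some⁻ (λ u → adj p u v) as s

nbr⁺ : ∀ {p : List (Edge n)} {as u v} → ¬ (v ∈ₗ as) → u ∈ₗ as → adj p u v ≡ true → nbr p as v ≡ true
nbr⁺ {p = p} {as} {u} {v} v∉ u∈ a = ∧⁺ (not⁺ (≢true⇒false (v∉ ∘ mem⁻))) (some⁺ (λ u → adj p u v) u∈ a)

both : (Fin n → Bool) → Edge n → Bool
both f e = f (proj₁ e) ∧ f (proj₂ e)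

-- Uncovered sets decrease, so the first one with at most M elements contains all later ones.
critical : ℕ → List (Edge n) → List (Edge n) → Fin n → Bool
critical M pre rest with size (not ∘ covered pre) ≤? M
critical M pre rest | yes _ = not ∘ covered pre
critical M pre [] | no _ = const false
critical M pre (e ∷ rest) | no _ = critical M (pre ∷ʳ e) rest

-- Holds for every edge list, because the empty set is the default when no uncovered set is small.
-- The shuffle needs the bound after every prefix.
size-critical : ∀ M (pre rest : List (Edge n)) → size (critical M pre rest) ≤ M
size-critical M pre rest with size (not ∘ covered pre) ≤? M
size-critical M pre rest | yes h = h
size-critical {n} M pre [] | no _ = ≤-trans (≤-reflexive (cnt-zero (const false) (allFin n) (λ _ _ → refl))) z≤n
size-critical M pre (e ∷ rest) | no _ = size-critical M (pre ∷ʳ e) rest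

-- The scan of `p₁ ++ p₂` stops within `p₁`. Hence a set computed up to a fixed time serves all
-- earlier ones, in particular τ, which depends on the removed edges.
critical-⊇ : ∀ M (pre p₁ p₂ : List (Edge n)) {v} → size (not ∘ covered (pre ++ p₁)) ≤ M →
  covered (pre ++ p₁) v ≡ false → critical M pre (p₁ ++ p₂) v ≡ true
critical-⊇ M pre p₁ p₂ {v} h u with size (not ∘ covered pre) ≤? M
critical-⊇ M pre p₁ p₂ {v} h u | yes _ =
    not⁺ (≢true⇒false λ c → true≢false (covered-mono {p = pre} (λ e∈ → ∈-++⁺ˡ e∈) {v} c) u)
critical-⊇ M pre [] p₂ {v} h u | no ¬h =
    ⊥-elim (¬h (subst (λ q → size (not ∘ covered q) ≤ M) (++-identityʳ pre) h))
critical-⊇ M pre (e ∷ p₁) p₂ {v} h u | no _ =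
  critical-⊇ M (pre ∷ʳ e) p₁ p₂ (subst (λ q → size (not ∘ covered q) ≤ M) (sym (++-assoc pre (e ∷ []) p₁)) h)
    (subst (λ q → covered q v ≡ false) (sym (++-assoc pre (e ∷ []) p₁)) u)

-- The properties to be excluded

Sparse : ℕ → ℕ → ℕ → Ordering n → Set
Sparse k a b σ = ∃ λ as → length as ≡ a × Unique as × size (nbr (take k σ) as) < b

-- The neighbourhood is taken at time `k`, its stability at time `k + m`: the `m` edges in between
-- are independent of the choice of the pairs they have to miss.
StableNeighbourhood : ℕ → ℕ → ℕ → ℕ → Ordering n → Set
StableNeighbourhood k m a b σ = ∃ λ as → length as ≡ a × b ≤ size (nbr (take k σ) as) ×
  cnt (both (nbr (take k σ) as)) (take (k + m) σ) ≡ 0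

Codegree : ℕ → ℕ → Ordering n → Set
Codegree t K σ = ∃₂ λ x y → ∃ λ ws → x ≢ y × length ws ≡ K × Unique ws ×
  (∀ {w} → w ∈ₗ ws → adj (take t σ) x w ≡ true × adj (take t σ) y w ≡ true)

-- The removed set F has `f` edges, all inside the critical set of the remaining ones among the
-- first `t`.
NearlyLast : ℕ → ℕ → ℕ → Ordering n → Set
NearlyLast t M f = Shuffled t f (λ π → both (critical M [] π))

-- Stable cuts

-- Stable cuts with their two sides as Boolean predicates, whose sizes can be counted. The symmetry
-- of the sides allows either to be the small one.
record Cut (p : List (Edge n)) (A S B : Fin n → Bool) : Set where
  field
    cover : ∀ v → A v ≡ true ⊎ S v ≡ true ⊎ B v ≡ true
    A∩S : ∀ v → A v ≡ true → S v ≡ true → ⊥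
    S∩B : ∀ v → S v ≡ true → B v ≡ true → ⊥
    stable : ∀ u v → S u ≡ true → S v ≡ true → adj p u v ≡ true → ⊥
    separated : ∀ u v → A u ≡ true → B v ≡ true → adj p u v ≡ true → ⊥
    a∈A : ∃ λ a → A a ≡ true
    b∈B : ∃ λ b → B b ≡ true

Cut-sym : ∀ {p : List (Edge n)} {A S B} → Cut p A S B → Cut p B S A
Cut-sym {p = p} c = record
  { cover = λ v → rot (cover v) ; A∩S = λ v b s → S∩B v s b ; S∩B = λ v s a → A∩S v a s ; stable = stable
  ; separated = λ u v b a h → separated v u a b (adj-sym p {u} h) ; a∈A = b∈B ; b∈B = a∈A }
  where
  open Cut c
  rot : ∀ {X Y Z : Set} → X ⊎ Y ⊎ Z → Z ⊎ Y ⊎ X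
  rot (inj₁ x) = inj₂ (inj₂ x)
  rot (inj₂ (inj₁ y)) = inj₂ (inj₁ y)
  rot (inj₂ (inj₂ z)) = inj₁ z

Cut-⊆ : ∀ {p q : List (Edge n)} {A S B} → (∀ {e} → e ∈ₗ q → e ∈ₗ p) → Cut p A S B → Cut q A S B
Cut-⊆ q⊆p c = record
  { cover = cover ; A∩S = A∩S ; S∩B = S∩B
  ; stable = λ u v su sv h → stable u v su sv (adj-mono q⊆p {u} h)
  ; separated = λ u v au bv h → separated u v au bv (adj-mono q⊆p {u} h)
  ; a∈A = a∈A ; b∈B = b∈B }
  where open Cut c

module _ {p : List (Edge n)} {A S B} (c : Cut p A S B) where
  open Cut c

  -- This needs the whole side: the neighbours of a part of `A` may lie in `A`, and only `B` is
  -- excluded for them.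
  nbr-A⊆S : ∀ {as} → (∀ {v} → A v ≡ true → v ∈ₗ as) → (∀ {v} → v ∈ₗ as → A v ≡ true) → ∀ {v} →
    nbr p as v ≡ true → S v ≡ true
  nbr-A⊆S A⊆ ⊆A {v} h with v∉ , u , u∈ , uv ← nbr⁻ {p = p} h | cover v
  ... | inj₁ a = ⊥-elim (v∉ (A⊆ a))
  ... | inj₂ (inj₁ s) = s
  ... | inj₂ (inj₂ b) = ⊥-elim (separated u v (⊆A u∈) b uv)

  B-nbr-disjoint : ∀ {as} → (∀ {v} → v ∈ₗ as → A v ≡ true) → size B + size (nbr p as) ≤ n
  B-nbr-disjoint ⊆A = size-disjoint λ v b h → let _ , u , u∈ , uv = nbr⁻ {p = p} h in separated u v (⊆A u∈) b uv

  S-nbr-disjoint : ∀ {ss} → (∀ {v} → v ∈ₗ ss → S v ≡ true) → size S + size (nbr p ss) ≤ n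
  S-nbr-disjoint ⊆S = size-disjoint λ v s h → let _ , u , u∈ , uv = nbr⁻ {p = p} h in stable u v (⊆S u∈) s uv

  size-cut : n ≤ size A + (size S + size B)
  size-cut = ≤-trans (≤-reflexive (sym all-n))
      (≤-trans (size-cover {f = const true} {A} {λ v → S v ∨ B v} cov₁) (+-monoʳ-≤ (size A) (size-cover cov₂)))
    where
    all-n : size {n} (const true) ≡ n
    all-n = trans (cnt-const-true (allFin n)) (length-allFin n)
    cov₁ : ∀ v → true ≡ true → A v ≡ true ⊎ S v ∨ B v ≡ true
    cov₁ v _ with cover v
    ... | inj₁ a = inj₁ a
    ... | inj₂ (inj₁ s) = inj₂ (∨⁺ˡ s)
    ... | inj₂ (inj₂ b) = inj₂ (∨⁺ʳ {S v} b)
    cov₂ : ∀ v → S v ∨ B v ≡ true → S v ≡ true ⊎ B v ≡ true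
    cov₂ v = ∨⁻ {S v}

-- Each side misses the neighbourhood of an a-subset of the other side, which
-- leaves more than n/3 vertices for S; but S misses that of an a-subset of itself.
no-balanced-cut : ∀ {p : List (Edge n)} {A S B} (a d : ℕ) → 2 * n < 3 * d → 3 * a ≤ n →
  (∀ as → length as ≡ a → Unique as → d ≤ size (nbr p as)) →
  Cut p A S B → a ≤ size A → a ≤ size B → ⊥
no-balanced-cut {n} {p} {A} {S} {B} a d 2n<3d 3a≤n exp c a≤A a≤B = <-irrefl refl (begin-strict
  n + (2 * n) <⟨ +-monoʳ-< n 2n<3d ⟩
  n + 3 * d ≤⟨ +-monoˡ-≤ (3 * d) (size-cut c) ⟩
  (size A + (size S + size B)) + 3 * d ≡⟨ rearrange (size A) (size S) (size B) d ⟩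
  (size A + d) + ((size S + d) + (size B + d)) ≤⟨ +-mono-≤ A+d (+-mono-≤ S+d B+d) ⟩
  n + (n + n) ≡⟨ cong (λ z → n + (n + z)) (+-identityʳ n) ⟨
  n + 2 * n ∎)
  where
  open ≤-Reasoning
  rearrange : ∀ a s b d → (a + (s + b)) + 3 * d ≡ (a + d) + ((s + d) + (b + d))
  rearrange = solve-∀
  B+d : size B + d ≤ n
  B+d with as , len , uq , ⊆A ← subset-of-size A a a≤A =
      ≤-trans (+-monoʳ-≤ (size B) (exp as len uq)) (B-nbr-disjoint c ⊆A)
  A+d : size A + d ≤ n
  A+d with bs , len , uq , ⊆B ← subset-of-size B a a≤B =
      ≤-trans (+-monoʳ-≤ (size A) (exp bs len uq)) (B-nbr-disjoint (Cut-sym c) ⊆B)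
  a≤S : a ≤ size S
  a≤S = *-cancelˡ-≤ 3 (+-cancelʳ-≤ (3 * n) _ _ (begin
    3 * a + 3 * n ≤⟨ +-monoˡ-≤ (3 * n) 3a≤n ⟩
    n + 3 * n ≡⟨ r₁ n ⟩
    2 * (2 * n) ≤⟨ *-monoʳ-≤ 2 (<⇒≤ 2n<3d) ⟩
    2 * (3 * d) ≡⟨ r₂ d ⟩
    3 * (d + d) ≤⟨ *-monoʳ-≤ 3 2d≤S+n ⟩
    3 * (size S + n) ≡⟨ *-distribˡ-+ 3 (size S) n ⟩
    3 * size S + 3 * n ∎))
    where
    r₁ : ∀ n → n + 3 * n ≡ 2 * (2 * n)
    r₁ = solve-∀
    r₂ : ∀ d → 2 * (3 * d) ≡ 3 * (d + d)
    r₂ = solve-∀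
    r₃ : ∀ n a b d → (n + (a + b)) + (d + d) ≡ n + ((a + d) + (b + d))
    r₃ = solve-∀
    r₄ : ∀ n a s b → (a + (s + b)) + (n + n) ≡ (n + (a + b)) + (s + n)
    r₄ = solve-∀
    2d≤S+n : d + d ≤ size S + n
    2d≤S+n = +-cancelˡ-≤ (n + (size A + size B)) _ _ (begin
      (n + (size A + size B)) + (d + d) ≡⟨ r₃ n (size A) (size B) d ⟩
      n + ((size A + d) + (size B + d)) ≤⟨ +-mono-≤ (size-cut c) (+-mono-≤ A+d B+d) ⟩
      (size A + (size S + size B)) + (n + n) ≡⟨ r₄ n (size A) (size S) (size B) ⟩
      (n + (size A + size B)) + (size S + n) ∎)
  S+d : size S + d ≤ n
  S+d with ss , len , uq , ⊆S ← subset-of-size S a a≤S =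
      ≤-trans (+-monoʳ-≤ (size S) (exp ss len uq)) (S-nbr-disjoint c ⊆S)

-- Removing the edges inside a small side

adj-irreflexive : ∀ {p : List (Edge n)} → (∀ {e} → e ∈ₗ p → e ∈ₗ allEdges n) → ∀ {u v} → adj p u v ≡ true →
  u ≢ v
adj-irreflexive {p = p} p⊆ {u} h refl with adj⁻ {p = p} h
... | inj₁ e = FP.<-irrefl refl (∈-allEdges⁻ (p⊆ e))
... | inj₂ e = FP.<-irrefl refl (∈-allEdges⁻ (p⊆ e))

take⊆allEdges : ∀ {σ : Ordering n} → IsOrdering n σ → ∀ t {e} → e ∈ₗ take t σ → e ∈ₗ allEdges n
take⊆allEdges {σ = σ} σ↭ t e∈ = ∈-resp-↭ σ↭ (∈-take⁻ t σ e∈)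

-- Once the edges inside A are removed, the uncovered vertices are those of A
-- and some common neighbours of pairs in A.
module _ {σ : Ordering n} (σ↭ : IsOrdering n σ) {τ t K : ℕ} (τ≤t : τ ≤ t) {A S B}
  (c : Cut (take τ σ) A S B) (allCovered : ∀ u → covered (take τ σ) u ≡ true) (¬codeg : ¬ Codegree t K σ) where
  open Cut c
  private
    p = take τ σ
    P = take t σ
    π₁ = filterᵇ (not ∘ both A) p
    π₂ = filterᵇ (not ∘ both A) (take (t ∸ τ) (drop τ σ))
    -- Empty for `x = y`, where the codegree bound says nothing.
    common : Fin n × Fin n → Fin n → Bool
    common (x , y) v = not (does (x FP.≟ y)) ∧ (adj P x v ∧ adj P y v)

    size-common : ∀ xy → size (common xy) ≤ K
    size-common (x , y) with x FP.≟ y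
    ... | yes _ = ≤-trans (≤-reflexive (cnt-zero (const false) (allFin n) (λ _ _ → refl))) z≤n
    ... | no x≢y with K ≤? size (λ v → adj P x v ∧ adj P y v)
    ...   | no K≰ = <⇒≤ (≰⇒> K≰)
    ...   | yes K≤ with ws , len , uq , ⊆c ← subset-of-size (λ v → adj P x v ∧ adj P y v) K K≤ =
      ⊥-elim (¬codeg (x , y , ws , x≢y , len , uq , λ {w} w∈ → ∧⁻ {adj P x w} (⊆c w∈)))

    π₁⊆p : ∀ {e} → e ∈ₗ π₁ → e ∈ₗ p
    π₁⊆p e∈ = proj₁ (∈-filterᵇ⁻ (not ∘ both A) p e∈)

    kept : ∀ {u v} → adj p u v ≡ true → A u ≡ false ⊎ A v ≡ false → adj π₁ u v ≡ true
    kept {u} {v} h or with adj⁻ {p = p} h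
    ... | inj₁ e = adj⁺ (inj₁ (∈-filterᵇ⁺ (not ∘ both A) e (keeps or)))
      where
      keeps : A u ≡ false ⊎ A v ≡ false → not (A u ∧ A v) ≡ true
      keeps (inj₁ e) rewrite e = refl
      keeps (inj₂ e) rewrite e = cong not (BP.∧-zeroʳ (A u))
    ... | inj₂ e = adj⁺ (inj₂ (∈-filterᵇ⁺ (not ∘ both A) e (keeps or)))
      where
      keeps : A u ≡ false ⊎ A v ≡ false → not (A v ∧ A u) ≡ true
      keeps (inj₁ e) rewrite e = cong not (BP.∧-zeroʳ (A v))
      keeps (inj₂ e) rewrite e = refl

    removed : ∀ {u v} → adj π₁ u v ≡ true → A u ≡ true → A v ≡ true → ⊥
    removed {u} {v} h au av with adj⁻ {p = π₁} h
    ... | inj₁ e = true≢false (∧⁺ au av) (not⁻ (proj₂ (∈-filterᵇ⁻ (not ∘ both A) p e)))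
    ... | inj₂ e = true≢false (∧⁺ av au) (not⁻ (proj₂ (∈-filterᵇ⁻ (not ∘ both A) p e)))

    side : ∀ {u v} → A u ≡ true → adj π₁ u v ≡ true → S v ≡ true
    side {u} {v} au h with cover v
    ... | inj₁ av = ⊥-elim (removed h au av)
    ... | inj₂ (inj₁ sv) = sv
    ... | inj₂ (inj₂ bv) = ⊥-elim (separated u v au bv (adj-mono π₁⊆p {u} h))

    -- Without inner edges all neighbours of a vertex of `A` lie in the stable set, so no two of
    -- them are adjacent.
    A-uncovered : ∀ {u} → A u ≡ true → covered π₁ u ≡ false
    A-uncovered {u} au = ≢true⇒false λ cu → let v , w , uv , vw , uw = covered⁻ {p = π₁} cu in
      stable v w (side au uv) (side au uw) (adj-mono π₁⊆p {v} vw)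

    pairsA = cartesianProduct (elements A) (elements A)

    uncovered : ∀ v → not (covered π₁ v) ≡ true → A v ≡ true ⊎ ((not (covered π₁ v) ∧ not (A v)) ≡ true)
    uncovered v h with A v
    ... | true = inj₁ refl
    ... | false = inj₂ (∧⁺ h refl)

    -- A triangle at a vertex outside `A` can lose only its opposite edge, and then both ends of
    -- that edge lie in `A`.
    outside : ∀ v → not (covered π₁ v) ∧ not (A v) ≡ true → ∃ λ xy → xy ∈ₗ pairsA × common xy v ≡ true
    outside v h with ¬cv , ¬av ← ∧⁻ {not (covered π₁ v)} h
                   | x , y , vx , xy , vy ← covered⁻ {p = p} (allCovered v) = go (A x) refl (A y) refl
      where
      keep : A x ≡ false ⊎ A y ≡ false → ⊥
      keep or = true≢false (covered⁺ {p = π₁} {v} {x} {y}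
          (kept vx (inj₁ (not⁻ (proj₂ (∧⁻ {not (covered π₁ v)} h))))) (kept xy or)
          (kept vy (inj₁ (not⁻ (proj₂ (∧⁻ {not (covered π₁ v)} h))))))
        (not⁻ (proj₁ (∧⁻ {not (covered π₁ v)} h)))
      up : ∀ {u w} → adj p u w ≡ true → adj P u w ≡ true
      up {u} = adj-mono (take-⊆ τ≤t σ) {u}
      go : ∀ a → A x ≡ a → ∀ b → A y ≡ b → ∃ λ xy → xy ∈ₗ pairsA × common xy v ≡ true
      go false ax _ _ = ⊥-elim (keep (inj₁ ax))
      go true ax false ay = ⊥-elim (keep (inj₂ ay))
      go true ax true ay = (x , y) , ∈-cartesianProduct⁺ (∈-elements⁺ A ax) (∈-elements⁺ A ay) ,
        ∧⁺ (not⁺ (dec-false (x FP.≟ y) (adj-irreflexive {p = p} (take⊆allEdges σ↭ τ) {x} {y} xy)))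
           (∧⁺ (up (adj-sym p {v} {x} vx)) (up (adj-sym p {v} {y} vy)))

    size-uncovered : size (not ∘ covered π₁) ≤ size A + size A * size A * K
    size-uncovered = ≤-trans (size-cover uncovered) (+-monoʳ-≤ (size A)
      (≤-trans (size-⋃ pairsA common _ outside (λ xy _ → size-common xy))
        (*-monoˡ-≤ K (≤-reflexive (trans (length-cartesianProductWith (elements A))
            (cong₂ _*_ (length-elements A) (length-elements A)))))))
      where
      length-cartesianProductWith : ∀ (xs : List (Fin n)) {ys : List (Fin n)} →
        length (cartesianProduct xs ys) ≡ length xs * length ys
      length-cartesianProductWith [] = refl
      length-cartesianProductWith (x ∷ xs) {ys} =
          trans (length-++ (map (x ,_) ys)) (cong₂ _+_ (length-map (x ,_) ys) (length-cartesianProductWith xs))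

    inside : ∀ {u v} → A u ≡ true → A v ≡ true → adj p u v ≡ true → ∃ λ e → e ∈ₗ p × both A e ≡ true
    inside au av h with adj⁻ {p = p} h
    ... | inj₁ e = _ , e , ∧⁺ au av
    ... | inj₂ e = _ , e , ∧⁺ av au

    -- In a triangle at a vertex of `A` the other two corners avoid `B` and cannot both lie in the
    -- stable set, so one is in `A`.
    insideEdge : ∃ λ e → e ∈ₗ p × both A e ≡ true
    insideEdge with u , au ← a∈A with v , w , uv , vw , uw ← covered⁻ {p = p} (allCovered u) | cover v | cover w
    ... | inj₁ av | _ = inside au av uv
    ... | inj₂ (inj₁ _) | inj₁ aw = inside au aw uw
    ... | inj₂ (inj₁ sv) | inj₂ (inj₁ sw) = ⊥-elim (stable v w sv sw vw)
    ... | inj₂ (inj₁ _) | inj₂ (inj₂ bw) = ⊥-elim (separated u w au bw uw)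
    ... | inj₂ (inj₂ bv) | _ = ⊥-elim (separated u v au bv uv)

  -- F consists of the edges inside `A` among the first `t`, not just the first τ, since the shuffle
  -- needs a time fixed in advance. What is left begins with `π₁`, whose uncovered set is small and
  -- contains `A`; so the critical set of what is left contains `A` too.
  small-cut⇒nearlyLast : ∀ {a M} → size A ≤ a → a + a * a * K ≤ M → ∃ λ f →
    1 ≤ f × f ≤ a * a × NearlyLast t M f σ
  small-cut⇒nearlyLast {a} {M} A≤a ≤M = length (filterᵇ (both A) P) ,
    ≤-trans (cnt-pos (both A) (take-⊆ τ≤t σ (proj₁ (proj₂ insideEdge))) (proj₂ (proj₂ insideEdge)))
        (≤-reflexive (sym count)) ,
    ≤-trans (≤-reflexive count) few , both A , refl ,
    cnt-zero _ (filterᵇ (both A) P) λ e e∈ → cong not (inCritical e (proj₂ (∈-filterᵇ⁻ (both A) P e∈)))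
    where
    count = cnt≡length-filter (both A) P
    few : cnt (both A) P ≤ a * a
    few = begin
      cnt (both A) P ≤⟨ m≤m+n _ _ ⟩
      cnt (both A) P + cnt (both A) (drop t σ) ≡⟨ cnt-++ (both A) P (drop t σ) ⟨
      cnt (both A) (P ++ drop t σ) ≡⟨ cong (cnt (both A)) (take++drop≡id t σ) ⟩
      cnt (both A) σ ≡⟨ cnt-↭ (both A) σ↭ ⟩
      cnt (both A) (allEdges n) ≤⟨ cnt-allEdges≤ n (λ u v → A u ∧ A v) ⟩
      ∑ (allFin n) (λ u → size (λ v → A u ∧ A v)) ≡⟨ ∑-product A A ⟩
      size A * size A ≤⟨ *-mono-≤ A≤a A≤a ⟩
      a * a ∎
      where open ≤-Reasoning
    split : filterᵇ (not ∘ both A) P ≡ π₁ ++ π₂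
    split = trans (cong (filterᵇ (not ∘ both A))
        (trans (cong (λ k → take k σ) (sym (m+[n∸m]≡n τ≤t))) (take-+ τ (t ∸ τ) σ)))
      (filter-++ (λ e → T? (not (both A e))) p _)
    crit : ∀ {v} → A v ≡ true → critical M [] (filterᵇ (not ∘ both A) P) v ≡ true
    crit {v} av = subst (λ q → critical M [] q v ≡ true) (sym split)
      (critical-⊇ M [] π₁ π₂ {v} (≤-trans size-uncovered
          (≤-trans (+-mono-≤ A≤a (*-monoˡ-≤ K (*-mono-≤ A≤a A≤a))) ≤M)) (A-uncovered av))
    inCritical : ∀ e → both A e ≡ true → both (critical M [] (filterᵇ (not ∘ both A) P)) e ≡ true
    inCritical (u , v) h with au , av ← ∧⁻ {A u} h = ∧⁺ (crit au) (crit av)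

-- Translating between subsets and Boolean predicates

∈-tabulate⁺ : ∀ (f : Fin n → Bool) {v} → f v ≡ true → v ∈ˢ tabulate f
∈-tabulate⁺ f {v} fv = lookup⇒[]= v (tabulate f) (trans (lookup∘tabulate f v) fv)

∈-tabulate⁻ : ∀ (f : Fin n → Bool) {v} → v ∈ˢ tabulate f → f v ≡ true
∈-tabulate⁻ f {v} h = trans (sym (lookup∘tabulate f v)) ([]=⇒lookup h)

two-others : ∀ (u : Fin (3 + n)) → ∃₂ λ x y → u ≢ x × u ≢ y × x ≢ y
two-others zero = suc zero , suc (suc zero) , (λ ()) , (λ ()) , λ ()
two-others (suc zero) = zero , suc (suc zero) , (λ ()) , (λ ()) , λ ()
two-others (suc (suc u)) = zero , suc zero , (λ ()) , (λ ()) , λ ()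

PathAvoiding-start : ∀ {R : Fin n → Fin n → Set} {S u v} → PathAvoiding R S u v → u ∉ˢ S
PathAvoiding-start (here u∉) = u∉
PathAvoiding-start (step u∉ _ _) = u∉

PathAvoiding-∷ʳ : ∀ {R : Fin n → Fin n → Set} {S u v w} → PathAvoiding R S u v → R v w → w ∉ˢ S →
  PathAvoiding R S u w
PathAvoiding-∷ʳ (here u∉) r w∉ = step u∉ r (here w∉)
PathAvoiding-∷ʳ (step u∉ r′ π) r w∉ = step u∉ r′ (PathAvoiding-∷ʳ π r w∉)

-- The neighbourhood of an uncovered vertex is a stable cut; if it is
-- everything else, the graph is a star and its centre is one.
uncovered⇒stableCut : 3 ≤ n → ∀ {σ : Ordering n} → IsOrdering n σ → ∀ s u → covered (take s σ) u ≡ false →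
  Σ (Subset n) (StableCut (Adj σ s))
uncovered⇒stableCut {n} (s≤s (s≤s (s≤s _))) {σ} σ↭ s u un with FP.any?
    (λ v → BP._≟_ (adj (take s σ) u v ∨ does (u FP.≟ v)) false)

... | yes (v , far) = tabulate (adj p u) , stable , u , v , u∉ , v∉ , blocked
  where
  p = take s σ
  noLoop : ∀ {u} → adj p u u ≡ true → ⊥
  noLoop {u} h = adj-irreflexive {p = p} (take⊆allEdges σ↭ s) {u} {u} h refl
  stable : Stable (Adj σ s) (tabulate (adj p u))
  stable x y x∈ y∈ xy = true≢false (covered⁺ {p = p} {u} {x} {y} (∈-tabulate⁻ (adj p u) x∈) (adj⁺ xy)
      (∈-tabulate⁻ (adj p u) y∈)) un
  u∉ : u ∉ˢ tabulate (adj p u)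
  u∉ h = noLoop {u} (∈-tabulate⁻ (adj p u) h)
  v∉ : v ∉ˢ tabulate (adj p u)
  v∉ h = true≢false (∨⁺ˡ {adj p u v} (∈-tabulate⁻ (adj p u) h)) far
  blocked : ¬ PathAvoiding (Adj σ s) (tabulate (adj p u)) u v
  blocked (here _) = true≢false (∨⁺ʳ {adj p u u} (does⁺ (u FP.≟ u) refl)) far
  blocked (step _ r π) = PathAvoiding-start π (∈-tabulate⁺ (adj p u) (adj⁺ r))
... | no none with x , y , u≢x , u≢y , x≢y ← two-others u =
  tabulate center , stable , x , y , ∉center u≢x , ∉center u≢y , blocked
  where
  p = take s σ
  center = λ v → does (u FP.≟ v)
  is-center : ∀ {v} → v ∈ˢ tabulate center → u ≡ v
  is-center {v} h = does⁻ (u FP.≟ v) (∈-tabulate⁻ center h)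
  ∉center : ∀ {v} → u ≢ v → v ∉ˢ tabulate center
  ∉center u≢v h = u≢v (is-center h)
  star : ∀ {v} → u ≢ v → adj p u v ≡ true
  star {v} u≢v with adj p u v in eq
  ... | true = refl
  ... | false = ⊥-elim (none (v , trans (cong (_∨ does (u FP.≟ v)) eq) (dec-false (u FP.≟ v) u≢v)))
  stable : Stable (Adj σ s) (tabulate center)
  stable a b a∈ b∈ ab = adj-irreflexive {p = p} (take⊆allEdges σ↭ s) {a} {b} (adj⁺ ab)
      (trans (sym (is-center a∈)) (is-center b∈))
  blocked : ¬ PathAvoiding (Adj σ s) (tabulate center) x y
  blocked (here _) = x≢y refl
  blocked (step {v = w} _ r π) = true≢false (covered⁺ {p = p} {u} {x} {w} (star u≢x) (adj⁺ r) (star u≢w)) un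
    where
    u≢w : u ≢ w
    u≢w u≡w = PathAvoiding-start π (∈-tabulate⁺ center (does⁺ (u FP.≟ w) u≡w))

-- Makes reachability decidable at all vertices at once, under a double negation. This suffices, as
-- `HasNoStableCut` is a negation.
¬¬-decidable : ∀ (P : Fin n → Set) → ¬ ¬ (∀ v → Dec (P v))
¬¬-decidable {zero} P k = k λ ()
¬¬-decidable {suc n} P k = ¬¬-excluded-middle λ d → ¬¬-decidable (P ∘ suc) λ ds →
    k λ { zero → d ; (suc v) → ds v }

-- One side is what `u` reaches outside `S`, the other everything else outside `S`; an edge between
-- them would extend a path.
stableCut⇒Cut : ∀ {σ : Ordering n} {s} → Σ (Subset n) (StableCut (Adj σ s)) →
  ¬ ¬ (∃ λ A → ∃₂ λ S B → Cut (take s σ) A S B)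
stableCut⇒Cut {σ = σ} {s} (S , stab , u , v , u∉ , v∉ , blocked) =
    ¬¬-map build (¬¬-decidable (PathAvoiding (Adj σ s) S u))
  where
  build : (∀ w → Dec (PathAvoiding (Adj σ s) S u w)) → ∃ λ A → ∃₂ λ S B → Cut (take s σ) A S B
  build reach? = A′ , S′ , B′ , record
    { cover = cover ; A∩S = A∩S
    ; S∩B = λ w sw bw → true≢false sw (not⁻ (proj₂ (∧⁻ {not (A′ w)} bw)))
    ; stable = λ x y sx sy xy → stab x y (does⁻ (x ∈ˢ? S) sx) (does⁻ (y ∈ˢ? S) sy) (adj⁻ {p = take s σ} xy)
    ; separated = λ x y ax by xy → true≢false
        (does⁺ (reach? y) (PathAvoiding-∷ʳ (does⁻ (reach? x) ax) (adj⁻ {p = take s σ} xy) (outside by)))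
        (not⁻ (proj₁ (∧⁻ {not (A′ y)} by)))
    ; a∈A = u , does⁺ (reach? u) (here u∉)
    ; b∈B = v , ∧⁺ (not⁺ (dec-false (reach? v) blocked)) (not⁺ (dec-false (v ∈ˢ? S) v∉)) }
    where
    A′ S′ B′ : Fin _ → Bool
    A′ w = does (reach? w)
    S′ w = does (w ∈ˢ? S)
    B′ w = not (A′ w) ∧ not (S′ w)
    outside : ∀ {w} → B′ w ≡ true → w ∉ˢ S
    outside {w} bw w∈ = true≢false (does⁺ (w ∈ˢ? S) w∈) (not⁻ (proj₂ (∧⁻ {not (A′ w)} bw)))
    end∉ : ∀ {R : Fin _ → Fin _ → Set} {S x y} → PathAvoiding R S x y → y ∉ˢ S
    end∉ (here x∉) = x∉
    end∉ (step _ _ π) = end∉ π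
    A∩S : ∀ w → A′ w ≡ true → S′ w ≡ true → ⊥
    A∩S w aw sw = end∉ (does⁻ (reach? w) aw) (does⁻ (w ∈ˢ? S) sw)
    cover : ∀ w → A′ w ≡ true ⊎ S′ w ≡ true ⊎ B′ w ≡ true
    cover w with does (reach? w) | does (w ∈ˢ? S)
    ... | true | _ = inj₁ refl
    ... | false | true = inj₂ (inj₁ refl)
    ... | false | false = inj₂ (inj₂ refl)

-- Typical orderings have equal hitting times

least : ∀ (P : ℕ → Set) → (∀ t → Dec (P t)) → ∀ t → P t → ∃ λ τ → τ ≤ t × P τ × (∀ s → s < τ → ¬ P s)
least P P? zero p = zero , z≤n , p , λ _ ()
least P P? (suc t) p with P? zero
... | yes p₀ = zero , z≤n , p₀ , λ _ ()
... | no ¬p₀ with τ , τ≤ , pτ , min ← least (P ∘ suc) (P? ∘ suc) t p = suc τ , s≤s τ≤ , pτ ,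
  λ { zero _ p₀ → ¬p₀ p₀ ; (suc s) (s≤s s<τ) ps → min s s<τ ps }

-- `k` stands for `T` and `k + m` for `t`. The vertex `z` places τ after `k + k`, so that the edges
-- between `k` and `k + k` are present at τ; `unstable-late`, about single vertices, places τ no
-- later than `k + m`.
record Typical (k m a₀ a⋆ D K M : ℕ) (z : Fin n) (σ : Ordering n) : Set where
  field
    uncovered-early : covered (take (k + k) σ) z ≡ false
    expanding : ∀ a → 1 ≤ a → a ≤ a⋆ → ¬ Sparse k a (a * D) σ
    unstable : ∀ a → a₀ ≤ a → a ≤ a⋆ → ¬ StableNeighbourhood k k a (a * D) σ
    unstable-late : ¬ StableNeighbourhood k m 1 (1 * D) σ
    codegree : ¬ Codegree (k + m) K σ
    notLast : ∀ f → 1 ≤ f → f ≤ a₀ * a₀ → ¬ NearlyLast (k + m) M f σ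

module _ {k m a₀ a⋆ D K M : ℕ} {z : Fin n} {σ : Ordering n} (σ↭ : IsOrdering n σ)
  (typ : Typical k m a₀ a⋆ D K M z σ)
  (3≤n : 3 ≤ n) (1≤a⋆ : 1 ≤ a⋆) (2n<3a⋆D : 2 * n < 3 * (a⋆ * D)) (3a⋆≤n : 3 * a⋆ ≤ n) (≤M : a₀ + a₀ * a₀ * K
    ≤ M) where
  open Typical typ

  private
    Covered : ℕ → Set
    Covered t = ∀ u → covered (take t σ) u ≡ true

    Covered? : ∀ t → Dec (Covered t)
    Covered? t = FP.all? (λ u → BP._≟_ (covered (take t σ) u) true)

    expands : ∀ as → 1 ≤ length as → length as ≤ a⋆ → Unique as → length as * D ≤ size (nbr (take k σ) as)
    expands as 1≤ ≤a⋆ uq with length as * D ≤? size (nbr (take k σ) as)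
    ... | yes h = h
    ... | no h = ⊥-elim (expanding (length as) 1≤ ≤a⋆ (as , refl , uq , ≰⇒> h))

    -- The neighbours that an uncovered vertex had at time `k` would still be pairwise non-adjacent
    -- at `k + m`, and expansion makes them numerous.
    covered-late : Covered (k + m)
    covered-late u with covered (take (k + m) σ) u in eq
    ... | true = refl
    ... | false = ⊥-elim (unstable-late (u ∷ [] , refl , expands (u ∷ []) ≤-refl 1≤a⋆ (All.[] ∷ []) ,
                    cnt-zero _ (take (k + m) σ) λ e e∈ → ≢true⇒false λ h → edge e e∈ h))
      where
      nbr⇒adj : ∀ {v} → nbr (take k σ) (u ∷ []) v ≡ true → adj (take (k + m) σ) u v ≡ true
      nbr⇒adj {v} h with _ , _ , here refl , uv ← nbr⁻ {p = take k σ} {u ∷ []} {v} h =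
          adj-mono (take-⊆ (m≤m+n k m) σ) {u} {v} uv
      edge : ∀ e → e ∈ₗ take (k + m) σ → both (nbr (take k σ) (u ∷ [])) e ≡ true → ⊥
      edge (x , y) e∈ h with nx , ny ← ∧⁻ {nbr (take k σ) (u ∷ []) x} h =
        true≢false (covered⁺ {p = take (k + m) σ} {u} {x} {y} (nbr⇒adj nx) (adj⁺ (inj₁ e∈)) (nbr⇒adj ny)) eq

    -- From `a₀` vertices on, the neighbourhood of the side at time `k` lies in the stable set,
    -- against `unstable`; a smaller side is excluded by its inner edges through `notLast`.
    no-small-cut : ∀ {τ A S B} → k + k ≤ τ → τ ≤ k + m → Covered τ → Cut (take τ σ) A S B → size A ≤ a⋆ → ⊥
    no-small-cut {τ} {A} {S} {B} k+k≤τ τ≤ cov c A≤a⋆ with a₀ ≤? size A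
    ... | no A<a₀ with f , 1≤f , f≤ , last ← small-cut⇒nearlyLast σ↭ τ≤ c cov codegree {a₀}
        (<⇒≤ (≰⇒> A<a₀)) ≤M =
      notLast f 1≤f f≤ last
    ... | yes a₀≤A = unstable (size A) a₀≤A A≤a⋆ (as , length-elements A ,
        subst (λ l → l * D ≤ size (nbr q as)) (length-elements A)
          (expands as (subst (1 ≤_) (sym (length-elements A)) (size-pos {f = A} (proj₂ (Cut.a∈A c))))
              (subst (_≤ a⋆) (sym (length-elements A)) A≤a⋆) (elements-unique A)) ,
        cnt-zero _ (take (k + k) σ) λ e e∈ → ≢true⇒false λ h → edge e e∈ h)
      where
      as = elements A
      q = take k σ
      N⊆S : ∀ {v} → nbr q as v ≡ true → S v ≡ true
      N⊆S = nbr-A⊆S (Cut-⊆ (take-⊆ (≤-trans (m≤m+n k k) k+k≤τ) σ) c) (∈-elements⁺ A) (∈-elements⁻ A)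
      edge : ∀ e → e ∈ₗ take (k + k) σ → both (nbr q as) e ≡ true → ⊥
      edge (x , y) e∈ h with nx , ny ← ∧⁻ {nbr q as x} h =
        Cut.stable c x y (N⊆S nx) (N⊆S ny) (adj⁺ (inj₁ (take-⊆ k+k≤τ σ e∈)))

    no-cut : ∀ {τ A S B} → k + k ≤ τ → τ ≤ k + m → Covered τ → ¬ Cut (take τ σ) A S B
    no-cut {τ} {A} {S} {B} k+k≤τ τ≤ cov c with size A ≤? a⋆ | size B ≤? a⋆
    ... | yes A≤ | _ = no-small-cut k+k≤τ τ≤ cov c A≤
    ... | no _ | yes B≤ = no-small-cut k+k≤τ τ≤ cov (Cut-sym c) B≤
    ... | no A> | no B> = no-balanced-cut a⋆ (a⋆ * D) 2n<3a⋆D 3a⋆≤n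
      (λ as len uq → subst (λ l → l * D ≤ size (nbr (take k σ) as)) len
          (expands as (subst (1 ≤_) (sym len) 1≤a⋆) (≤-reflexive len) uq))
      (Cut-⊆ (take-⊆ (≤-trans (m≤m+n k k) k+k≤τ) σ) c) (<⇒≤ (≰⇒> A>)) (<⇒≤ (≰⇒> B>))

  typical⇒hittingTimesEqual : HittingTimesEqual σ
  typical⇒hittingTimesEqual with τ , τ≤ , covτ , first ← least Covered Covered? (k + m) covered-late =
    τ , (noCut , cutBefore) , (λ u → triangles u) , λ s s<τ h → first s s<τ (allCovered s h)
    where
    k+k≤τ : k + k ≤ τ
    k+k≤τ with k + k ≤? τ
    ... | yes h = h
    ... | no h = ⊥-elim (true≢false (covered-mono {p = take τ σ} (take-⊆ (<⇒≤ (≰⇒> h)) σ) {z} (covτ z))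
        uncovered-early)
    noCut : HasNoStableCut σ τ
    noCut sc = stableCut⇒Cut sc λ (A , S , B , c) → no-cut k+k≤τ τ≤ covτ c
    cutBefore : ∀ s → s < τ → ¬ HasNoStableCut σ s
    cutBefore s s<τ h with u , un ← FP.¬∀⟶∃¬ n _ (λ u → BP._≟_ (covered (take s σ) u) true) (first s s<τ) =
      h (uncovered⇒stableCut 3≤n σ↭ s u (≢true⇒false un))
    triangles : EveryVertexInTriangle σ τ
    triangles u with v , w , a , b , c ← covered⁻ {p = take τ σ} (covτ u) =
      v , w , adj⁻ {p = take τ σ} a , adj⁻ {p = take τ σ} b , adj⁻ {p = take τ σ} c
    allCovered : ∀ s → EveryVertexInTriangle σ s → Covered s
    allCovered s h u with v , w , a , b , c ← h u =
        covered⁺ {p = take s σ} {u} {v} {w} (adj⁺ a) (adj⁺ b) (adj⁺ c)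

-- Exceptional events

-- Bernoulli's inequality for `1 + q / r`, multiplied by `r ^ (c + 1)`.
bernoulli : ∀ c r q → r ^ c * r + c * q * r ^ c ≤ (r + q) ^ c * r
bernoulli zero r q = ≤-reflexive (+-identityʳ (1 * r))
bernoulli (suc c) r q = begin
  r * r ^ c * r + (q + c * q) * (r * r ^ c) ≡⟨ e₁ r (r ^ c) q (c * q) ⟩
  r * (r ^ c * r + c * q * r ^ c) + q * (r ^ c * r)
      ≤⟨ +-mono-≤ (*-monoʳ-≤ r (bernoulli c r q)) (*-monoʳ-≤ q (*-monoˡ-≤ r (^-monoˡ-≤ c (m≤m+n r q)))) ⟩
  r * ((r + q) ^ c * r) + q * ((r + q) ^ c * r) ≡⟨ e₂ r q ((r + q) ^ c) ⟩
  (r + q) * (r + q) ^ c * r ∎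
  where
  open ≤-Reasoning
  e₁ : ∀ r p q x → r * p * r + (q + x) * (r * p) ≡ r * (p * r + x * p) + q * (p * r)
  e₁ = solve-∀
  e₂ : ∀ r q p → r * (p * r) + q * (p * r) ≡ (r + q) * p * r
  e₂ = solve-∀

-- From `r ≤ c * q`, the lower bound `1 + c q / r` of Bernoulli is at least 2.
halving : ∀ c r q → 1 ≤ c → r + q ≤ c * q → 2 * r ^ c ≤ (r + q) ^ c
halving (suc c) zero q _ _ = z≤n
halving c r@(suc _) q _ h = *-cancelʳ-≤ _ _ r (begin
  2 * r ^ c * r ≡⟨ e₁ (r ^ c) r ⟩
  r ^ c * r + r * r ^ c ≤⟨ +-monoʳ-≤ (r ^ c * r) (*-monoˡ-≤ (r ^ c) (≤-trans (m≤m+n r q) h)) ⟩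
  r ^ c * r + c * q * r ^ c ≤⟨ bernoulli c r q ⟩
  (r + q) ^ c * r ∎)
  where
  open ≤-Reasoning
  e₁ : ∀ p r → 2 * p * r ≡ p * r + r * p
  e₁ = solve-∀

-- A substitute for `1 - x ≤ exp (- x)`: the `m` factors contain `e` blocks, each of which halves
-- the product.
power-decay : ∀ e m q N → 1 ≤ q → 1 ≤ N → 2 * e * N ≤ q * m → 2 ^ e * (N ∸ q) ^ m ≤ N ^ m
power-decay zero m q N _ _ _ = ≤-trans (≤-reflexive (*-identityˡ _)) (^-monoˡ-≤ m (m∸n≤m N q))
power-decay e@(suc _) zero q@(suc _) N@(suc _) _ _ h rewrite *-zeroʳ q with () ← h
power-decay e@(suc _) m@(suc _) q@(suc q′) N 1≤q 1≤N h with q ≤? N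
... | no q≰N rewrite m≤n⇒m∸n≡0 (<⇒≤ (≰⇒> q≰N)) | *-zeroʳ (2 ^ e) = z≤n
... | yes q≤N = begin
  2 ^ e * r ^ m ≡⟨ cong (λ k → 2 ^ e * r ^ k) (sym (m+[n∸m]≡n c*e≤m)) ⟩
  2 ^ e * r ^ (c * e + m′) ≡⟨ cong (2 ^ e *_) (^-distribˡ-+-* r (c * e) m′) ⟩
  2 ^ e * (r ^ (c * e) * r ^ m′) ≡⟨ *-assoc (2 ^ e) _ _ ⟨
  2 ^ e * r ^ (c * e) * r ^ m′ ≡⟨ cong (λ z → 2 ^ e * z * r ^ m′) (sym (^-*-assoc r c e)) ⟩
  2 ^ e * (r ^ c) ^ e * r ^ m′ ≡⟨ cong (_* r ^ m′) (^-distribʳ-* e 2 (r ^ c)) ⟨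
  (2 * r ^ c) ^ e * r ^ m′ ≤⟨ *-mono-≤ (^-monoˡ-≤ e half) (^-monoˡ-≤ m′ (m∸n≤m N q)) ⟩
  (N ^ c) ^ e * N ^ m′ ≡⟨ cong (_* N ^ m′) (^-*-assoc N c e) ⟩
  N ^ (c * e) * N ^ m′ ≡⟨ ^-distribˡ-+-* N (c * e) m′ ⟨
  N ^ (c * e + m′) ≡⟨ cong (N ^_) (m+[n∸m]≡n c*e≤m) ⟩
  N ^ m ∎
  where
  open ≤-Reasoning
  r = N ∸ q
  r+q≡N : r + q ≡ N
  r+q≡N = m∸n+n≡m q≤N
  -- Block length just above `N / q`: long enough to halve, and at most `2 N / q` because `q ≤ N`.
  -- The latter accounts for the 2 in the hypothesis.
  c = suc (N / q)
  N≤cq : N ≤ c * q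
  N≤cq = ≤-trans (≤-reflexive (m≡m%n+[m/n]*n N q)) (+-monoˡ-≤ (N / q * q) (<⇒≤ (m%n<n N q)))
  cq≤2N : c * q ≤ N + N
  cq≤2N = +-mono-≤ q≤N (m/n*n≤m N q)
  c*e≤m : c * e ≤ m
  c*e≤m = *-cancelˡ-≤ q (begin
    q * (c * e) ≡⟨ e₁ q c e ⟩
    e * (c * q) ≤⟨ *-monoʳ-≤ e cq≤2N ⟩
    e * (N + N) ≡⟨ e₂ e N ⟩
    2 * e * N ≤⟨ h ⟩
    q * m ∎)
    where
    e₁ : ∀ q c e → q * (c * e) ≡ e * (c * q)
    e₁ = solve-∀
    e₂ : ∀ e N → e * (N + N) ≡ 2 * e * N
    e₂ = solve-∀
  m′ = m ∸ c * e
  half : 2 * r ^ c ≤ N ^ c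
  half = subst (λ z → 2 * r ^ c ≤ z ^ c) r+q≡N (halving c r q (s≤s z≤n) (≤-trans (≤-reflexive r+q≡N) N≤cq))

Rare-avoids : ∀ {k m q e} g → k ≤ length (allEdges n) → 1 ≤ length (allEdges n) → 1 ≤ q →
  2 * e * length (allEdges n) ≤ q * m → Rare (allEdges n) (2 ^ e) (Avoids k m q g (allEdges n))
Rare-avoids {n} {k} {m} {q} {e} g k≤ 1≤N 1≤q h =
  Bound⇒Rare (2 ^ e) (1≤^ m 1≤N) (power-decay e m q _ 1≤q 1≤N h) (Bound-avoid-after k m g k≤ ≤-refl 1≤q)

-- The union runs over the set together with its neighbourhood, hence over tuples of length `a + b`.
-- At least `x` vertices lie outside the tuple, and all pairs between them and the set are missed.
Rare-sparse : ∀ {k a b x q e d} → Fin n → a + b + x ≤ n → q + q ≤ a * x → 1 ≤ q → 1 ≤ length (allEdges n) →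
  n ^ (a + b) * d ≤ 2 ^ e → 2 * e * length (allEdges n) ≤ q * k → Rare (allEdges n) d (Sparse k a b)
Rare-sparse {n} {k} {a} {b} {x} {q} {e} {d} z abx≤n 2q≤ 1≤q 1≤N choices decay =
  Bound-⊆ sparse⇒ (Rare-∃ {c = n ^ (a + b)} (tuples n (a + b)) (1≤^ (a + b) (≤-trans (s≤s z≤n) (FP.toℕ<n z)))
      (length-tuples n (a + b))
    λ ws _ → Rare-weaken choices (Rare-avoids {q = q} {e} (λ _ → gap ws) z≤n 1≤N 1≤q decay))
  where
  gap : List (Fin n) → Edge n → Bool
  gap ws (u , v) = (mem (take a ws) u ∧ not (mem ws v)) ∨ (not (mem ws u) ∧ mem (take a ws) v)
  sparse⇒ : ∀ σ → σ ↭ allEdges n → Sparse k a b σ → ∃ λ ws →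
    ws ∈ₗ tuples n (a + b) × Avoids 0 k q (λ _ → gap ws) (allEdges n) σ
  sparse⇒ σ σ↭ (as , len , uq , small) = ws , subst (λ l → ws ∈ₗ tuples n l) len-ws (∈-tuples ws) , q≤ ,
    cnt-zero (gap ws) (take k σ) (λ e e∈ → ≢true⇒false (noGap e e∈))
    where
    p = take k σ
    S = elements (nbr p as)
    -- Padding by `z` gives the tuples a common length; further vertices in the tuple only shrink
    -- the set of missed pairs, as counted by `x`.
    ss = S ++ replicate (b ∸ length S) z
    ws = as ++ ss
    len-ss : length ss ≡ b
    len-ss = trans (length-++ S) (trans (cong (length S +_) (length-replicate (b ∸ length S)))
      (m+[n∸m]≡n (<⇒≤ (≤-trans (≤-reflexive (cong suc (length-elements (nbr p as)))) small))))
    len-ws : length ws ≡ a + b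
    len-ws = trans (length-++ as) (cong₂ _+_ len len-ss)
    take-ws : take a ws ≡ as
    take-ws = trans (cong (λ l → take l ws) (sym len)) (take-length-++ as)
    A′ = mem (take a ws)
    X = not ∘ mem ws
    A⇒ : ∀ {v} → A′ v ≡ true → v ∈ₗ as
    A⇒ {v} h = subst (v ∈ₗ_) take-ws (mem⁻ h)
    noEdge : ∀ {u v} → adj p u v ≡ true → A′ u ≡ true → X v ≡ true → ⊥
    noEdge {u} {v} uv au xv = true≢false (mem⁺ {xs = ws} (∈-++⁺ʳ as (∈-++⁺ˡ (∈-elements⁺ (nbr p as)
      (nbr⁺ {p = p} {as} {u} {v} (λ v∈ → true≢false (mem⁺ {xs = ws} (∈-++⁺ˡ v∈)) (not⁻ xv)) (A⇒ au) uv)))))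
          (not⁻ xv)
    noGap : ∀ e → e ∈ₗ p → gap ws e ≡ true → ⊥
    noGap (u , v) e∈ h with ∨⁻ {mem (take a ws) u ∧ not (mem ws v)} h
    ... | inj₁ h′ with au , xv ← ∧⁻ {mem (take a ws) u} h′ = noEdge (adj⁺ {p = p} {u} {v} (inj₁ e∈)) au xv
    ... | inj₂ h′ with xu , av ← ∧⁻ {not (mem ws u)} h′ = noEdge (adj⁺ {p = p} {v} {u} (inj₂ e∈)) av xu
    A⊆ws : ∀ {v} → A′ v ≡ true → X v ≡ true → ⊥
    A⊆ws av xv = true≢false (mem⁺ {xs = ws} (∈-++⁺ˡ (A⇒ av))) (not⁻ xv)
    a≤A : a ≤ size A′
    a≤A = ≤-trans (≤-reflexive (sym len))
        (unique⇒length≤size A′ uq (λ v∈ → mem⁺ (subst (_ ∈ₗ_) (sym take-ws) v∈)))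
    x≤X : x ≤ size X
    x≤X = +-cancelˡ-≤ (a + b) _ _ (≤-trans abx≤n (≤-trans (≤-reflexive (sym (size-not (mem ws))))
      (+-monoˡ-≤ (size X) (≤-trans (size-mem≤ ws) (≤-reflexive len-ws)))))
    h : Fin n → Fin n → Bool
    h u v = gap ws (u , v)
    h-sym : ∀ u v → h u v ≡ h v u
    h-sym u v = trans (cong₂ _∨_ (∧-comm (A′ u) (X v)) (∧-comm (X u) (A′ v))) (∨-comm (X v ∧ A′ u) (A′ v ∧ X u))
    diagonal : ∀ v → h v v ≡ true → ⊥
    diagonal v hv with ∨⁻ {A′ v ∧ X v} hv
    ... | inj₁ h′ = A⊆ws (proj₁ (∧⁻ {A′ v} h′)) (proj₂ (∧⁻ {A′ v} h′))
    ... | inj₂ h′ = A⊆ws (proj₂ (∧⁻ {X v} h′)) (proj₁ (∧⁻ {X v} h′))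
    -- Pairs are counted from `A′` to `X` only, which loses a factor 2 and explains `q + q` in the
    -- hypothesis.
    q≤ : q ≤ cnt (gap ws) (allEdges n)
    q≤ = *-cancelˡ-≤ 2 (begin
      2 * q ≡⟨ cong (q +_) (+-identityʳ q) ⟩
      q + q ≤⟨ 2q≤ ⟩
      a * x ≤⟨ *-mono-≤ a≤A x≤X ⟩
      size A′ * size X ≡⟨ ∑-product A′ X ⟨
      ∑ (allFin n) (λ u → size (λ v → A′ u ∧ X v))
          ≤⟨ ∑-mono (allFin n) (λ u _ → size-mono {f = λ v → A′ u ∧ X v} {h u} (λ v → ∨⁺ˡ {A′ u ∧ X v})) ⟩
      ∑ (allFin n) (λ u → size (h u)) ≡⟨ cnt-symmetric n h h-sym ⟩
      2 * cnt (gap ws) (allEdges n) + size (λ v → h v v)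
          ≡⟨ cong (2 * cnt (gap ws) (allEdges n) +_)
          (cnt-zero (λ v → h v v) (allFin n) (λ v _ → ≢true⇒false (diagonal v))) ⟩
      2 * cnt (gap ws) (allEdges n) + 0 ≡⟨ +-identityʳ _ ⟩
      2 * cnt (gap ws) (allEdges n) ∎)
      where open ≤-Reasoning

-- Monotonicity of `x (x - 1)`, written without subtraction.
square-gap : ∀ {q b s} → q + q + b ≤ b * b → b ≤ s → q + q + s ≤ s * s
square-gap {q} {zero} {s} h b≤s with q
... | zero = s≤s*s s
  where
  s≤s*s : ∀ s → s ≤ s * s
  s≤s*s zero = z≤n
  s≤s*s (suc s) = m≤m+n (suc s) (s * suc s)
square-gap {q} {suc b} {suc s} h b≤s@(s≤s b≤s′) = begin
  q + q + suc s ≡⟨ +-comm (q + q) (suc s) ⟩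
  suc s + (q + q) ≤⟨ +-monoʳ-≤ (suc s)
      (≤-trans (+-cancelˡ-≤ (suc b) _ _ (≤-trans (≤-reflexive (+-comm (suc b) (q + q))) h))
      (*-mono-≤ b≤s′ b≤s)) ⟩
  suc s + s * suc s ∎
  where open ≤-Reasoning

cnt-both : ∀ (f : Fin n → Bool) {q b} → q + q + b ≤ b * b → b ≤ size f → q ≤ cnt (both f) (allEdges n)
cnt-both {n} f {q} {b} h b≤ = *-cancelˡ-≤ 2 (+-cancelʳ-≤ (size f) _ _ (begin
  2 * q + size f ≡⟨ cong (λ z → q + z + size f) (+-identityʳ q) ⟩
  q + q + size f ≤⟨ square-gap {q} h b≤ ⟩
  size f * size f ≡⟨ ∑-product f f ⟨
  ∑ (allFin n) (λ u → size (λ v → f u ∧ f v))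
      ≡⟨ cnt-symmetric n (λ u v → f u ∧ f v) (λ u v → ∧-comm (f u) (f v)) ⟩
  2 * cnt (both f) (allEdges n) + size (λ v → f v ∧ f v)
      ≡⟨ cong (2 * cnt (both f) (allEdges n) +_) (cnt-cong (λ v → BP.∧-idem (f v)) (allFin n)) ⟩
  2 * cnt (both f) (allEdges n) + size f ∎))
  where open ≤-Reasoning

-- The first `k` edges determine the neighbourhood, so the union pays for the set of `a` vertices
-- alone.
Rare-stableNeighbourhood : ∀ {k m a b q e d} → 1 ≤ n → k ≤ length (allEdges n) → 1 ≤ length (allEdges n) →
  q + q + b ≤ b * b → 1 ≤ q → n ^ a * d ≤ 2 ^ e → 2 * e * length (allEdges n) ≤ q * m →
  Rare (allEdges n) d (StableNeighbourhood k m a b)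
Rare-stableNeighbourhood {n} {k} {m} {a} {b} {q} {e} {d} 1≤n k≤ 1≤N 2q≤ 1≤q choices decay =
  Bound-⊆ stable⇒ (Rare-∃ {c = n ^ a} (tuples n a) (1≤^ a 1≤n) (length-tuples n a)
    λ as _ → Rare-weaken choices (Rare-avoids {q = q} {e} (λ π → both (nbr π as)) k≤ 1≤N 1≤q decay))
  where
  stable⇒ : ∀ σ → σ ↭ allEdges n → StableNeighbourhood k m a b σ →
    ∃ λ as → as ∈ₗ tuples n a × Avoids k m q (λ π → both (nbr π as)) (allEdges n) σ
  stable⇒ σ _ (as , len , b≤ , none) = as , subst (λ l → as ∈ₗ tuples n l) len (∈-tuples as) ,
    cnt-both (nbr (take k σ) as) 2q≤ b≤ , none

allEdges-unique : ∀ n → Unique (allEdges n)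
allEdges-unique n = Uniq.filter⁺ _ (Uniq.cartesianProduct⁺ (Uniq.allFin⁺ n) (Uniq.allFin⁺ n))

cnt-memᵉ≤ : ∀ (es : List (Edge n)) → cnt (memᵉ es) (allEdges n) ≤ length es
cnt-memᵉ≤ {n} es = begin
  cnt (memᵉ es) (allEdges n) ≡⟨ cnt≡length-filter (memᵉ es) (allEdges n) ⟨
  length (filterᵇ (memᵉ es) (allEdges n))
    ≤⟨ unique⇒length≤cnt (const true) {ys = es} (Uniq.filter⁺ _ (allEdges-unique n))
        (λ e∈ → memᵉ⁻ (proj₂ (∈-filterᵇ⁻ (memᵉ es) (allEdges n) e∈)) , refl) ⟩
  cnt (const true) es ≡⟨ cnt-const-true es ⟩
  length es ∎
  where open ≤-Reasoning

cnt-take≤ : ∀ {A : Set} (f : A → Bool) t σ → cnt f (take t σ) ≤ cnt f σ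
cnt-take≤ f t σ = ≤-trans (m≤m+n _ _)
    (≤-reflexive (trans (sym (cnt-++ f (take t σ) (drop t σ))) (cong (cnt f) (take++drop≡id t σ))))

Contains : ℕ → ℕ → List (Edge n) → Ordering n → Set
Contains t f es σ = length es ≡ f × Unique es × (∀ {e} → e ∈ₗ es → e ∈ₗ take t σ)

-- The shuffle with the edges themselves as the allowed set. It loses `f ^ f`, which is harmless for
-- the bounded `f` of the applications.
Rare-contains : ∀ {t f ℓ d} → 1 ≤ ℓ → f ≤ t → ℓ + t ≤ length (allEdges n) → d * (t * f) ^ f ≤ ℓ ^ f →
  ∀ es → Rare (allEdges n) d (Contains t f es)
Rare-contains {n} {t} {f} {ℓ} {d} 1≤ℓ f≤t ℓ+t≤ small es =
  Bound-dec (length es ≟ f) (λ _ _ → proj₁) λ len →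
  Bound⇒Rare d (1≤^ f 1≤ℓ) small (Bound-⊆ shuffled
    (Bound-shuffle t f (λ _ → memᵉ es) 1≤ℓ f≤t ℓ+t≤ (λ _ → ≤-trans (cnt-memᵉ≤ es) (≤-reflexive len))))
  where
  shuffled : ∀ σ → σ ↭ allEdges n → Contains t f es σ → Shuffled t f (λ _ → memᵉ es) σ
  shuffled σ σ↭ (len , uq , es⊆) = memᵉ es ,
    trans (cnt≡length-filter (memᵉ es) (take t σ)) (≤-antisym
      (≤-trans (cnt-take≤ (memᵉ es) t σ) (≤-trans (≤-reflexive (cnt-↭ (memᵉ es) σ↭))
          (≤-trans (cnt-memᵉ≤ es) (≤-reflexive len))))
      (≤-trans (≤-reflexive (sym len)) (unique⇒length≤cnt (memᵉ es) uq (λ e∈ → es⊆ e∈ , memᵉ⁺ e∈)))) ,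
    cnt-zero _ (filterᵇ (memᵉ es) (take t σ)) λ e e∈ → cong not (proj₂ (∈-filterᵇ⁻ (memᵉ es) (take t σ) e∈))

edge : Fin n → Fin n → Edge n
edge u v = if does (u FP.<? v) then (u , v) else (v , u)

edge-cases : ∀ (u v : Fin n) → edge u v ≡ (u , v) ⊎ edge u v ≡ (v , u)
edge-cases u v with does (u FP.<? v)
... | true = inj₁ refl
... | false = inj₂ refl

edge-injective : ∀ {u v x y : Fin n} → edge u v ≡ edge x y → (u ≡ x × v ≡ y) ⊎ (u ≡ y × v ≡ x)
edge-injective {u = u} {v} {x} {y} h with edge-cases u v | edge-cases x y
... | inj₁ p | inj₁ q with refl ← trans (sym p) (trans h q) = inj₁ (refl , refl)
... | inj₁ p | inj₂ q with refl ← trans (sym p) (trans h q) = inj₂ (refl , refl)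
... | inj₂ p | inj₁ q with refl ← trans (sym p) (trans h q) = inj₂ (refl , refl)
... | inj₂ p | inj₂ q with refl ← trans (sym p) (trans h q) = inj₁ (refl , refl)

edge-∈ : ∀ {p : List (Edge n)} → (∀ {e} → e ∈ₗ p → e ∈ₗ allEdges n) → ∀ {u v} → adj p u v ≡ true → edge u v ∈ₗ p
edge-∈ {p = p} p⊆ {u} {v} h with adj⁻ {p = p} {u} {v} h
... | inj₁ e rewrite dec-true (u FP.<? v) (∈-allEdges⁻ (p⊆ e)) = e
... | inj₂ e rewrite dec-false (u FP.<? v) (FP.<-asym (∈-allEdges⁻ (p⊆ e))) = e

-- First moment: `n ^ (2 + K)` choices against `K + K` edges of probability about n^(-2/3) each. The
-- balance is n^(2 - K/3), so `K = 7` will do.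
Rare-codegree : ∀ {t K ℓ d} → 1 ≤ n → 1 ≤ ℓ → K + K ≤ t → ℓ + t ≤ length (allEdges n) →
  n ^ (2 + K) * d * (t * (K + K)) ^ (K + K) ≤ ℓ ^ (K + K) → Rare (allEdges n) d (Codegree t K)
Rare-codegree {n} {t} {K} {ℓ} {d} 1≤n 1≤ℓ 2K≤t ℓ+t≤ small =
  Bound-⊆ codegree⇒ (Rare-∃ {c = n ^ (2 + K)} (tuples n (2 + K)) (1≤^ (2 + K) 1≤n) (length-tuples n (2 + K))
    λ ws _ → Rare-contains 1≤ℓ 2K≤t ℓ+t≤ small (stars ws))
  where
  stars : List (Fin n) → List (Edge n)
  stars (x ∷ y ∷ ws) = map (edge x) ws ++ map (edge y) ws
  stars _ = []
  codegree⇒ : ∀ σ → σ ↭ allEdges n → Codegree t K σ → ∃ λ ws →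
    ws ∈ₗ tuples n (2 + K) × Contains t (K + K) (stars ws) σ
  codegree⇒ σ σ↭ (x , y , ws , x≢y , len , uq , adjs) = x ∷ y ∷ ws ,
      subst (λ l → x ∷ y ∷ ws ∈ₗ tuples n (2 + l)) len (∈-tuples (x ∷ y ∷ ws)) ,
    trans (length-++ (map (edge x) ws)) (cong₂ _+_ (trans (length-map (edge x) ws) len)
        (trans (length-map (edge y) ws) len)) ,
    Uniq.++⁺ (Uniq.map⁺ (inj x) uq) (Uniq.map⁺ (inj y) uq) disjoint , inP
    where
    p = take t σ
    p⊆ : ∀ {e} → e ∈ₗ p → e ∈ₗ allEdges n
    p⊆ = take⊆allEdges σ↭ t
    inj : ∀ (z : Fin n) {v w} → edge z v ≡ edge z w → v ≡ w
    inj z {v} {w} h with edge-injective h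
    ... | inj₁ (_ , v≡w) = v≡w
    ... | inj₂ (z≡w , v≡z) = trans v≡z z≡w
    disjoint : ∀ {e} → e ∈ₗ map (edge x) ws × e ∈ₗ map (edge y) ws → ⊥
    disjoint (e∈₁ , e∈₂) with w , w∈ , refl ← ∈-map⁻ (edge x) e∈₁ with w′ , w′∈ ,
        h ← ∈-map⁻ (edge y) e∈₂ with edge-injective h
    ... | inj₁ (x≡y , _) = x≢y x≡y
    ... | inj₂ (x≡w′ , _) = adj-irreflexive {p = p} p⊆ {x} {w′} (proj₁ (adjs w′∈)) x≡w′
    inP : ∀ {e} → e ∈ₗ map (edge x) ws ++ map (edge y) ws → e ∈ₗ p
    inP e∈ with ∈-++⁻ (map (edge x) ws) e∈
    ... | inj₁ h with w , w∈ , refl ← ∈-map⁻ (edge x) h = edge-∈ p⊆ {x} {w} (proj₁ (adjs w∈))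
    ... | inj₂ h with w , w∈ , refl ← ∈-map⁻ (edge y) h = edge-∈ p⊆ {y} {w} (proj₂ (adjs w∈))

-- First moment: n² pairs of further corners against three edges of probability about n^(-2/3). The
-- powers of n cancel, so the logarithmic factors in the time decide.
Rare-covered : ∀ {t ℓ d} (z : Fin n) → 1 ≤ ℓ → 3 ≤ t → ℓ + t ≤ length (allEdges n) →
  n ^ 2 * d * (t * 3) ^ 3 ≤ ℓ ^ 3 → Rare (allEdges n) d (λ σ → covered (take t σ) z ≡ true)
Rare-covered {n} {t} {ℓ} {d} z 1≤ℓ 3≤t ℓ+t≤ small =
  Bound-⊆ covered⇒ (Rare-∃ {c = n ^ 2} (tuples n 2) (1≤^ 2 (≤-trans (s≤s z≤n) (FP.toℕ<n z))) (length-tuples n 2)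
    λ ws _ → Rare-contains 1≤ℓ 3≤t ℓ+t≤ small (sides ws))
  where
  sides : List (Fin n) → List (Edge n)
  sides (v ∷ w ∷ _) = edge z v ∷ edge v w ∷ edge z w ∷ []
  sides _ = []
  covered⇒ : ∀ σ → σ ↭ allEdges n → covered (take t σ) z ≡ true → ∃ λ ws →
    ws ∈ₗ tuples n 2 × Contains t 3 (sides ws) σ
  covered⇒ σ σ↭ h with v , w , zv , vw , zw ← covered⁻ {p = take t σ} {z} h =
    v ∷ w ∷ [] , ∈-tuples (v ∷ w ∷ []) , refl , (h₁ All.∷ h₂ All.∷ All.[]) ∷ (h₃ All.∷ All.[]) ∷ All.[] ∷ [] ,
    λ { (here refl) → edge-∈ p⊆ {z} {v} zv ; (there (here refl)) →
        edge-∈ p⊆ {v} {w} vw ; (there (there (here refl))) → edge-∈ p⊆ {z} {w} zw }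
    where
    p = take t σ
    p⊆ : ∀ {e} → e ∈ₗ p → e ∈ₗ allEdges n
    p⊆ = take⊆allEdges σ↭ t
    z≢v = adj-irreflexive {p = p} p⊆ {z} {v} zv
    v≢w = adj-irreflexive {p = p} p⊆ {v} {w} vw
    z≢w = adj-irreflexive {p = p} p⊆ {z} {w} zw
    h₁ : edge z v ≢ edge v w
    h₁ e with edge-injective e
    ... | inj₁ (z≡v , _) = z≢v z≡v
    ... | inj₂ (z≡w , _) = z≢w z≡w
    h₂ : edge z v ≢ edge z w
    h₂ e with edge-injective e
    ... | inj₁ (_ , v≡w) = v≢w v≡w
    ... | inj₂ (z≡w , _) = z≢w z≡w
    h₃ : edge v w ≢ edge z w
    h₃ e with edge-injective e
    ... | inj₁ (v≡z , _) = z≢v (sym v≡z)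
    ... | inj₂ (v≡w , _) = v≢w v≡w

Rare-nearlyLast : ∀ {t M f ℓ d} → 1 ≤ ℓ → f ≤ t → ℓ + t ≤ length (allEdges n) → d * (t * (M * M)) ^ f ≤ ℓ ^ f →
  Rare (allEdges n) d (NearlyLast t M f)
Rare-nearlyLast {n} {t} {M} {f} {ℓ} {d} 1≤ℓ f≤t ℓ+t≤ small =
  Bound⇒Rare d (1≤^ f 1≤ℓ) small (Bound-shuffle t f (λ π → both (critical M [] π)) 1≤ℓ f≤t ℓ+t≤ few)
  where
  few : ∀ π → cnt (both (critical M [] π)) (allEdges n) ≤ M * M
  few π = ≤-trans (cnt-allEdges≤ n (λ u v → critical M [] π u ∧ critical M [] π v))
    (≤-trans (≤-reflexive (∑-product (critical M [] π) (critical M [] π)))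
        (*-mono-≤ (size-critical M [] π) (size-critical M [] π)))

-- Choice of the parameters

positive-factor : ∀ a {b c} → b < 3 * (a * c) → 1 ≤ a
positive-factor (suc a) _ = s≤s z≤n

-- Up to powers of s, which is about log n: R = n^(1/3), neighbourhoods have size
-- D = R, triangles appear between T and t = R⁴, and ℓ = R⁶ is of the order of N.
module Parameters (n s Q N : ℕ)
  (large : 20000 ≤ s) (n≤2^s : n ≤ 2 ^ s) (Q-large : s ^ 229 ≤ Q)
  (R³≤n : s ^ 6 * Q * (s ^ 6 * Q) * (s ^ 6 * Q) ≤ n)
  (n≤8R³ : n ≤ 8 * (s ^ 6 * Q * (s ^ 6 * Q) * (s ^ 6 * Q)))
  (n²≡2N+n : n * n ≡ 2 * N + n) where

  open ≤-Reasoning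

  -- Making `R` a multiple of `s ^ 6` keeps fractions exact: `D` is `R` over s^5, `y` is `R³` over
  -- s, `T` is `R⁴` over s^2, and `ℓ` is `R⁶` over s. Spare factors `s` absorb the constants. Each
  -- kind of exceptional event gets probability at most `1 / δ`.
  R R³ R⁴ R⁶ D y T m t ℓ a₀ M δ : ℕ
  R = s ^ 6 * Q
  R³ = R * R * R
  R⁴ = R³ * R
  R⁶ = R³ * R³
  D = s * Q
  y = s ^ 5 * (s ^ 6 * (s ^ 6 * (Q * Q * Q)))
  T = R³ * (s ^ 4 * Q)
  m = s ^ 13 * R⁴
  t = T + m
  ℓ = R³ * (R * R) * (s ^ 5 * Q)
  a₀ = s ^ 15
  M = s ^ 31
  δ = s * s

  lit : ∀ c {_ : True (c ≤? 20000)} → c ≤ s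
  lit c {h} = ≤-trans (toWitness h) large

  1≤s : 1 ≤ s
  1≤s = lit 1

  private instance
    s≢0 : NonZero s
    s≢0 = >-nonZero 1≤s

  1≤s^ : ∀ k → 1 ≤ s ^ k
  1≤s^ k = 1≤^ k 1≤s

  s^-+ : ∀ a b c {_ : True (a + b ≟ c)} → s ^ a * s ^ b ≡ s ^ c
  s^-+ a b c {h} = trans (sym (^-distribˡ-+-* s a b)) (cong (s ^_) (toWitness h))

  s^≤Q : ∀ k → k ≤ 229 → s ^ k ≤ Q
  s^≤Q k k≤ = ≤-trans (^-monoʳ-≤ s k≤) Q-large

  1≤Q : 1 ≤ Q
  1≤Q = s^≤Q 0 z≤n

  Q≤R : Q ≤ R
  Q≤R = m≤o*m Q (1≤s^ 6)

  1≤R : 1 ≤ R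
  1≤R = ≤-trans 1≤Q Q≤R

  R≤R² : R ≤ R * R
  R≤R² = m≤o*m R 1≤R

  1≤R³ : 1 ≤ R³
  1≤R³ = *-mono-≤ (*-mono-≤ 1≤R 1≤R) 1≤R

  R≤R³ : R ≤ R³
  R≤R³ = m≤o*m R (*-mono-≤ 1≤R 1≤R)

  s≤n : s ≤ n
  s≤n = ≤-trans (≤-trans (≤-reflexive (sym (*-identityʳ s))) (s^≤Q 1 (s≤s z≤n)))
      (≤-trans Q≤R (≤-trans R≤R³ R³≤n))

  1≤n : 1 ≤ n
  1≤n = ≤-trans 1≤s s≤n

  n²≤4N : n * n ≤ 4 * N
  n²≤4N = +-cancelʳ-≤ (n * n) _ _ (begin
    n * n + n * n ≡⟨ cong₂ _+_ n²≡2N+n n²≡2N+n ⟩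
    (2 * N + n) + (2 * N + n) ≡⟨ e N n ⟩
    4 * N + 2 * n ≤⟨ +-monoʳ-≤ (4 * N) (*-monoˡ-≤ n (≤-trans (lit 2) s≤n)) ⟩
    4 * N + n * n ∎)
    where
    e : ∀ N n → (2 * N + n) + (2 * N + n) ≡ 4 * N + 2 * n
    e = solve-∀

  R⁶≤n² : R⁶ ≤ n * n
  R⁶≤n² = *-mono-≤ R³≤n R³≤n

  n²≤64R⁶ : n * n ≤ 64 * R⁶
  n²≤64R⁶ = ≤-trans (*-mono-≤ n≤8R³ n≤8R³) (≤-reflexive (e R³))
    where
    e : ∀ r → 8 * r * (8 * r) ≡ 64 * (r * r)
    e = solve-∀

  2N≤64R⁶ : 2 * N ≤ 64 * R⁶
  2N≤64R⁶ = ≤-trans (m≤m+n (2 * N) n) (≤-trans (≤-reflexive (sym n²≡2N+n)) n²≤64R⁶)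

  sy≡R³ : s * y ≡ R³
  sy≡R³ = e s (s ^ 5) Q
    where
    e : ∀ s p Q → s * (p * (s * p * (s * p * (Q * Q * Q)))) ≡ s * p * Q * (s * p * Q) * (s * p * Q)
    e = solve-∀

  ssT≡R⁴ : s * s * T ≡ R⁴
  ssT≡R⁴ = e s (s ^ 4) Q R³
    where
    e : ∀ s p Q r → s * s * (r * (p * Q)) ≡ r * (s * (s * p) * Q)
    e = solve-∀

  sℓ≡R⁶ : s * ℓ ≡ R⁶
  sℓ≡R⁶ = e s (s ^ 5) Q R³
    where
    e : ∀ s p Q r → s * (r * (s * p * Q * (s * p * Q)) * (p * Q)) ≡ r * (s * p * Q * (s * p * Q) * (s * p * Q))
    e = solve-∀

  R⁴R²≡R⁶ : R⁴ * (R * R) ≡ R⁶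
  R⁴R²≡R⁶ = e R
    where
    e : ∀ R → R * R * R * R * (R * R) ≡ R * R * R * (R * R * R)
    e = solve-∀

  T≤R⁴ : T ≤ R⁴
  T≤R⁴ = ≤-trans (m≤o*m T (*-mono-≤ 1≤s 1≤s)) (≤-reflexive ssT≡R⁴)

  T≤m : T ≤ m
  T≤m = ≤-trans T≤R⁴ (m≤o*m R⁴ (1≤s^ 13))

  t≤2m : t ≤ 2 * m
  t≤2m = +-mono-≤ T≤m (≤-reflexive (sym (+-identityʳ m)))

  t≤s¹⁴R⁴ : t ≤ s ^ 14 * R⁴
  t≤s¹⁴R⁴ = ≤-trans t≤2m (≤-trans (*-monoˡ-≤ m (lit 2)) (≤-reflexive (sym (*-assoc s (s ^ 13) R⁴))))

  s^≤R² : ∀ k → k ≤ 229 → s ^ k ≤ R * R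
  s^≤R² k k≤ = ≤-trans (s^≤Q k k≤) (≤-trans Q≤R R≤R²)

  1≤ℓ : 1 ≤ ℓ
  1≤ℓ = *-mono-≤ (*-mono-≤ 1≤R³ (*-mono-≤ 1≤R 1≤R)) (*-mono-≤ (1≤s^ 5) 1≤Q)

  -- Since `R⁶ ≤ 4 * N`, it suffices that `8 * ℓ` and `8 * t` are at most `R⁶`.
  ℓ+t≤N : ℓ + t ≤ N
  ℓ+t≤N = *-cancelˡ-≤ 8 (begin
    8 * (ℓ + t) ≡⟨ *-distribˡ-+ 8 ℓ t ⟩
    8 * ℓ + 8 * t ≤⟨ +-mono-≤ (≤-trans (*-monoˡ-≤ ℓ (lit 8)) (≤-reflexive sℓ≡R⁶)) (*-mono-≤ (lit 8) t≤s¹⁴R⁴) ⟩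
    R⁶ + s * (s ^ 14 * R⁴) ≡⟨ cong (R⁶ +_) (sym (*-assoc s (s ^ 14) R⁴)) ⟩
    R⁶ + s ^ 15 * R⁴ ≤⟨ +-monoʳ-≤ R⁶ (*-monoˡ-≤ R⁴ (s^≤R² 15 (lit′ 15))) ⟩
    R⁶ + R * R * R⁴ ≡⟨ cong (R⁶ +_) (trans (*-comm (R * R) R⁴) R⁴R²≡R⁶) ⟩
    R⁶ + R⁶ ≤⟨ +-mono-≤ (≤-trans R⁶≤n² n²≤4N) (≤-trans R⁶≤n² n²≤4N) ⟩
    4 * N + 4 * N ≡⟨ e N ⟩
    8 * N ∎)
    where
    e : ∀ N → 4 * N + 4 * N ≡ 8 * N
    e = solve-∀
    lit′ : ∀ c {_ : True (c ≤? 229)} → c ≤ 229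
    lit′ c {h} = toWitness h

  T+T≤t : T + T ≤ t
  T+T≤t = +-monoʳ-≤ T T≤m

  ℓ+2T≤N : ℓ + (T + T) ≤ N
  ℓ+2T≤N = ≤-trans (+-monoʳ-≤ ℓ T+T≤t) ℓ+t≤N

  T≤N : T ≤ N
  T≤N = ≤-trans (m≤m+n T T) (m+n≤o⇒n≤o ℓ ℓ+2T≤N)

  1≤N : 1 ≤ N
  1≤N = ≤-trans 1≤ℓ (m+n≤o⇒m≤o ℓ ℓ+t≤N)

  Q≤T : Q ≤ T
  Q≤T = ≤-trans (m≤o*m Q (1≤s^ 4)) (m≤o*m (s ^ 4 * Q) 1≤R³)

  s^≤t : ∀ k → k ≤ 229 → s ^ k ≤ t
  s^≤t k k≤ = ≤-trans (s^≤Q k k≤) (≤-trans Q≤T (m≤m+n T m))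

  s≤Q : s ≤ Q
  s≤Q = ≤-trans (≤-reflexive (sym (*-identityʳ s))) (s^≤Q 1 (s≤s z≤n))

  few-edges-early : n ^ 2 * δ * ((T + T) * 3) ^ 3 ≤ ℓ ^ 3
  few-edges-early = *-cancelʳ-≤ _ _ ((s * s) ^ 3) {{m^n≢0 (s * s) 3 {{m*n≢0 s s}}}} (begin
    n ^ 2 * δ * ((T + T) * 3) ^ 3 * (s * s) ^ 3 ≡⟨ *-assoc (n ^ 2 * δ) _ _ ⟩
    n ^ 2 * δ * (((T + T) * 3) ^ 3 * (s * s) ^ 3)
        ≡⟨ cong (n ^ 2 * δ *_) (^-distribʳ-* 3 ((T + T) * 3) (s * s)) ⟨
    n ^ 2 * δ * ((T + T) * 3 * (s * s)) ^ 3
        ≡⟨ cong₂ (λ a b → a * δ * b ^ 3) (cong (n *_) (*-identityʳ n)) (trans (e₁ T s) (cong (6 *_) ssT≡R⁴)) ⟩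
    n * n * δ * (6 * R⁴) ^ 3 ≡⟨ cong (n * n * δ *_) (trans (^-distribʳ-* 3 6 R⁴) (cong (216 *_) (e₂ R³ R))) ⟩
    n * n * δ * (216 * (R³ * R³ * R³ * R³)) ≤⟨ *-monoˡ-≤ _ (*-monoˡ-≤ δ n²≤64R⁶) ⟩
    64 * R⁶ * δ * (216 * (R³ * R³ * R³ * R³)) ≡⟨ e₃ 64 R³ δ 216 ⟩
    -- `13824 = 64 * 6 ^ 3` is the largest constant that a single `s` has to absorb; `20000 ≤ s`
    -- accommodates it.
    13824 * (δ * (R⁶ * R⁶ * R⁶)) ≤⟨ *-monoˡ-≤ (δ * (R⁶ * R⁶ * R⁶)) (lit 13824) ⟩
    s * (s * s * (R⁶ * R⁶ * R⁶)) ≡⟨ e₄ s R⁶ ⟩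
    (R⁶ * s) ^ 3 ≡⟨ cong (λ z → (z * s) ^ 3) sℓ≡R⁶ ⟨
    (s * ℓ * s) ^ 3 ≡⟨ cong (_^ 3) (e₅ s ℓ) ⟩
    (ℓ * (s * s)) ^ 3 ≡⟨ ^-distribʳ-* 3 ℓ (s * s) ⟩
    ℓ ^ 3 * (s * s) ^ 3 ∎)
    where
    e₁ : ∀ T s → (T + T) * 3 * (s * s) ≡ 6 * (s * s * T)
    e₁ = solve-∀
    e₂ : ∀ r R → r * R * (r * R * (r * R * 1)) ≡ r * r * r * (R * R * R)
    e₂ = solve-∀
    e₃ : ∀ a r d b → a * (r * r) * d * (b * (r * r * r * r)) ≡ a * b * (d * (r * r * (r * r) * (r * r)))
    e₃ = solve-∀
    e₄ : ∀ s r → s * (s * s * (r * r * r)) ≡ r * s * (r * s * (r * s * 1))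
    e₄ = solve-∀
    e₅ : ∀ s ℓ → s * ℓ * s ≡ ℓ * (s * s)
    e₅ = solve-∀

  s≤2^s : s ≤ 2 ^ s
  s≤2^s = <⇒≤ (n<2^n s)

  -- Of the three extra factors `2 ^ s`, one pays for the values of `a`, the other two for
  -- `δ = s * s`.
  choices : ∀ k → n ^ k * (n * δ) ≤ 2 ^ (s * (k + 3))
  choices k = begin
    n ^ k * (n * δ) ≤⟨ *-mono-≤ (^-monoˡ-≤ k n≤2^s) (*-mono-≤ n≤2^s (*-mono-≤ s≤2^s s≤2^s)) ⟩
    (2 ^ s) ^ k * (2 ^ s * (2 ^ s * 2 ^ s))
        ≡⟨ cong (λ z → (2 ^ s) ^ k * (2 ^ s * (2 ^ s * z))) (sym (*-identityʳ (2 ^ s))) ⟩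
    (2 ^ s) ^ k * (2 ^ s) ^ 3 ≡⟨ ^-distribˡ-+-* (2 ^ s) k 3 ⟨
    (2 ^ s) ^ (k + 3) ≡⟨ ^-*-assoc 2 s (k + 3) ⟩
    2 ^ (s * (k + 3)) ∎

  4≤D : 4 ≤ D
  4≤D = ≤-trans (lit 4) (≤-trans (≤-reflexive (sym (*-identityʳ s))) (*-monoʳ-≤ s 1≤Q))

  1≤y : 1 ≤ y
  1≤y = *-mono-≤ (1≤s^ 5) (*-mono-≤ (1≤s^ 6) (*-mono-≤ (1≤s^ 6) (*-mono-≤ (*-mono-≤ 1≤Q 1≤Q) 1≤Q)))

  -- The choices cost an exponent of about `2 a s² Q`, and the missed pairs yield one of order
  -- `a R / s³ = a s³ Q`. With `D` smaller than `R` by s^5, one `s` is left for the constants.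
  sparse-decay : ∀ a → 1 ≤ a → 2 * (s * (a + a * D + 3)) * N ≤ a * y * T
  sparse-decay a 1≤a = *-cancelˡ-≤ s (begin
    s * (2 * (s * (a + a * D + 3)) * N) ≡⟨ e₁ s (a + a * D + 3) N ⟩
    s * s * (a + a * D + 3) * (2 * N) ≤⟨ *-mono-≤ (*-monoʳ-≤ (s * s) a+aD+3≤) 2N≤64R⁶ ⟩
    s * s * (a * (2 * (s * Q))) * (64 * R⁶) ≡⟨ e₂ s a Q R⁶ ⟩
    128 * (s * s * s * (a * Q * R⁶)) ≤⟨ *-monoˡ-≤ _ (lit 128) ⟩
    s * (s * s * s * (a * Q * R⁶)) ≡⟨ e₃ s a Q R³ ⟩
    a * R³ * T ≡⟨ cong (λ z → a * z * T) (sym sy≡R³) ⟩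
    a * (s * y) * T ≡⟨ e₄ a s y T ⟩
    s * (a * y * T) ∎)
    where
    a+aD+3≤ : a + a * D + 3 ≤ a * (2 * (s * Q))
    a+aD+3≤ = begin
      a + a * D + 3 ≤⟨ +-monoʳ-≤ (a + a * D) (*-mono-≤ 1≤a (≤-refl {3})) ⟩
      a + a * D + a * 3 ≡⟨ e a D ⟩
      a * (D + 4) ≤⟨ *-monoʳ-≤ a (+-monoʳ-≤ D (≤-trans 4≤D (≤-reflexive (sym (+-identityʳ D))))) ⟩
      a * (2 * (s * Q)) ∎
      where
      e : ∀ a D → a + a * D + a * 3 ≡ a * (D + 4)
      e = solve-∀
    e₁ : ∀ s b N → s * (2 * (s * b) * N) ≡ s * s * b * (2 * N)
    e₁ = solve-∀
    e₂ : ∀ s a Q R → s * s * (a * (2 * (s * Q))) * (64 * R) ≡ 128 * (s * s * s * (a * Q * R))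
    e₂ = solve-∀
    e₃ : ∀ s a Q r → s * (s * s * s * (a * Q * (r * r))) ≡ a * r * (r * (s * (s * (s * (s * 1))) * Q))
    e₃ = solve-∀
    e₄ : ∀ a s y T → a * (s * y) * T ≡ s * (a * y * T)
    e₄ = solve-∀

  -- This is `(a * D) ^ 2 / s`; the division by `s` covers both the half and the diagonal in the
  -- number of pairs among `a * D` vertices.
  q : ℕ → ℕ
  q a = a * D * (a * Q)

  1≤q : ∀ a → 1 ≤ a → 1 ≤ q a
  1≤q a 1≤a = *-mono-≤ (*-mono-≤ 1≤a (≤-trans (s≤s z≤n) 4≤D)) (*-mono-≤ 1≤a 1≤Q)

  2q+b≤b² : ∀ a → 1 ≤ a → q a + q a + a * D ≤ a * D * (a * D)
  2q+b≤b² a 1≤a = begin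
    q a + q a + a * D ≡⟨ cong (q a + q a +_) (*-identityʳ (a * D)) ⟨
    q a + q a + a * D * 1 ≤⟨ +-monoʳ-≤ (q a + q a) (*-monoʳ-≤ (a * D) (*-mono-≤ 1≤a 1≤Q)) ⟩
    q a + q a + q a ≡⟨ e₁ (a * D) (a * Q) ⟩
    a * D * (3 * (a * Q)) ≤⟨ *-monoʳ-≤ (a * D) (*-monoˡ-≤ (a * Q) (lit 3)) ⟩
    a * D * (s * (a * Q)) ≡⟨ cong (a * D *_) (e₂ s a Q) ⟩
    a * D * (a * D) ∎
    where
    e₁ : ∀ b c → b * c + b * c + b * c ≡ b * (3 * c)
    e₁ = solve-∀
    e₂ : ∀ s a Q → s * (a * Q) ≡ a * (s * Q)
    e₂ = solve-∀

  stable-decay : ∀ a m′ → 1 ≤ a → 256 * R⁶ ≤ a * (Q * Q) * m′ → 2 * (s * (a + 3)) * N ≤ q a * m′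
  stable-decay a m′ 1≤a h = begin
    2 * (s * (a + 3)) * N ≡⟨ e₁ s (a + 3) N ⟩
    s * (a + 3) * (2 * N) ≤⟨ *-mono-≤ (*-monoʳ-≤ s (+-monoʳ-≤ a (*-mono-≤ 1≤a (≤-refl {3})))) 2N≤64R⁶ ⟩
    s * (a + a * 3) * (64 * R⁶) ≡⟨ e₂ s a R⁶ ⟩
    s * a * (256 * R⁶) ≤⟨ *-monoʳ-≤ (s * a) h ⟩
    s * a * (a * (Q * Q) * m′) ≡⟨ e₃ s a Q m′ ⟩
    q a * m′ ∎
    where
    e₁ : ∀ s b N → 2 * (s * b) * N ≡ s * b * (2 * N)
    e₁ = solve-∀
    e₂ : ∀ s a r → s * (a + a * 3) * (64 * r) ≡ s * a * (256 * r)
    e₂ = solve-∀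
    e₃ : ∀ s a Q m → s * a * (a * (Q * Q) * m) ≡ a * (s * Q) * (a * Q) * m
    e₃ = solve-∀

  R⁶≡ : R⁶ ≡ s ^ 12 * (Q * Q) * R⁴
  R⁶≡ = begin-equality
    R⁶ ≡⟨ R⁴R²≡R⁶ ⟨
    R⁴ * (R * R) ≡⟨ e R⁴ (s ^ 6) Q ⟩
    s ^ 6 * s ^ 6 * (Q * Q) * R⁴ ≡⟨ cong (λ z → z * (Q * Q) * R⁴) (s^-+ 6 6 12) ⟩
    s ^ 12 * (Q * Q) * R⁴ ∎
    where
    e : ∀ r p Q → r * (p * Q * (p * Q)) ≡ p * p * (Q * Q) * r
    e = solve-∀

  -- Here `a₀` originates: `R⁶` is `s ^ 12 * (Q * Q) * R⁴` and `T` lacks s^2 to be `R⁴`, so `a` must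
  -- exceed s^14 by a constant factor.
  stable-early : ∀ a → a₀ ≤ a → 256 * R⁶ ≤ a * (Q * Q) * T
  stable-early a a₀≤a = *-cancelˡ-≤ (s * s) {{m*n≢0 s s}} (begin
    s * s * (256 * R⁶) ≡⟨ cong (λ z → s * s * (256 * z)) R⁶≡ ⟩
    s * s * (256 * (s ^ 12 * (Q * Q) * R⁴)) ≡⟨ e₁ s (s ^ 12) (Q * Q) R⁴ ⟩
    256 * (s * (s * s ^ 12)) * ((Q * Q) * R⁴) ≤⟨ *-monoˡ-≤ _ (≤-trans (*-monoˡ-≤ (s ^ 14) (lit 256)) a₀≤a) ⟩
    a * ((Q * Q) * R⁴) ≡⟨ cong (λ z → a * ((Q * Q) * z)) (sym ssT≡R⁴) ⟩
    a * ((Q * Q) * (s * s * T)) ≡⟨ e₂ a (Q * Q) s T ⟩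
    s * s * (a * (Q * Q) * T) ∎)
    where
    e₁ : ∀ s p x r → s * s * (256 * (p * x * r)) ≡ 256 * (s * (s * p)) * (x * r)
    e₁ = solve-∀
    e₂ : ∀ a x s T → a * (x * (s * s * T)) ≡ s * s * (a * x * T)
    e₂ = solve-∀

  -- For a single vertex the factor that `a` supplied in `stable-early` has to come from the number
  -- of edges; hence the s^13 in `m`.
  stable-late : 256 * R⁶ ≤ 1 * (Q * Q) * m
  stable-late = begin
    256 * R⁶ ≡⟨ cong (256 *_) R⁶≡ ⟩
    256 * (s ^ 12 * (Q * Q) * R⁴) ≤⟨ *-monoˡ-≤ _ (lit 256) ⟩
    s * (s ^ 12 * (Q * Q) * R⁴) ≡⟨ e s (s ^ 12) (Q * Q) R⁴ ⟩
    1 * (Q * Q) * m ∎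
    where
    e : ∀ s p x r → s * (p * x * r) ≡ 1 * x * (s * p * r)
    e = solve-∀

  -- Up to powers of `s`, choosing 9 vertices costs `R ^ 27` and 14 edges gain `R ^ 28`. The
  -- remaining `R` exceeds the accumulated s^215, the largest power of `s` that `Q` has to dominate.
  few-codegree : n ^ 9 * δ * (t * 14) ^ 14 ≤ ℓ ^ 14
  few-codegree = *-cancelʳ-≤ _ _ ((R * R) ^ 14) {{m^n≢0 (R * R) 14 {{>-nonZero (*-mono-≤ 1≤R 1≤R)}}}} (begin
    n ^ 9 * δ * (t * 14) ^ 14 * (R * R) ^ 14 ≡⟨ *-assoc (n ^ 9 * δ) _ _ ⟩
    n ^ 9 * δ * ((t * 14) ^ 14 * (R * R) ^ 14) ≡⟨ cong (n ^ 9 * δ *_) (^-distribʳ-* 14 (t * 14) (R * R)) ⟨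
    n ^ 9 * δ * (t * 14 * (R * R)) ^ 14 ≤⟨ *-mono-≤ (*-monoˡ-≤ δ (^-monoˡ-≤ 9 n≤8R³)) (^-monoˡ-≤ 14 one) ⟩
    (8 * R³) ^ 9 * δ * (s ^ 15 * ℓ) ^ 14
        ≡⟨ cong₂ (λ a b → a * δ * b) (^-distribʳ-* 9 8 R³) (^-distribʳ-* 14 (s ^ 15) ℓ) ⟩
    8 ^ 9 * R³ ^ 9 * δ * ((s ^ 15) ^ 14 * ℓ ^ 14) ≡⟨ e₁ (8 ^ 9) (R³ ^ 9) δ ((s ^ 15) ^ 14) (ℓ ^ 14) ⟩
    ℓ ^ 14 * (R³ ^ 9 * (8 ^ 9 * (δ * (s ^ 15) ^ 14))) ≤⟨ *-monoʳ-≤ (ℓ ^ 14) (*-monoʳ-≤ (R³ ^ 9) constants) ⟩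
    ℓ ^ 14 * (R³ ^ 9 * R) ≡⟨ cong (ℓ ^ 14 *_) powers ⟩
    ℓ ^ 14 * (R * R) ^ 14 ∎)
    where
    e₁ : ∀ a b c d f → a * b * c * (d * f) ≡ f * (b * (a * (c * d)))
    e₁ = solve-∀
    one : t * 14 * (R * R) ≤ s ^ 15 * ℓ
    one = begin
      t * 14 * (R * R) ≤⟨ *-monoˡ-≤ (R * R) (*-monoˡ-≤ 14 t≤2m) ⟩
      2 * m * 14 * (R * R) ≡⟨ e (s ^ 13) R⁴ (R * R) ⟩
      28 * (s ^ 13 * (R⁴ * (R * R))) ≡⟨ cong (λ z → 28 * (s ^ 13 * z)) (trans R⁴R²≡R⁶ (sym sℓ≡R⁶)) ⟩
      28 * (s ^ 13 * (s * ℓ)) ≤⟨ *-monoˡ-≤ _ (lit 28) ⟩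
      s * (s ^ 13 * (s * ℓ)) ≡⟨ e′ s (s ^ 13) ℓ ⟩
      s ^ 15 * ℓ ∎
      where
      e : ∀ p r x → 2 * (p * r) * 14 * x ≡ 28 * (p * (r * x))
      e = solve-∀
      e′ : ∀ s p ℓ → s * (p * (s * ℓ)) ≡ s * (s * p) * ℓ
      e′ = solve-∀
    constants : 8 ^ 9 * (δ * (s ^ 15) ^ 14) ≤ R
    constants = begin
      8 ^ 9 * (δ * (s ^ 15) ^ 14) ≤⟨ *-monoˡ-≤ (δ * (s ^ 15) ^ 14) (^-monoˡ-≤ 3 (lit 512)) ⟩
      s ^ 3 * (s * s * (s ^ 15) ^ 14) ≡⟨ cong (λ z → s ^ 3 * (s * s * z)) (^-*-assoc s 15 14) ⟩
      s ^ 3 * (s * s * s ^ 210) ≡⟨ cong (s ^ 3 *_) (*-assoc s s (s ^ 210)) ⟩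
      s ^ 3 * s ^ 212 ≡⟨ s^-+ 3 212 215 ⟩
      s ^ 215 ≤⟨ s^≤Q 215 (toWitness {a? = 215 ≤? 229} tt) ⟩
      Q ≤⟨ Q≤R ⟩
      R ∎
    powers : R³ ^ 9 * R ≡ (R * R) ^ 14
    powers = begin-equality
      R³ ^ 9 * R ≡⟨ cong (λ z → z ^ 9 * R) (e R) ⟩
      (R ^ 3) ^ 9 * R ≡⟨ cong (_* R) (^-*-assoc R 3 9) ⟩
      R ^ 27 * R ≡⟨ *-comm (R ^ 27) R ⟩
      R ^ 28 ≡⟨ ^-*-assoc R 2 14 ⟨
      (R ^ 2) ^ 14 ≡⟨ cong (λ z → (R * z) ^ 14) (*-identityʳ R) ⟩
      (R * R) ^ 14 ∎
      where
      e : ∀ R → R * R * R ≡ R * (R * (R * 1))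
      e = solve-∀

  -- Since `f` is positive, one factor `X / ℓ` is available to absorb `s ^ 31 * δ`, where s^31 pays
  -- for the values of `f`.
  few-nearlyLast : ∀ f → 1 ≤ f → s ^ 31 * δ * (t * (M * M)) ^ f ≤ ℓ ^ f
  few-nearlyLast (suc f) _ = begin
    s ^ 31 * δ * (X * X ^ f) ≡⟨ *-assoc (s ^ 31 * δ) X (X ^ f) ⟨
    s ^ 31 * δ * X * X ^ f ≤⟨ *-mono-≤ X-small
        (^-monoˡ-≤ f (≤-trans (m≤o*m X (*-mono-≤ (1≤s^ 31) (*-mono-≤ 1≤s 1≤s))) X-small)) ⟩
    ℓ * ℓ ^ f ∎
    where
    X = t * (M * M)
    X-small : s ^ 31 * δ * X ≤ ℓ
    X-small = *-cancelˡ-≤ s (begin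
      s * (s ^ 31 * δ * (t * (M * M))) ≤⟨ *-monoʳ-≤ s (*-monoʳ-≤ (s ^ 31 * δ) (*-monoˡ-≤ (M * M) t≤s¹⁴R⁴)) ⟩
      s * (s ^ 31 * (s * s) * (s ^ 14 * R⁴ * (s ^ 31 * s ^ 31))) ≡⟨ e s (s ^ 31) (s ^ 14) R⁴ ⟩
      (s * (s * (s * (s ^ 31 * (s ^ 31 * (s ^ 31 * s ^ 14)))))) * R⁴
          ≡⟨ cong (λ z → s * (s * (s * z)) * R⁴) exponents ⟩
      s ^ 110 * R⁴ ≤⟨ *-monoˡ-≤ R⁴ (s^≤R² 110 (toWitness {a? = 110 ≤? 229} tt)) ⟩
      R * R * R⁴ ≡⟨ *-comm (R * R) R⁴ ⟩
      R⁴ * (R * R) ≡⟨ trans R⁴R²≡R⁶ (sym sℓ≡R⁶) ⟩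
      s * ℓ ∎)
      where
      e : ∀ s p r x → s * (p * (s * s) * (r * x * (p * p))) ≡ s * (s * (s * (p * (p * (p * r))))) * x
      e = solve-∀
      exponents : s ^ 31 * (s ^ 31 * (s ^ 31 * s ^ 14)) ≡ s ^ 107
      exponents = begin-equality
        s ^ 31 * (s ^ 31 * (s ^ 31 * s ^ 14)) ≡⟨ cong (λ z → s ^ 31 * (s ^ 31 * z)) (s^-+ 31 14 45) ⟩
        s ^ 31 * (s ^ 31 * s ^ 45) ≡⟨ cong (s ^ 31 *_) (s^-+ 31 45 76) ⟩
        s ^ 31 * s ^ 76 ≡⟨ s^-+ 31 76 107 ⟩
        s ^ 107 ∎

  a₀²≡ : a₀ * a₀ ≡ s ^ 30
  a₀²≡ = s^-+ 15 15 30

  suc-a₀²≤ : suc (a₀ * a₀) ≤ s ^ 31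
  suc-a₀²≤ = begin
    suc (a₀ * a₀) ≡⟨ cong suc a₀²≡ ⟩
    suc (s ^ 30) ≤⟨ +-monoˡ-≤ (s ^ 30) (1≤s^ 30) ⟩
    s ^ 30 + s ^ 30 ≡⟨ cong (s ^ 30 +_) (+-identityʳ (s ^ 30)) ⟨
    2 * s ^ 30 ≤⟨ *-monoˡ-≤ (s ^ 30) (lit 2) ⟩
    s ^ 31 ∎

  -- The uncovered vertices after the removal: `a₀` for the side, and fewer than 7 common neighbours
  -- for each of `a₀ * a₀` pairs.
  a₀+a₀²7≤M : a₀ + a₀ * a₀ * 7 ≤ M
  a₀+a₀²7≤M = begin
    a₀ + a₀ * a₀ * 7 ≤⟨ +-monoˡ-≤ (a₀ * a₀ * 7) (m≤o*m a₀ (1≤s^ 15)) ⟩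
    a₀ * a₀ + a₀ * a₀ * 7 ≡⟨ e (a₀ * a₀) ⟩
    8 * (a₀ * a₀) ≡⟨ cong (8 *_) a₀²≡ ⟩
    8 * s ^ 30 ≤⟨ *-monoˡ-≤ (s ^ 30) (lit 8) ⟩
    s ^ 31 ∎
    where
    e : ∀ x → x + x * 7 ≡ 8 * x
    e = solve-∀

  a₀²≤t : a₀ * a₀ ≤ t
  a₀²≤t = ≤-trans (≤-reflexive a₀²≡) (s^≤t 30 (toWitness {a? = 30 ≤? 229} tt))

  14≤t : 14 ≤ t
  14≤t = ≤-trans (lit 14) (≤-trans s≤Q (≤-trans Q≤T (m≤m+n T m)))

  3≤2T : 3 ≤ T + T
  3≤2T = ≤-trans (lit 3) (≤-trans s≤Q (≤-trans Q≤T (m≤m+n T T)))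

  -- The largest size for which a set, `D` neighbours per element and `y + y` further vertices fit
  -- into `n`; the last are needed for expansion.
  a⋆ : ℕ
  a⋆ = (n ∸ (y + y)) / suc D

  36y≤n : 36 * y ≤ n
  36y≤n = ≤-trans (*-monoˡ-≤ y (lit 36)) (≤-trans (≤-reflexive sy≡R³) R³≤n)

  2y≤n : y + y ≤ n
  2y≤n = ≤-trans (≤-reflexive (cong (y +_) (sym (+-identityʳ y))))
      (≤-trans (*-monoˡ-≤ y (toWitness {a? = 2 ≤? 36} tt)) 36y≤n)

  a⋆-fits : a⋆ * suc D + (y + y) ≤ n
  a⋆-fits = ≤-trans (+-monoˡ-≤ (y + y) (m/n*n≤m (n ∸ (y + y)) (suc D))) (≤-reflexive (m∸n+n≡m 2y≤n))

  fits : ∀ {a} → a ≤ a⋆ → a + a * D + (y + y) ≤ n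
  fits {a} a≤ = ≤-trans (+-monoˡ-≤ (y + y) (≤-trans (≤-reflexive (sym (*-suc a D))) (*-monoˡ-≤ (suc D) a≤)))
      a⋆-fits

  sucD≤y : suc D ≤ y
  sucD≤y = begin
    suc D ≤⟨ +-monoˡ-≤ D (≤-trans (s≤s z≤n) 4≤D) ⟩
    D + D ≡⟨ cong (D +_) (+-identityʳ D) ⟨
    2 * D ≤⟨ *-monoˡ-≤ D (≤-trans (lit 2)
        (*-mono-≤ {s} {s} {1} ≤-refl (*-mono-≤ (1≤s^ 3)
        (*-mono-≤ (1≤s^ 6) (*-mono-≤ (1≤s^ 6) (*-mono-≤ 1≤Q 1≤Q)))) |> ≤-trans
        (≤-reflexive (sym (*-identityʳ s))))) ⟩
    s * (s ^ 3 * (s ^ 6 * (s ^ 6 * (Q * Q)))) * D ≡⟨ e s (s ^ 3) (s ^ 6) Q ⟩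
    y ∎
    where
    e : ∀ s a p Q → s * (a * (p * (p * (Q * Q)))) * (s * Q) ≡ s * (s * a) * (p * (p * (Q * Q * Q)))
    e = solve-∀

  12a⋆≤n : 12 * a⋆ ≤ n
  12a⋆≤n = begin
    12 * a⋆ ≡⟨ *-comm 12 a⋆ ⟩
    a⋆ * 12 ≤⟨ *-monoʳ-≤ a⋆ (≤-trans (lit 12) (≤-trans (m≤m*n s Q {{>-nonZero 1≤Q}}) (n≤1+n D))) ⟩
    a⋆ * suc D ≤⟨ m+n≤o⇒m≤o (a⋆ * suc D) a⋆-fits ⟩
    n ∎

  3a⋆≤n : 3 * a⋆ ≤ n
  3a⋆≤n = ≤-trans (*-monoˡ-≤ a⋆ (toWitness {a? = 3 ≤? 12} tt)) 12a⋆≤n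

  -- Rounding down `a⋆` gives `n < 2 y + (a⋆ + 1)(D + 1)`. Compared with `a⋆ D`, three times the
  -- excess is at most `n`, as `y` is at most `n / 36` and `a⋆` at most `n / 12`.
  2n<3a⋆D : 2 * n < 3 * (a⋆ * D)
  2n<3a⋆D = +-cancelʳ-< n _ _ (begin-strict
    2 * n + n ≡⟨ e₁ n ⟩
    3 * n <⟨ *-monoʳ-< 3 n< ⟩
    3 * (y + y + (suc D + a⋆ * suc D)) ≡⟨ e₂ y D a⋆ ⟩
    3 * (a⋆ * D) + (6 * y + 3 * a⋆ + 3 * suc D) ≤⟨ +-monoʳ-≤ (3 * (a⋆ * D)) slack ⟩
    3 * (a⋆ * D) + n ∎)
    where
    e₁ : ∀ n → 2 * n + n ≡ 3 * n
    e₁ = solve-∀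
    e₂ : ∀ y D a → 3 * (y + y + (suc D + a * suc D)) ≡ 3 * (a * D) + (6 * y + 3 * a + 3 * suc D)
    e₂ = solve-∀
    e₃ : ∀ y a c → 4 * (6 * y + 3 * a + 3 * c) ≡ 24 * y + 12 * c + 12 * a
    e₃ = solve-∀
    e₄ : ∀ y → 24 * y + 12 * y ≡ 36 * y
    e₄ = solve-∀
    n< : n < y + y + (suc D + a⋆ * suc D)
    n< = begin-strict
      n ≡⟨ m+[n∸m]≡n 2y≤n ⟨
      y + y + (n ∸ (y + y)) ≡⟨ cong (y + y +_) (m≡m%n+[m/n]*n (n ∸ (y + y)) (suc D)) ⟩
      y + y + ((n ∸ (y + y)) % suc D + a⋆ * suc D)
          <⟨ +-monoʳ-< (y + y) (+-monoˡ-< (a⋆ * suc D) (m%n<n (n ∸ (y + y)) (suc D))) ⟩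
      y + y + (suc D + a⋆ * suc D) ∎
    slack : 6 * y + 3 * a⋆ + 3 * suc D ≤ n
    slack = *-cancelˡ-≤ 4 (begin
      4 * (6 * y + 3 * a⋆ + 3 * suc D) ≡⟨ e₃ y a⋆ (suc D) ⟩
      24 * y + 12 * suc D + 12 * a⋆ ≤⟨ +-mono-≤ (+-monoʳ-≤ (24 * y) (*-monoʳ-≤ 12 sucD≤y)) 12a⋆≤n ⟩
      24 * y + 12 * y + n ≡⟨ cong (_+ n) (e₄ y) ⟩
      36 * y + n ≤⟨ +-monoˡ-≤ n 36y≤n ⟩
      n + n ≡⟨ cong (n +_) (+-identityʳ n) ⟨
      2 * n ≤⟨ *-monoˡ-≤ n (toWitness {a? = 2 ≤? 4} tt) ⟩
      4 * n ∎)

  1≤a⋆ : 1 ≤ a⋆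
  1≤a⋆ = positive-factor a⋆ 2n<3a⋆D

  suc-a⋆≤n : suc a⋆ ≤ n
  suc-a⋆≤n = begin
    suc a⋆ ≤⟨ +-monoˡ-≤ a⋆ 1≤a⋆ ⟩
    a⋆ + a⋆ ≡⟨ cong (a⋆ +_) (+-identityʳ a⋆) ⟨
    2 * a⋆ ≤⟨ *-monoˡ-≤ a⋆ (toWitness {a? = 2 ≤? 3} tt) ⟩
    3 * a⋆ ≤⟨ 3a⋆≤n ⟩
    n ∎

-- Collecting the exceptional events

Rare-⊎ : ∀ {A : Set} {L : List A} {d P Q} → Rare L (2 * d) P → Rare L (2 * d) Q → Rare L d (λ σ → P σ ⊎ Q σ)
Rare-⊎ {L = L} {d} {P} {Q} p q = Bound-⊆ choose
    (Rare-∃ {P = either} {c = 2} {d} (true ∷ false ∷ []) (s≤s z≤n) ≤-refl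
  λ { true _ → p ; false _ → q })
  where
  either : Bool → List _ → Set
  either true = P
  either false = Q
  choose : ∀ σ → _ → P σ ⊎ Q σ → ∃ λ b → b ∈ₗ true ∷ false ∷ [] × either b σ
  choose σ _ (inj₁ h) = true , here refl , h
  choose σ _ (inj₂ h) = false , there (here refl) , h

Rare-range : ∀ {A : Set} {L : List A} {d} {P : ℕ → List A → Set} c b → suc b ≤ c →
  (∀ i → 1 ≤ i → i ≤ b → Rare L (c * d) (P i)) →
  Rare L d (λ σ → ∃ λ i → 1 ≤ i × i ≤ b × P i σ)
Rare-range {P = P} c b b<c r = Bound-⊆ (λ { σ _ (i , 1≤i , i≤b , h) → i , ∈-upTo⁺ (s≤s i≤b) , 1≤i , h })
  -- `upTo (suc b)` also lists 0, which the event excludes; this is why `c` has to bound `suc b`.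
  (Rare-∃ {P = λ i σ → 1 ≤ i × P i σ} (upTo (suc b)) (≤-trans (s≤s z≤n) b<c)
      (≤-trans (≤-reflexive (length-upTo (suc b))) b<c)
    λ i i∈ → Bound-dec (1 ≤? i) (λ _ _ → proj₁) λ 1≤i → Bound-⊆ (λ _ _ → proj₂) (r i 1≤i (≤-pred (∈-upTo⁻ i∈))))

Exceptions : ∀ n → ℕ → (Ordering n → Set) → Set
Exceptions n k P = Σ (List (Ordering n)) λ B →
    (∀ σ → IsOrdering n σ → ¬ P σ → σ ∈ₗ B) × (k * length B < ((n C 2) !))

-- Rarity `suc k` gives the strict inequality for `k` if the list is nonempty; otherwise a factorial
-- is positive.
rare⇒exceptions : ∀ {n k} {P Q : Ordering n → Set} → Rare (allEdges n) (suc k) Q →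
  (∀ {σ} → IsOrdering n σ → ¬ Q σ → P σ) → Exceptions n k P
rare⇒exceptions {n} {k} {P} (bound B covering small) typical = B ,
  -- Membership in `B` is decidable, so it is enough that orderings outside `B` satisfy `P`.
  (λ σ σ↭ ¬P → decidable-stable (DecMembership._∈?_ (LP.≡-dec (≡-dec FP._≟_ FP._≟_)) σ B)
      (λ σ∉ → ¬P (typical σ↭ (σ∉ ∘ covering σ σ↭)))) , few B small
  where
  few : ∀ (B : List (Ordering n)) → suc k * length B ≤ 1 * length (allEdges n) ! → k * length B < (n C 2) !
  few [] _ = ≤-trans (s≤s (≤-reflexive (*-zeroʳ k))) (1≤n! (n C 2))
  few B@(_ ∷ _) h = begin-strict
    k * length B <⟨ m<n+m (k * length B) (s≤s z≤n) ⟩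
    suc k * length B ≤⟨ h ⟩
    1 * length (allEdges n) ! ≡⟨ *-identityˡ _ ⟩
    length (allEdges n) ! ≡⟨ cong _! (length-allEdges≡nC2 n) ⟩
    (n C 2) ! ∎
    where open ≤-Reasoning

module Assembly (n s Q k : ℕ) (large : 20000 ≤ s) (k<s : k < s) (n≤2^s : n ≤ 2 ^ s) (Q-large : s ^ 229 ≤ Q)
  (R³≤n : s ^ 6 * Q * (s ^ 6 * Q) * (s ^ 6 * Q) ≤ n)
  (n≤8R³ : n ≤ 8 * (s ^ 6 * Q * (s ^ 6 * Q) * (s ^ 6 * Q))) where

  open Parameters n s Q (length (allEdges n)) large n≤2^s Q-large R³≤n n≤8R³ (length-allEdges n)

  z : Fin n
  z = fromℕ< 1≤n

  E = allEdges n

  Early SomeSparse SomeStable LateStable SomeLast Atypical : Ordering n → Set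
  Early σ = covered (take (T + T) σ) z ≡ true
  SomeSparse σ = ∃ λ a → 1 ≤ a × a ≤ a⋆ × Sparse T a (a * D) σ
  SomeStable σ = ∃ λ a → 1 ≤ a × a ≤ a⋆ × a₀ ≤ a × StableNeighbourhood T T a (a * D) σ
  LateStable σ = StableNeighbourhood T m 1 (1 * D) σ
  SomeLast σ = ∃ λ f → 1 ≤ f × f ≤ a₀ * a₀ × NearlyLast t M f σ
  Atypical σ = Early σ ⊎ (SomeSparse σ ⊎ (SomeStable σ ⊎ (LateStable σ ⊎ (Codegree t 7 σ ⊎ SomeLast σ))))

  rare-early : Rare E δ Early
  rare-early = Rare-covered z 1≤ℓ 3≤2T ℓ+2T≤N few-edges-early

  rare-sparse : Rare E δ SomeSparse
  rare-sparse = Rare-range {P = λ a → Sparse T a (a * D)} n a⋆ suc-a⋆≤n λ a 1≤a a≤ →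
    Rare-sparse {x = y + y} {q = a * y} {e = s * (a + a * D + 3)} z (fits a≤)
      (≤-reflexive (sym (*-distribˡ-+ a y y))) (*-mono-≤ 1≤a 1≤y) 1≤N (choices (a + a * D)) (sparse-decay a 1≤a)

  rare-stable : ∀ a m′ → 1 ≤ a → 256 * R⁶ ≤ a * (Q * Q) * m′ →
    Rare E (n * δ) (StableNeighbourhood T m′ a (a * D))
  rare-stable a m′ 1≤a h = Rare-stableNeighbourhood {q = q a} {e = s * (a + 3)} 1≤n T≤N 1≤N (2q+b≤b² a 1≤a)
      (1≤q a 1≤a)
    (choices a) (stable-decay a m′ 1≤a h)

  rare-someStable : Rare E δ SomeStable
  rare-someStable = Rare-range {P = λ a σ →
      a₀ ≤ a × StableNeighbourhood T T a (a * D) σ} n a⋆ suc-a⋆≤n λ a 1≤a _ →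
    Bound-dec (a₀ ≤? a) (λ _ _ → proj₁) λ a₀≤a →
        Bound-⊆ (λ _ _ → proj₂) (rare-stable a T 1≤a (stable-early a a₀≤a))

  rare-lateStable : Rare E δ LateStable
  rare-lateStable = Rare-weaken (m≤o*m δ 1≤n) (rare-stable 1 m ≤-refl stable-late)

  rare-codegree : Rare E δ (Codegree t 7)
  rare-codegree = Rare-codegree 1≤n 1≤ℓ 14≤t ℓ+t≤N few-codegree

  rare-last : Rare E δ SomeLast
  rare-last = Rare-range {P = NearlyLast t M} (s ^ 31) (a₀ * a₀) suc-a₀²≤ λ f 1≤f f≤ →
    Rare-nearlyLast {M = M} {f} 1≤ℓ (≤-trans f≤ a₀²≤t) ℓ+t≤N (few-nearlyLast f 1≤f)

  rare-atypical : Rare E (suc k) Atypical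
  rare-atypical =
    Rare-⊎ (w 1 rare-early) (Rare-⊎ (w 2 rare-sparse) (Rare-⊎ (w 3 rare-someStable)
      (Rare-⊎ (w 4 rare-lateStable) (Rare-⊎ (w 5 rare-codegree) (w 5 rare-last)))))
    where
    double : ℕ → ℕ
    double zero = suc k
    double (suc j) = 2 * double j
    double≡ : ∀ j → double j ≡ 2 ^ j * suc k
    double≡ zero = sym (*-identityˡ (suc k))
    double≡ (suc j) = trans (cong (2 *_) (double≡ j)) (sym (*-assoc 2 (2 ^ j) (suc k)))
    -- The reason for `δ = s * s`: one `s` pays for splitting into six events, the other for
    -- `suc k`.
    w : ∀ j {_ : True (2 ^ j ≤? 20000)} {P} → Rare E δ P → Rare E (double j) P
    w j {h} = Rare-weaken (≤-trans (≤-reflexive (double≡ j)) (*-mono-≤ (≤-trans (toWitness h) large) k<s))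

  typical : ∀ {σ} → ¬ Atypical σ → Typical T m a₀ a⋆ D 7 M z σ
  typical ¬a = record
    { uncovered-early = ≢true⇒false (¬a ∘ inj₁)
    ; expanding = λ a 1≤a a≤ h → ¬a (inj₂ (inj₁ (a , 1≤a , a≤ , h)))
    ; unstable = λ a a₀≤a a≤ h → ¬a (inj₂ (inj₂ (inj₁ (a , ≤-trans (1≤s^ 15) a₀≤a , a≤ , a₀≤a , h))))
    ; unstable-late = λ h → ¬a (inj₂ (inj₂ (inj₂ (inj₁ h))))
    ; codegree = λ h → ¬a (inj₂ (inj₂ (inj₂ (inj₂ (inj₁ h)))))
    ; notLast = λ f 1≤f f≤ h → ¬a (inj₂ (inj₂ (inj₂ (inj₂ (inj₂ (f , 1≤f , f≤ , h))))))
    }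

  hittingTimes : ∀ {σ} → IsOrdering n σ → ¬ Atypical σ → HittingTimesEqual σ
  hittingTimes σ↭ ¬a = typical⇒hittingTimesEqual σ↭ (typical ¬a)
      (≤-trans (lit 3) s≤n) 1≤a⋆ 2n<3a⋆D 3a⋆≤n a₀+a₀²7≤M

  exceptions : Exceptions n k HittingTimesEqual
  exceptions = rare⇒exceptions rare-atypical hittingTimes

-- Existence of the scales

cube : ℕ → ℕ
cube x = x * x * x

cube-mono : ∀ {x y} → x ≤ y → cube x ≤ cube y
cube-mono h = *-mono-≤ (*-mono-≤ h h) h

Scales : ℕ → ℕ → ℕ → ℕ → Set
Scales e d n s = ∃ λ Q → 20000 ≤ s × d ≤ s × n ≤ 2 ^ s × s ^ e ≤ Q × cube (s ^ 6 * Q) ≤ n × n ≤ 8 * cube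
    (s ^ 6 * Q)

-- The quotient of `s` by `r = suc j` lies below its own power of 2, so `s ≤ r * 2 ^ (s / r)`; now
-- take `r`-th powers.
power≤exponential : ∀ j s → s ^ suc j ≤ suc j ^ suc j * 2 ^ s
power≤exponential j s = begin
  s ^ r ≤⟨ ^-monoˡ-≤ r s≤ ⟩
  (r * 2 ^ q) ^ r ≡⟨ ^-distribʳ-* r r (2 ^ q) ⟩
  r ^ r * (2 ^ q) ^ r ≡⟨ cong (r ^ r *_) (^-*-assoc 2 q r) ⟩
  r ^ r * 2 ^ (q * r) ≤⟨ *-monoʳ-≤ (r ^ r) (^-monoʳ-≤ 2 (m/n*n≤m s r)) ⟩
  r ^ r * 2 ^ s ∎
  where
  open ≤-Reasoning
  r = suc j
  q = s / r
  s≤ : s ≤ r * 2 ^ q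
  s≤ = begin
    s ≡⟨ m≡m%n+[m/n]*n s r ⟩
    s % r + q * r ≤⟨ +-monoˡ-≤ (q * r) (<⇒≤ (m%n<n s r)) ⟩
    suc q * r ≤⟨ *-monoˡ-≤ r (n<2^n q) ⟩
    2 ^ q * r ≡⟨ *-comm (2 ^ q) r ⟩
    r * 2 ^ q ∎

-- Apply the previous bound to the next exponent; the extra factor `s` outweighs the constant.
exponential-dominates : ∀ j → ∃ λ c → ∀ s → c ≤ s → s ^ j ≤ 2 ^ s
exponential-dominates j = suc (suc j ^ suc j) , λ { s@(suc _) (s≤s c≤) →
  *-cancelˡ-≤ s (≤-trans (power≤exponential j s) (*-monoˡ-≤ (2 ^ s) (≤-trans c≤ (n≤1+n _)))) }

-- The exponent is `705 = 3 * (6 + 229)`, and the 8 in the upper bound is the cost of replacing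
-- `suc Q` by `Q + Q`.
cubeRoot : ∀ {d n s} → 20000 ≤ s → d ≤ s → n ≤ 2 ^ s → s ^ 705 ≤ n → Scales 229 d n s
cubeRoot {d} {n} {s} large d≤s n≤2^s s^705≤n
  with least (λ Q → n < cube (s ^ 6 * suc Q)) (λ Q → n <? cube (s ^ 6 * suc Q)) n n-big
  where
  1≤s : 1 ≤ s
  1≤s = ≤-trans (toWitness {a? = 1 ≤? 20000} _) large
  n-big : n < cube (s ^ 6 * suc n)
  n-big = ≤-trans (m≤o*m (suc n) (1≤^ 6 1≤s)) (m≤o*m _ (*-mono-≤ pos pos))
    where
    pos : 1 ≤ s ^ 6 * suc n
    pos = *-mono-≤ {1} (1≤^ 6 1≤s) (s≤s z≤n)
... | Q , _ , n<cube , Q-least = Q , large , d≤s , n≤2^s , Q-large , lower Q Q-least 1≤Q , upper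
  where
  open ≤-Reasoning
  s^-+ : ∀ a b c {_ : True (a + b ≟ c)} → s ^ a * s ^ b ≡ s ^ c
  s^-+ a b c {h} = trans (sym (^-distribˡ-+-* s a b)) (cong (s ^_) (toWitness h))
  exponents : cube (s ^ 6 * s ^ 229) ≡ s ^ 705
  exponents = begin-equality
    cube (s ^ 6 * s ^ 229) ≡⟨ cong cube (s^-+ 6 229 235) ⟩
    s ^ 235 * s ^ 235 * s ^ 235 ≡⟨ cong (_* s ^ 235) (s^-+ 235 235 470) ⟩
    s ^ 470 * s ^ 235 ≡⟨ s^-+ 470 235 705 ⟩
    s ^ 705 ∎
  Q-large : s ^ 229 ≤ Q
  Q-large = ≮⇒≥ λ Q< → <-irrefl refl (begin-strict
    n <⟨ n<cube ⟩
    cube (s ^ 6 * suc Q) ≤⟨ cube-mono (*-monoʳ-≤ (s ^ 6) Q<) ⟩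
    cube (s ^ 6 * s ^ 229) ≡⟨ exponents ⟩
    s ^ 705 ≤⟨ s^705≤n ⟩
    n ∎)
  1≤Q : 1 ≤ Q
  1≤Q = ≤-trans (1≤^ 229 (≤-trans (toWitness {a? = 1 ≤? 20000} _) large)) Q-large
  lower : ∀ Q → (∀ r → r < Q → ¬ (n < cube (s ^ 6 * suc r))) → 1 ≤ Q → cube (s ^ 6 * Q) ≤ n
  lower (suc Q) Q-least _ = ≮⇒≥ (Q-least Q ≤-refl)
  double-cube : ∀ p Q → p * (Q + Q) * (p * (Q + Q)) * (p * (Q + Q)) ≡ 8 * (p * Q * (p * Q) * (p * Q))
  double-cube = solve-∀
  upper : n ≤ 8 * cube (s ^ 6 * Q)
  upper = begin
    n ≤⟨ <⇒≤ n<cube ⟩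
    cube (s ^ 6 * suc Q) ≤⟨ cube-mono (*-monoʳ-≤ (s ^ 6) (+-monoˡ-≤ Q 1≤Q)) ⟩
    cube (s ^ 6 * (Q + Q)) ≡⟨ double-cube (s ^ 6) Q ⟩
    8 * cube (s ^ 6 * Q) ∎

halve-power : ∀ {n s} → 1 ≤ s → (∀ r → r < s → ¬ (n < 2 ^ r)) → 2 ^ s ≤ 2 * n
halve-power {s = suc s} _ s-least = *-monoʳ-≤ 2 (≮⇒≥ (s-least s ≤-refl))

-- s is the binary length of n, and Q the largest number with (s⁶Q)³ ≤ n.
scales : ∀ {c} → (∀ s → c ≤ s → s ^ 706 ≤ 2 ^ s) → ∀ d n → 2 ^ (c + (20000 + d)) ≤ n → ∃ (Scales 229 d n)
scales {c} dominates d n 2^C≤n with s , _ , n<2^s ,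
    s-least ← least (λ s → n < 2 ^ s) (λ s → n <? 2 ^ s) n (n<2^n n) =
  s , cubeRoot large (≤-trans (m≤n+m d (c + 20000)) (≤-trans (≤-reflexive (+-assoc c 20000 d)) C≤s))
      (<⇒≤ n<2^s) s^705≤n
  where
  C≤s : c + (20000 + d) ≤ s
  C≤s = <⇒≤ (≰⇒> λ s≤C → <-irrefl refl (<-≤-trans n<2^s (≤-trans (^-monoʳ-≤ 2 s≤C) 2^C≤n)))
  large : 20000 ≤ s
  large = ≤-trans (≤-trans (m≤m+n 20000 d) (m≤n+m (20000 + d) c)) C≤s
  s^705≤n : s ^ 705 ≤ n
  -- Minimality of `s` gives only `2 ^ s ≤ 2 * n`; the exponent 706 supplies one more `s` to absorb
  -- this 2.
  s^705≤n = *-cancelˡ-≤ 2 (≤-trans (*-monoˡ-≤ (s ^ 705) (≤-trans (toWitness {a? = 2 ≤? 20000} _) large))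
    (≤-trans (dominates s (≤-trans (m≤m+n c _) C≤s))
        (halve-power (≤-trans (toWitness {a? = 1 ≤? 20000} _) large) s-least)))

abstract
  -- The value exceeds `2 ^ (707 ^ 707)`; being abstract, it is known only through its property.
  threshold : ∀ d → ∃ λ N₀ → ∀ n → N₀ ≤ n → ∃ (Scales 229 d n)
  threshold d = let c , dominates = exponential-dominates 706 in 2 ^ (c + (20000 + d)) , scales dominates d

theorem3p2 : AAS HittingTimesEqual
theorem3p2 k _ with N₀ , scale ← threshold (suc k) = N₀ , λ n N₀≤n → conclude n (scale n N₀≤n)
  where
  conclude : ∀ n → ∃ (Scales 229 (suc k) n) → Exceptions n k HittingTimesEqual
  conclude n (s , Q , large , k<s , n≤2^s , Q-large , R³≤n , n≤8R³) =
    Assembly.exceptions n s Q k large k<s n≤2^s Q-large R³≤n n≤8R³
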